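{- Let $n>k>0$ be integers and let $L=\{\ell_1,\ell_2,\ldots,\ell_s\}\subset[0,k-1]$ with $\ell_1<\ell_2<\cdots<\ell_s$. Suppose $L$ contains $b$ full runs of consecutive integers, and let $m_i$ be the length of the $i$th full run for $1\le i\le b$. Set \[K(k,L)=\prod_{i=1}^{b}m_i!\cdot\frac{\binom{k}{k-\ell_1}\binom{k-\ell_1-1}{k-\ell_2}\cdots\binom{k-\ell_{s-1}-1}{k-\ell_s}}{\prod_{i=1}^s(\ell_i+1)(k-\ell_i)}.\] Then there is a constant $c$ depending on $k$ and $L$ but not on $n$ such that \[\vartheta(G(n,k,L))\ge K(k,L)\,n^s-cn^{s-1},\] and a constant $C$ depending on $k$ and $L$ but not on $n$ such that \[\vartheta(G(n,k,L))\le K(k,L)\,n^s+Cn^{s-1}.\] In particular, for fixed $k$ and $L$, $\vartheta(G(n,k,L))=\Theta(n^{|L|})$ as $n\to\infty$.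
   Context: For integers $a\le b$, $[a,b]=\{a,a+1,\ldots,b\}$ and $[b]=[1,b]$; $\binom{[n]}{k}$ is the family of $k$-subsets of $[n]$. For $L\subset[0,k-1]$, the generalized Johnson graph $G(n,k,L)$ has vertex set $\binom{[n]}{k}$, with $A,B$ adjacent iff $|A\cap B|\notin L$. For a graph $G$ on $N$ vertices, the Lovász number is $\vartheta(G)=\max\sum_{i,j}b_{ij}$ over all $N\times N$ positive semidefinite matrices $B=(b_{ij})$ with trace $1$ and $b_{ij}=0$ whenever $ij$ is an edge. For $L=\{\ell_1<\cdots<\ell_s\}$, a subset $\{\ell_m,\ldots,\ell_{m+p}\}$ is a run if $\ell_{m+i}=\ell_m+i$ for $0\le i\le p$; it is a full run if moreover ($m=1$ or $\ell_{m-1}<\ell_m-1$) and ($m+p=s$ or $\ell_{m+p+1}>\ell_{m+p}+1$). $L$ decomposes uniquely into full runs; the length of a run is its cardinality. -}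

module Defs where

open import Algebra.Bundles using (CommutativeRing)
import Algebra.Properties.Ring as RingProperties
import Algebra.Properties.Semiring.Exp as SemiringExp
import Algebra.Properties.Semiring.Mult as SemiringMult
import Algebra.Properties.Semiring.Sum as SemiringSum
open import Data.Bool.Base using (true; false)
open import Data.Empty using (⊥-elim)
open import Data.Fin.Base as Fin using (Fin; zero; suc; toℕ)
import Data.Fin.Properties as Finₚ
open import Data.Fin.Subset using (Subset; inside; outside; ∣_∣; _∩_)
open import Data.Fin.Subset.Properties using (∩-comm)
open import Data.Integer.Base as ℤ using (ℤ; +_; -[1+_])
open import Data.List.Base
  using (List; []; _∷_; map; allFin; cartesianProduct; filter; length; lookup)
open import Data.List.Membership.Propositional using (_∉_)
open import Data.Nat.Base as ℕ using (ℕ; zero; suc; _∸_; _!)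
open import Data.Nat.Combinatorics using (_C_)
open import Data.Nat.ListAction using (product)
import Data.Nat.Properties as ℕₚ
open import Data.Product.Base using (Σ; ∃; ∃₂; _×_; _,_; proj₁; proj₂; uncurry)
open import Data.Sum.Base using (_⊎_; inj₁; inj₂)
open import Data.Sum.Function.Propositional using (_⊎-↔_)
open import Data.Vec.Base using ([]; _∷_)
open import Function.Base using (_∘_)
open import Function.Bundles using (_↔_; mk↔ₛ′; Inverse)
import Function.Construct.Composition as Comp
import Function.Construct.Symmetry as Symm
open import Level using (0ℓ)
import Relation.Binary.Construct.StrictToNonStrict as StrictToNonStrict
open import Relation.Binary.Bundles using (StrictPartialOrder)
open import Relation.Binary.Core using (Rel)
open import Relation.Binary.Definitions using (Symmetric; Irreflexive; tri<; tri≈; tri>)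
open import Relation.Binary.PropositionalEquality as ≡ using (_≡_; _≢_)
import Relation.Binary.Reasoning.StrictPartialOrder as SPOReasoning
open import Relation.Binary.Structures using (IsStrictTotalOrder)
open import Relation.Nullary.Decidable.Core using (Dec; yes; no; _×-dec_; _→-dec_)
open import Relation.Nullary.Negation.Core using (¬_)

-- The real numbers, given by their axioms: a complete ordered field is unique
-- up to isomorphism.  The supremum is required to be approximated from within
-- the set; classically this is the same as being the least upper bound, and it
-- is what makes the axioms imply excluded middle (see `em` below).
record CompleteOrderedField : Set₁ where
  field
    commutativeRing : CommutativeRing 0ℓ 0ℓ

  open CommutativeRing commutativeRing public hiding (zero)

  infix  4 _<_ _≤_
  infix  9 _⁻¹

  field
    _<_                : Rel Carrier 0ℓ
    isStrictTotalOrder : IsStrictTotalOrder _≈_ _<_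
    0≉1                : 0# ≉ 1#
    +-monoʳ-<          : ∀ z {x y} → x < y → z + x < z + y
    *-pos              : ∀ {x y} → 0# < x → 0# < y → 0# < x * y
    _⁻¹                : Carrier → Carrier
    ⁻¹-cong            : ∀ {x y} → x ≈ y → x ⁻¹ ≈ y ⁻¹
    ⁻¹-inverseʳ        : ∀ {x} → x ≉ 0# → x * x ⁻¹ ≈ 1#

  _≤_ : Rel Carrier 0ℓ
  _≤_ = StrictToNonStrict._≤_ _≈_ _<_

  IsSupremum : (Carrier → Set) → Carrier → Set
  IsSupremum S s = (∀ x → S x → x ≤ s) × (∀ y → y < s → ∃ λ x → S x × y < x)

  field
    complete : (S : Carrier → Set) → ∃ S → (∃ λ u → ∀ x → S x → x ≤ u) →
               ∃ (IsSupremum S)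

-- Finite simple graphs on a nonempty vertex set.
record Graph : Set₁ where
  infix 4 _~_
  field
    order    : ℕ
    Vertex   : Set
    enum     : Vertex ↔ Fin order
    nonempty : Vertex
    _~_      : Rel Vertex 0ℓ
    ~-sym    : Symmetric _~_
    ~-irrefl : Irreflexive _≡_ _~_

KSubset : ℕ → ℕ → Set
KSubset n k = Σ (Subset n) λ A → ∣ A ∣ ≡ k

private
  KSubset-≡ : ∀ {n k} {A B : KSubset n k} → proj₁ A ≡ proj₁ B → A ≡ B
  KSubset-≡ {A = A , p} {B = .A , q} ≡.refl = ≡.cong (A ,_) (ℕₚ.≡-irrelevant p q)

  split₀ : ∀ n → KSubset (suc n) 0 ↔ KSubset n 0
  split₀ n = mk↔ₛ′ f g (λ _ → ≡.refl) gf
    where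
    f : KSubset (suc n) 0 → KSubset n 0
    f (outside ∷ A , p) = A , p
    g : KSubset n 0 → KSubset (suc n) 0
    g (A , p) = outside ∷ A , p
    gf : ∀ A → g (f A) ≡ A
    gf (outside ∷ A , p) = ≡.refl

  split₊ : ∀ n k → KSubset (suc n) (suc k) ↔ (KSubset n k ⊎ KSubset n (suc k))
  split₊ n k = mk↔ₛ′ f g fg gf
    where
    f : KSubset (suc n) (suc k) → KSubset n k ⊎ KSubset n (suc k)
    f (inside  ∷ A , p) = inj₁ (A , ℕₚ.suc-injective p)
    f (outside ∷ A , p) = inj₂ (A , p)
    g : KSubset n k ⊎ KSubset n (suc k) → KSubset (suc n) (suc k)
    g (inj₁ (A , p)) = inside ∷ A , ≡.cong suc p
    g (inj₂ (A , p)) = outside ∷ A , p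
    fg : ∀ x → f (g x) ≡ x
    fg (inj₁ _) = ≡.cong inj₁ (KSubset-≡ ≡.refl)
    fg (inj₂ _) = ≡.refl
    gf : ∀ A → g (f A) ≡ A
    gf (inside  ∷ A , p) = KSubset-≡ ≡.refl
    gf (outside ∷ A , p) = ≡.refl

  enumKSubsets : ∀ n k → ∃ λ N → KSubset n k ↔ Fin N
  enumKSubsets zero zero =
    1 , mk↔ₛ′ (λ _ → zero) (λ _ → [] , ≡.refl) (λ { zero → ≡.refl })
              (λ { ([] , p) → KSubset-≡ ≡.refl })
  enumKSubsets zero (suc k) = 0 , mk↔ₛ′ (λ { ([] , ()) }) (λ ()) (λ ()) (λ { ([] , ()) })
  enumKSubsets (suc n) zero with enumKSubsets n zero
  ... | N , e = N , Comp.inverse (split₀ n) e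
  enumKSubsets (suc n) (suc k) with enumKSubsets n k | enumKSubsets n (suc k)
  ... | N , e | M , e′ =
    N ℕ.+ M , Comp.inverse (Comp.inverse (split₊ n k) (e ⊎-↔ e′)) (Symm.inverse Finₚ.+↔⊎)

  someKSubset : ∀ {n k} → k ℕ.≤ n → KSubset n k
  someKSubset {zero}  ℕ.z≤n     = [] , ≡.refl
  someKSubset {suc n} ℕ.z≤n     with someKSubset {n} ℕ.z≤n
  ... | A , p = outside ∷ A , p
  someKSubset         (ℕ.s≤s h) with someKSubset h
  ... | A , p = inside ∷ A , ≡.cong suc p

-- The generalized Johnson graph G(n,k,L).  Since k ∉ L, distinctness of
-- adjacent vertices has to be imposed to get a simple graph.
johnson : ∀ n k → List ℕ → k ℕ.≤ n → Graph
johnson n k L k≤n = record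
  { order    = proj₁ (enumKSubsets n k)
  ; Vertex   = KSubset n k
  ; enum     = proj₂ (enumKSubsets n k)
  ; nonempty = someKSubset k≤n
  ; _~_      = λ A B → A ≢ B × ∣ proj₁ A ∩ proj₁ B ∣ ∉ L
  ; ~-sym    = λ {A} {B} (A≢B , h) →
                 (A≢B ∘ ≡.sym) , ≡.subst (λ C → ∣ C ∣ ∉ L) (∩-comm (proj₁ A) (proj₁ B)) h
  ; ~-irrefl = λ A≡B (A≢B , _) → A≢B A≡B
  }

-- The list L enumerates ℓ₁ < ⋯ < ℓₛ; the indices m ≤ e below stand for the
-- subset {ℓₘ, …, ℓₑ}.
module Runs (L : List ℕ) where

  private
    Index : Set
    Index = Fin (length L)

    ℓ : Index → ℕ
    ℓ = lookup L

  IsRun : Index → Index → Set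
  IsRun m e = m Fin.≤ e ×
    (∀ i → m Fin.≤ i → i Fin.≤ e → ℓ i ≡ ℓ m ℕ.+ (toℕ i ∸ toℕ m))

  -- The last two conditions are void when m is the first, resp. e the last, index.
  IsFullRun : Index → Index → Set
  IsFullRun m e = IsRun m e ×
    (∀ i → suc (toℕ i) ≡ toℕ m → ℓ i ℕ.+ 1 ℕ.< ℓ m) ×
    (∀ i → toℕ i ≡ suc (toℕ e) → ℓ e ℕ.+ 1 ℕ.< ℓ i)

  isFullRun? : ∀ m e → Dec (IsFullRun m e)
  isFullRun? m e =
    (m Finₚ.≤? e ×-dec
      Finₚ.all? λ i → m Finₚ.≤? i →-dec (i Finₚ.≤? e →-dec
        ℓ i ℕₚ.≟ ℓ m ℕ.+ (toℕ i ∸ toℕ m)))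
    ×-dec Finₚ.all? (λ i → suc (toℕ i) ℕₚ.≟ toℕ m →-dec ℓ i ℕ.+ 1 ℕₚ.<? ℓ m)
    ×-dec Finₚ.all? (λ i → toℕ i ℕₚ.≟ suc (toℕ e) →-dec ℓ e ℕ.+ 1 ℕₚ.<? ℓ i)

  fullRuns : List (Index × Index)
  fullRuns = filter (uncurry isFullRun?)
    (cartesianProduct (allFin (length L)) (allFin (length L)))

  runLengths : List ℕ
  runLengths = map (λ (m , e) → suc (toℕ e ∸ toℕ m)) fullRuns

-- binomialChain t k (ℓ₁ ∷ ℓ₂ ∷ ⋯) = (t choose k-ℓ₁) (k-ℓ₁-1 choose k-ℓ₂) ⋯
binomialChain : ℕ → ℕ → List ℕ → ℕ
binomialChain t k []      = 1
binomialChain t k (ℓ ∷ L) = (t C (k ∸ ℓ)) ℕ.* binomialChain (k ∸ ℓ ∸ 1) k L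

K-numerator : ℕ → List ℕ → ℕ
K-numerator k L = product (map _! (Runs.runLengths L)) ℕ.* binomialChain k k L

K-denominator : ℕ → List ℕ → ℕ
K-denominator k L = product (map (λ ℓ → (ℓ ℕ.+ 1) ℕ.* (k ∸ ℓ)) L)

-- Consequences of the axioms used to show that the Lovász number is attained.
module RealFacts (ℝ : CompleteOrderedField) where

  open CompleteOrderedField ℝ
  open IsStrictTotalOrder isStrictTotalOrder public
    using (compare; isStrictPartialOrder)
    renaming (trans to <-trans; irrefl to <-irrefl; <-resp-≈ to <-resp)
  open RingProperties ring public
    using (-‿distribˡ-*; -‿distribʳ-*; -‿involutive; -0#≈0#; -‿+-comm)
  open SemiringSum semiring using (sum)
  open SemiringSum semiring public
    using (sum-cong-≋; ∑-distrib-+; *-distribˡ-sum; *-distribʳ-sum)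

  strictPartialOrder : StrictPartialOrder 0ℓ 0ℓ 0ℓ
  strictPartialOrder = record { isStrictPartialOrder = isStrictPartialOrder }

  module <R = SPOReasoning strictPartialOrder

  ≮⇒≥ : ∀ {x y} → ¬ (x < y) → y ≤ x
  ≮⇒≥ {x} {y} h with compare x y
  ... | tri< a _ _ = ⊥-elim (h a)
  ... | tri≈ _ b _ = inj₂ (sym b)
  ... | tri> _ _ c = inj₁ c

  <-≤-trans : ∀ {x y z} → x < y → y ≤ z → x < z
  <-≤-trans {x} {y} {z} p q = begin-strict x <⟨ p ⟩ y ≤⟨ q ⟩ z ∎
    where open <R

  ≤-<-trans : ∀ {x y z} → x ≤ y → y < z → x < z
  ≤-<-trans {x} {y} {z} p q = begin-strict x ≤⟨ p ⟩ y <⟨ q ⟩ z ∎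
    where open <R

  ≤⇒≯ : ∀ {x y} → x ≤ y → ¬ (y < x)
  ≤⇒≯ p q = <-irrefl refl (≤-<-trans p q)

  ≤-antisym : ∀ {x y} → x ≤ y → y ≤ x → x ≈ y
  ≤-antisym (inj₂ p) _ = p
  ≤-antisym (inj₁ p) q = ⊥-elim (≤⇒≯ q p)

  ≤-resp : ∀ {x x′ y y′} → x ≈ x′ → y ≈ y′ → x ≤ y → x′ ≤ y′
  ≤-resp {x} {x′} {y} {y′} p q h = begin x′ ≈⟨ p ⟨ x ≤⟨ h ⟩ y ≈⟨ q ⟩ y′ ∎
    where open <R

  <-resp₂ : ∀ {x x′ y y′} → x ≈ x′ → y ≈ y′ → x < y → x′ < y′
  <-resp₂ {x} {x′} {y} {y′} p q h = begin-strict x′ ≈⟨ p ⟨ x <⟨ h ⟩ y ≈⟨ q ⟩ y′ ∎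
    where open <R

  +-monoˡ-< : ∀ z {x y} → x < y → x + z < y + z
  +-monoˡ-< z p = <-resp₂ (+-comm _ _) (+-comm _ _) (+-monoʳ-< z p)

  +-mono-< : ∀ {x y u v} → x < y → u < v → x + u < y + v
  +-mono-< p q = <-trans (+-monoˡ-< _ p) (+-monoʳ-< _ q)

  +-monoʳ-≤ : ∀ z {x y} → x ≤ y → z + x ≤ z + y
  +-monoʳ-≤ z (inj₁ p) = inj₁ (+-monoʳ-< z p)
  +-monoʳ-≤ z (inj₂ p) = inj₂ (+-congˡ p)

  +-mono-≤ : ∀ {x y u v} → x ≤ y → u ≤ v → x + u ≤ y + v
  +-mono-≤ {x} {y} {u} {v} p q = begin
    x + u ≤⟨ +-monoʳ-≤ x q ⟩
    x + v ≈⟨ +-comm x v ⟩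
    v + x ≤⟨ +-monoʳ-≤ v p ⟩
    v + y ≈⟨ +-comm v y ⟩
    y + v ∎
    where open <R

  +-mono-<-≤ : ∀ {x y u v} → x < y → u ≤ v → x + u < y + v
  +-mono-<-≤ p q = <-≤-trans (+-monoˡ-< _ p) (+-monoʳ-≤ _ q)

  cancel : ∀ x y → - x + (x + y) ≈ y
  cancel x y = begin-equality
    - x + (x + y) ≈⟨ +-assoc _ _ _ ⟨
    - x + x + y   ≈⟨ +-congʳ (-‿inverseˡ x) ⟩
    0# + y        ≈⟨ +-identityˡ y ⟩
    y             ∎
    where open <R

  x<y⇒0<y-x : ∀ {x y} → x < y → 0# < y - x
  x<y⇒0<y-x {x} p = <-resp₂ (-‿inverseʳ x) refl (+-monoˡ-< (- x) p)

  y-x+x≈y : ∀ x y → y - x + x ≈ y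
  y-x+x≈y x y = trans (+-assoc _ _ _) (trans (+-congˡ (-‿inverseˡ x)) (+-identityʳ y))

  0<y-x⇒x<y : ∀ {x y} → 0# < y - x → x < y
  0<y-x⇒x<y {x} {y} p = <-resp₂ (+-identityˡ x) (y-x+x≈y x y) (+-monoˡ-< x p)

  x<x+ε : ∀ x {ε} → 0# < ε → x < x + ε
  x<x+ε x p = <-resp₂ (+-identityʳ x) refl (+-monoʳ-< x p)

  neg-pos : ∀ {x} → x < 0# → 0# < - x
  neg-pos p = <-resp₂ refl (+-identityˡ _) (x<y⇒0<y-x p)

  *-monoʳ-<-pos : ∀ {a x y} → 0# < a → x < y → a * x < a * y
  *-monoʳ-<-pos {a} {x} {y} p q = 0<y-x⇒x<y (<-resp₂ refl
    (trans (distribˡ a y (- x)) (+-congˡ (sym (-‿distribʳ-* a x)))) (*-pos p (x<y⇒0<y-x q)))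

  neg*neg : ∀ x y → - x * - y ≈ x * y
  neg*neg x y = begin-equality
    - x * - y     ≈⟨ -‿distribˡ-* x (- y) ⟨
    - (x * - y)   ≈⟨ -‿cong (-‿distribʳ-* x y) ⟨
    - (- (x * y)) ≈⟨ -‿involutive _ ⟩
    x * y         ∎
    where open <R

  0≤x*x : ∀ x → 0# ≤ x * x
  0≤x*x x with compare x 0#
  ... | tri< a _ _ = inj₁ (<-resp₂ refl (neg*neg x x) (*-pos (neg-pos a) (neg-pos a)))
  ... | tri≈ _ b _ = inj₂ (sym (trans (*-congʳ b) (zeroˡ x)))
  ... | tri> _ _ c = inj₁ (*-pos c c)

  0<1 : 0# < 1#
  0<1 with compare 0# 1#
  ... | tri< a _ _ = a
  ... | tri≈ _ b _ = ⊥-elim (0≉1 b)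
  ... | tri> _ _ c = ⊥-elim (≤⇒≯ (≤-resp refl (*-identityˡ 1#) (0≤x*x 1#)) c)

  pos⇒≉0 : ∀ {x} → 0# < x → x ≉ 0#
  pos⇒≉0 p q = <-irrefl (sym q) p

  ⁻¹-pos : ∀ {a} → 0# < a → 0# < a ⁻¹
  ⁻¹-pos {a} p with compare 0# (a ⁻¹)
  ... | tri< h _ _ = h
  ... | tri≈ _ h _ = ⊥-elim (0≉1 (trans (sym (zeroʳ a))
                       (trans (*-congˡ h) (⁻¹-inverseʳ (pos⇒≉0 p)))))
  ... | tri> _ _ h = ⊥-elim (≤⇒≯ (inj₁ 0<1)
                       (<-resp₂ (⁻¹-inverseʳ (pos⇒≉0 p)) (zeroʳ a) (*-monoʳ-<-pos p h)))

  half : ∀ {ε} → 0# < ε → ∃ λ δ → 0# < δ × δ + δ ≈ ε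
  half {ε} p = ε * (1# + 1#) ⁻¹ , *-pos p (⁻¹-pos 0<2) , eq
    where
    0<2 : 0# < 1# + 1#
    0<2 = <-trans 0<1 (x<x+ε 1# 0<1)
    open <R
    eq : ε * (1# + 1#) ⁻¹ + ε * (1# + 1#) ⁻¹ ≈ ε
    eq = begin-equality
      ε * (1# + 1#) ⁻¹ + ε * (1# + 1#) ⁻¹
        ≈⟨ distribˡ _ _ _ ⟨
      ε * ((1# + 1#) ⁻¹ + (1# + 1#) ⁻¹)
        ≈⟨ *-congˡ (+-cong (*-identityˡ _) (*-identityˡ _)) ⟨
      ε * (1# * (1# + 1#) ⁻¹ + 1# * (1# + 1#) ⁻¹)
        ≈⟨ *-congˡ (distribʳ _ _ _) ⟨
      ε * ((1# + 1#) * (1# + 1#) ⁻¹)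
        ≈⟨ *-congˡ (⁻¹-inverseʳ (pos⇒≉0 0<2)) ⟩
      ε * 1#
        ≈⟨ *-identityʳ ε ⟩
      ε ∎

  min : ∀ {x y} → 0# < x → 0# < y → ∃ λ z → 0# < z × z ≤ x × z ≤ y
  min {x} {y} p q with compare x y
  ... | tri< a _ _ = x , p , inj₂ refl , inj₁ a
  ... | tri≈ _ b _ = x , p , inj₂ refl , inj₂ b
  ... | tri> _ _ c = y , q , inj₁ c , inj₂ refl

  em : (P : Set) → Dec P
  em P with complete (λ y → y ≈ 0# ⊎ (P × y ≈ 1#)) (0# , inj₁ refl)
              (1# , λ { x (inj₁ h) → inj₁ (<-resp₂ (sym h) refl 0<1)
                      ; x (inj₂ (_ , h)) → inj₂ h })
  ... | s , ub , approx with compare 0# s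
  ... | tri≈ _ h _ = no λ p → ≤⇒≯ (≤-resp refl (sym h) (ub 1# (inj₂ (p , refl)))) 0<1
  ... | tri> _ _ h = ⊥-elim (≤⇒≯ (ub 0# (inj₁ refl)) h)
  ... | tri< h _ _ with approx 0# h
  ...   | x , inj₁ x≈0 , 0<x = ⊥-elim (<-irrefl (sym x≈0) 0<x)
  ...   | x , inj₂ (p , _) , _ = yes p

  -- x and y differ by less than ε
  Close : Carrier → Carrier → Carrier → Set
  Close ε x y = x < y + ε × y < x + ε

  Close-mono : ∀ {ε ε′ x y} → ε ≤ ε′ → Close ε x y → Close ε′ x y
  Close-mono h (p , q) = <-≤-trans p (+-monoʳ-≤ _ h) , <-≤-trans q (+-monoʳ-≤ _ h)

  -- Bolzano–Weierstrass for a filter base S on X, along bounded functions f.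
  cluster : ∀ {X : Set} d (f : Fin d → X → Carrier) (S : Carrier → X → Set) →
    (∀ {ε ε′ x} → ε ≤ ε′ → S ε x → S ε′ x) →
    (∀ ε → 0# < ε → ∃ (S ε)) →
    (l u : Carrier) → (∀ {ε x} → S ε x → ∀ i → l ≤ f i x × f i x ≤ u) →
    ∃ λ (v : Fin d → Carrier) →
      ∀ ε → 0# < ε → ∃ λ x → S ε x × ∀ i → Close ε (f i x) (v i)
  cluster zero f S mono ne l u bd =
    (λ ()) , λ ε p → proj₁ (ne ε p) , proj₂ (ne ε p) , λ ()
  cluster {X} (suc d) f S mono ne l u bd = v , result
    where
    T : Carrier → Set
    T t = ∀ ε → 0# < ε → ∃ λ x → S ε x × t ≤ f zero x

    supT : ∃ (IsSupremum T)
    supT = complete T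
      (l , λ ε p → proj₁ (ne ε p) , proj₂ (ne ε p) , proj₁ (bd (proj₂ (ne ε p)) zero))
      (u , λ t h → let x , s , q = h 1# 0<1 in
         ≮⇒≥ λ u<t → ≤⇒≯ (proj₂ (bd s zero)) (<-≤-trans u<t q))

    v₀ = proj₁ supT

    eventually : ∀ {ε} → 0# < ε → ∃ λ δ → 0# < δ × ∀ x → S δ x → f zero x < v₀ + ε
    eventually {ε} p with em (∃ λ δ → 0# < δ × ∀ x → S δ x → f zero x < v₀ + ε)
    ... | yes h = h
    ... | no ¬h = ⊥-elim (≤⇒≯ (proj₁ (proj₂ supT) (v₀ + ε) inT) (x<x+ε v₀ p))
      where
      inT : T (v₀ + ε)
      inT δ q with em (∃ λ x → S δ x × v₀ + ε ≤ f zero x)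
      ... | yes h = h
      ... | no ¬h′ = ⊥-elim (¬h (δ , q , λ x s → below x s))
        where
        below : ∀ x → S δ x → f zero x < v₀ + ε
        below x s with compare (f zero x) (v₀ + ε)
        ... | tri< a _ _ = a
        ... | tri≈ _ b _ = ⊥-elim (¬h′ (x , s , inj₂ (sym b)))
        ... | tri> _ _ c = ⊥-elim (¬h′ (x , s , inj₁ c))

    S′ : Carrier → X → Set
    S′ ε x = S ε x × Close ε (f zero x) v₀

    ne′ : ∀ ε → 0# < ε → ∃ (S′ ε)
    ne′ ε p =
      let δ , 0<δ , ev   = eventually p
          η , 0<η , η≤δ , η≤ε = min 0<δ p
          t , inT , lt   = proj₂ (proj₂ supT) (v₀ - ε) (below p)
          x , s , t≤x    = inT η 0<η
      in x , mono η≤ε s , ev x (mono η≤δ s) ,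
         <-resp₂ (y-x+x≈y ε v₀) refl (+-monoˡ-< ε (<-≤-trans lt t≤x))
      where
      below : 0# < ε → v₀ - ε < v₀
      below p = <-resp₂ refl (y-x+x≈y ε v₀) (x<x+ε (v₀ - ε) p)

    rest = cluster d (λ i → f (suc i)) S′
      (λ h (s , c) → mono h s , Close-mono h c) ne′ l u (λ (s , _) i → bd s (suc i))

    v : Fin (suc d) → Carrier
    v zero    = v₀
    v (suc i) = proj₁ rest i

    result : ∀ ε → 0# < ε → ∃ λ x → S ε x × ∀ i → Close ε (f i x) (v i)
    result ε p = let x , (s , c₀) , c = proj₂ rest ε p in
      x , s , λ { zero → c₀ ; (suc i) → c i }

  sum-mono : ∀ {n} (f g : Fin n → Carrier) → (∀ i → f i ≤ g i) → sum f ≤ sum g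
  sum-mono {zero}  f g h = inj₂ refl
  sum-mono {suc n} f g h = +-mono-≤ (h zero) (sum-mono (f ∘ suc) (g ∘ suc) (h ∘ suc))

  sum-nonneg : ∀ {n} (f : Fin n → Carrier) → (∀ i → 0# ≤ f i) → 0# ≤ sum f
  sum-nonneg {zero}  f h = inj₂ refl
  sum-nonneg {suc n} f h =
    ≤-resp (+-identityˡ 0#) refl (+-mono-≤ (h zero) (sum-nonneg (f ∘ suc) (h ∘ suc)))

  term≤sum : ∀ {n} (f : Fin n → Carrier) → (∀ i → 0# ≤ f i) → ∀ i → f i ≤ sum f
  term≤sum f h zero =
    ≤-resp (+-identityʳ _) refl (+-monoʳ-≤ _ (sum-nonneg (f ∘ suc) (h ∘ suc)))
  term≤sum f h (suc i) =
    ≤-resp (+-identityˡ _) refl (+-mono-≤ (h zero) (term≤sum (f ∘ suc) (h ∘ suc) i))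

  sum-0 : ∀ {n} (f : Fin n → Carrier) → (∀ i → f i ≈ 0#) → sum f ≈ 0#
  sum-0 {zero}  f h = refl
  sum-0 {suc n} f h = trans (+-cong (h zero) (sum-0 (f ∘ suc) (h ∘ suc))) (+-identityˡ 0#)

  δ : ∀ {n} → Fin n → Fin n → Carrier
  δ zero    zero    = 1#
  δ zero    (suc j) = 0#
  δ (suc i) zero    = 0#
  δ (suc i) (suc j) = δ i j

  δ-≢ : ∀ {n} (i j : Fin n) → i ≢ j → δ i j ≈ 0#
  δ-≢ zero    zero    h = ⊥-elim (h ≡.refl)
  δ-≢ zero    (suc j) h = refl
  δ-≢ (suc i) zero    h = refl
  δ-≢ (suc i) (suc j) h = δ-≢ i j (h ∘ ≡.cong suc)

  δ-refl : ∀ {n} (i : Fin n) → δ i i ≈ 1#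
  δ-refl zero    = refl
  δ-refl (suc i) = δ-refl i

  sum-δ : ∀ {n} (i : Fin n) (f : Fin n → Carrier) → sum (λ j → δ i j * f j) ≈ f i
  sum-δ zero f = trans
    (+-cong (*-identityˡ _) (sum-0 (λ j → 0# * f (suc j)) (λ j → zeroˡ (f (suc j)))))
    (+-identityʳ _)
  sum-δ (suc i) f = trans (+-cong (zeroˡ _) (sum-δ i (f ∘ suc))) (+-identityˡ _)

module Lovász (ℝ : CompleteOrderedField) where

  open CompleteOrderedField ℝ public
  open SemiringExp semiring public using (_^_)
  open SemiringMult semiring using () renaming (_×_ to _×ⁿ_)
  open SemiringSum semiring public using (sum)

  ⟦_⟧ : ℕ → Carrier
  ⟦ n ⟧ = n ×ⁿ 1#

  infixr 8 _^ᶻ_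
  _^ᶻ_ : Carrier → ℤ → Carrier
  x ^ᶻ (+ m)    = x ^ m
  x ^ᶻ -[1+ m ] = (x ⁻¹) ^ suc m

  module _ (G : Graph) where

    open Graph G

    ∑ᵥ : (Vertex → Carrier) → Carrier
    ∑ᵥ f = sum λ i → f (Inverse.from enum i)

    Matrix : Set
    Matrix = Vertex → Vertex → Carrier

    trace : Matrix → Carrier
    trace B = ∑ᵥ λ i → B i i

    total : Matrix → Carrier
    total B = ∑ᵥ λ i → ∑ᵥ λ j → B i j

    PositiveSemidefinite : Matrix → Set
    PositiveSemidefinite B =
      (∀ i j → B i j ≈ B j i) ×
      (∀ (x : Vertex → Carrier) → 0# ≤ ∑ᵥ λ i → ∑ᵥ λ j → x i * B i j * x j)

    Feasible : Matrix → Set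
    Feasible B = PositiveSemidefinite B × trace B ≈ 1# × (∀ i j → i ~ j → B i j ≈ 0#)

    IsLovászNumber : Carrier → Set
    IsLovászNumber t =
      (∃ λ B → Feasible B × total B ≈ t) × (∀ B → Feasible B → total B ≤ t)

    -- The maximum exists by compactness of the set of feasible matrices.
    module Attained where

      open RealFacts ℝ
      open <R

      to : Vertex → Fin order
      to = Inverse.to enum
      from : Fin order → Vertex
      from = Inverse.from enum
      from-to : ∀ i → from (to i) ≡ i
      from-to i = Inverse.strictlyInverseʳ enum i
      to-from : ∀ a → to (from a) ≡ a
      to-from a = Inverse.strictlyInverseˡ enum a

      ∑-cong : ∀ {f g} → (∀ i → f i ≈ g i) → ∑ᵥ f ≈ ∑ᵥ g
      ∑-cong h = sum-cong-≋ (λ a → h (from a))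

      ∑-+ : ∀ f g → ∑ᵥ (λ i → f i + g i) ≈ ∑ᵥ f + ∑ᵥ g
      ∑-+ f g = ∑-distrib-+ (f ∘ from) (g ∘ from)

      ∑-*ˡ : ∀ c f → ∑ᵥ (λ i → c * f i) ≈ c * ∑ᵥ f
      ∑-*ˡ c f = sym (*-distribˡ-sum c (f ∘ from))

      ∑-*ʳ : ∀ c f → ∑ᵥ (λ i → f i * c) ≈ ∑ᵥ f * c
      ∑-*ʳ c f = sym (*-distribʳ-sum c (f ∘ from))

      e : Vertex → Vertex → Carrier
      e i j = δ (to i) (to j)

      ∑-e : ∀ i f → ∑ᵥ (λ j → e i j * f j) ≈ f i
      ∑-e i f = begin-equality
        ∑ᵥ (λ j → e i j * f j)
          ≈⟨ sum-cong-≋ (λ a → *-congʳ (reflexive (≡.cong (δ (to i)) (to-from a)))) ⟩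
        sum (λ a → δ (to i) a * f (from a))
          ≈⟨ sum-δ (to i) (f ∘ from) ⟩
        f (from (to i))
          ≈⟨ reflexive (≡.cong f (from-to i)) ⟩
        f i ∎

      form : Matrix → (x y : Vertex → Carrier) → Carrier
      form B x y = ∑ᵥ λ i → ∑ᵥ λ j → x i * B i j * y j

      form-+ˡ : ∀ B x x′ y → form B (λ i → x i + x′ i) y ≈ form B x y + form B x′ y
      form-+ˡ B x x′ y = begin-equality
        form B (λ i → x i + x′ i) y
          ≈⟨ ∑-cong (λ i → ∑-cong (λ j →
               trans (*-congʳ (distribʳ (B i j) (x i) (x′ i)))
                     (distribʳ (y j) (x i * B i j) (x′ i * B i j)))) ⟩
        ∑ᵥ (λ i → ∑ᵥ (λ j → x i * B i j * y j + x′ i * B i j * y j))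
          ≈⟨ ∑-cong (λ i → ∑-+ (λ j → x i * B i j * y j) (λ j → x′ i * B i j * y j)) ⟩
        ∑ᵥ (λ i → ∑ᵥ (λ j → x i * B i j * y j) + ∑ᵥ (λ j → x′ i * B i j * y j))
          ≈⟨ ∑-+ (λ i → ∑ᵥ λ j → x i * B i j * y j) (λ i → ∑ᵥ λ j → x′ i * B i j * y j) ⟩
        form B x y + form B x′ y ∎

      form-+ʳ : ∀ B x y y′ → form B x (λ i → y i + y′ i) ≈ form B x y + form B x y′
      form-+ʳ B x y y′ = begin-equality
        form B x (λ i → y i + y′ i)
          ≈⟨ ∑-cong (λ i → ∑-cong (λ j → distribˡ (x i * B i j) (y j) (y′ j))) ⟩
        ∑ᵥ (λ i → ∑ᵥ (λ j → x i * B i j * y j + x i * B i j * y′ j))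
          ≈⟨ ∑-cong (λ i → ∑-+ (λ j → x i * B i j * y j) (λ j → x i * B i j * y′ j)) ⟩
        ∑ᵥ (λ i → ∑ᵥ (λ j → x i * B i j * y j) + ∑ᵥ (λ j → x i * B i j * y′ j))
          ≈⟨ ∑-+ (λ i → ∑ᵥ λ j → x i * B i j * y j) (λ i → ∑ᵥ λ j → x i * B i j * y′ j) ⟩
        form B x y + form B x y′ ∎

      form-*ʳ : ∀ B x c y → form B x (λ i → c * y i) ≈ c * form B x y
      form-*ʳ B x c y = begin-equality
        form B x (λ i → c * y i)
          ≈⟨ ∑-cong (λ i → ∑-cong (λ j → swap (x i * B i j) c (y j))) ⟩
        ∑ᵥ (λ i → ∑ᵥ (λ j → c * (x i * B i j * y j)))
          ≈⟨ ∑-cong (λ i → ∑-*ˡ c (λ j → x i * B i j * y j)) ⟩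
        ∑ᵥ (λ i → c * ∑ᵥ (λ j → x i * B i j * y j))
          ≈⟨ ∑-*ˡ c (λ i → ∑ᵥ λ j → x i * B i j * y j) ⟩
        c * form B x y ∎
        where
        swap : ∀ p c q → p * (c * q) ≈ c * (p * q)
        swap p c q = trans (sym (*-assoc p c q)) (trans (*-congʳ (*-comm p c)) (*-assoc c p q))

      form-*ˡ : ∀ B c x y → form B (λ i → c * x i) y ≈ c * form B x y
      form-*ˡ B c x y = begin-equality
        form B (λ i → c * x i) y
          ≈⟨ ∑-cong (λ i → ∑-cong (λ j →
               trans (*-congʳ (*-assoc c (x i) (B i j))) (*-assoc c (x i * B i j) (y j)))) ⟩
        ∑ᵥ (λ i → ∑ᵥ (λ j → c * (x i * B i j * y j)))
          ≈⟨ ∑-cong (λ i → ∑-*ˡ c (λ j → x i * B i j * y j)) ⟩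
        ∑ᵥ (λ i → c * ∑ᵥ (λ j → x i * B i j * y j))
          ≈⟨ ∑-*ˡ c (λ i → ∑ᵥ λ j → x i * B i j * y j) ⟩
        c * form B x y ∎

      form-e : ∀ B i j → form B (e i) (e j) ≈ B i j
      form-e B i j = begin-equality
        form B (e i) (e j)
          ≈⟨ ∑-cong (λ k → ∑-cong (λ l → *-comm (e i k * B k l) (e j l))) ⟩
        ∑ᵥ (λ k → ∑ᵥ (λ l → e j l * (e i k * B k l)))
          ≈⟨ ∑-cong (λ k → ∑-e j (λ l → e i k * B k l)) ⟩
        ∑ᵥ (λ k → e i k * B k j)
          ≈⟨ ∑-e i (λ k → B k j) ⟩
        B i j ∎

      module Bounds {B : Matrix} (feas : Feasible B) where

        symm = proj₁ (proj₁ feas)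
        psd  = proj₂ (proj₁ feas)

        diag≥0 : ∀ i → 0# ≤ B i i
        diag≥0 i = ≤-resp refl (form-e B i i) (psd (e i))

        diag≤1 : ∀ i → B i i ≤ 1#
        diag≤1 i = begin
          B i i                           ≈⟨ reflexive (≡.cong₂ B (from-to i) (from-to i)) ⟨
          B (from (to i)) (from (to i))   ≤⟨ term≤sum _ (diag≥0 ∘ from) (to i) ⟩
          trace B                         ≈⟨ proj₁ (proj₂ feas) ⟩
          1#                              ∎

        expand : ∀ a → a * a ≈ 1# → ∀ i j →
          0# ≤ (B i i + a * B i j) + (a * B i j + B j j)
        expand a aa i j = begin
          0#
            ≤⟨ psd x ⟩
          form B x x
            ≈⟨ form-+ˡ B (e i) y x ⟩
          form B (e i) x + form B y x
            ≈⟨ +-cong (form-+ʳ B (e i) (e i) y) (form-+ʳ B y (e i) y) ⟩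
          (form B (e i) (e i) + form B (e i) y) + (form B y (e i) + form B y y)
            ≈⟨ +-cong
                 (+-cong (form-e B i i)
                         (trans (form-*ʳ B (e i) a (e j)) (*-congˡ (form-e B i j))))
                 (+-cong (trans (form-*ˡ B a (e j) (e i))
                            (*-congˡ (trans (form-e B j i) (symm j i))))
                         last) ⟩
          (B i i + a * B i j) + (a * B i j + B j j) ∎
          where
          x y : Vertex → Carrier
          y k = a * e j k
          x k = e i k + y k
          last : form B y y ≈ B j j
          last = begin-equality
            form B y y                   ≈⟨ form-*ˡ B a (e j) y ⟩
            a * form B (e j) y           ≈⟨ *-congˡ (form-*ʳ B (e j) a (e j)) ⟩
            a * (a * form B (e j) (e j)) ≈⟨ *-assoc _ _ _ ⟨
            a * a * form B (e j) (e j)   ≈⟨ *-cong aa (form-e B j j) ⟩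
            1# * B j j                   ≈⟨ *-identityˡ _ ⟩
            B j j                        ∎

        -1≤ : ∀ a → a * a ≈ 1# → ∀ i j → - 1# ≤ a * B i j
        -1≤ a aa i j = ≮⇒≥ λ h → ≤⇒≯ (expand a aa i j) (begin-strict
          (B i i + a * B i j) + (a * B i j + B j j)
            <⟨ +-mono-<
                 (<-resp₂ (+-comm _ _) (+-comm _ _) (+-mono-<-≤ h (diag≤1 i)))
                 (+-mono-<-≤ h (diag≤1 j)) ⟩
          (1# + - 1#) + (- 1# + 1#)
            ≈⟨ +-cong (-‿inverseʳ 1#) (-‿inverseˡ 1#) ⟩
          0# + 0#
            ≈⟨ +-identityˡ 0# ⟩
          0# ∎)

        lower : ∀ i j → - 1# ≤ B i j
        lower i j = ≤-resp refl (*-identityˡ _) (-1≤ 1# (*-identityˡ 1#) i j)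

        upper : ∀ i j → B i j ≤ 1#
        upper i j = ≮⇒≥ λ h → ≤⇒≯ neg (neg< h)
          where
          neg : - 1# ≤ - B i j
          neg = ≤-resp refl (trans (sym (-‿distribˡ-* _ _)) (-‿cong (*-identityˡ _)))
                  (-1≤ (- 1#) (trans (neg*neg 1# 1#) (*-identityˡ 1#)) i j)
          neg< : 1# < B i j → - B i j < - 1#
          neg< h = <-resp₂ (cancel 1# (- B i j))
            (trans (+-congˡ (-‿inverseʳ _)) (+-identityʳ _))
            (+-monoʳ-< (- 1#) (+-monoˡ-< (- B i j) h))

        total≤ : total B ≤ ∑ᵥ (λ i → ∑ᵥ (λ j → 1#))
        total≤ = sum-mono _ _ λ a → sum-mono _ _ λ b → upper (from a) (from b)

      feasible₀ : ∃ Feasible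
      feasible₀ = B , (symm , psd) , tr , edge
        where
        w = e nonempty
        B : Matrix
        B i j = w i * w j
        symm : ∀ i j → B i j ≈ B j i
        symm i j = *-comm _ _
        psd : ∀ x → 0# ≤ ∑ᵥ λ i → ∑ᵥ λ j → x i * B i j * x j
        psd x = ≤-resp refl (sym eq) (0≤x*x (∑ᵥ λ i → w i * x i))
          where
          regroup : ∀ p q r s → p * (q * r) * s ≈ (q * p) * (r * s)
          regroup p q r s = begin-equality
            p * (q * r) * s   ≈⟨ *-congʳ (*-assoc p q r) ⟨
            p * q * r * s     ≈⟨ *-assoc (p * q) r s ⟩
            (p * q) * (r * s) ≈⟨ *-congʳ (*-comm p q) ⟩
            (q * p) * (r * s) ∎
          eq : ∑ᵥ (λ i → ∑ᵥ λ j → x i * B i j * x j) ≈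
               ∑ᵥ (λ i → w i * x i) * ∑ᵥ (λ i → w i * x i)
          eq = begin-equality
            ∑ᵥ (λ i → ∑ᵥ λ j → x i * B i j * x j)
              ≈⟨ ∑-cong (λ i → ∑-cong (λ j → regroup (x i) (w i) (w j) (x j))) ⟩
            ∑ᵥ (λ i → ∑ᵥ λ j → (w i * x i) * (w j * x j))
              ≈⟨ ∑-cong (λ i → ∑-*ˡ (w i * x i) (λ j → w j * x j)) ⟩
            ∑ᵥ (λ i → (w i * x i) * ∑ᵥ (λ j → w j * x j))
              ≈⟨ ∑-*ʳ (∑ᵥ (λ j → w j * x j)) (λ i → w i * x i) ⟩
            ∑ᵥ (λ i → w i * x i) * ∑ᵥ (λ i → w i * x i) ∎
        tr : trace B ≈ 1#
        tr = trans (∑-e nonempty w) (δ-refl (to nonempty))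
        to-inj : ∀ {i j} → to i ≡ to j → i ≡ j
        to-inj {i} {j} h = ≡.trans (≡.sym (from-to i)) (≡.trans (≡.cong from h) (from-to j))
        edge : ∀ i j → i ~ j → B i j ≈ 0#
        edge i j h with to nonempty Finₚ.≟ to i
        ... | no ≢i = trans (*-congʳ (δ-≢ _ _ ≢i)) (zeroˡ _)
        ... | yes ≡i = trans (*-congˡ (δ-≢ _ _ λ ≡j →
                         ~-irrefl (to-inj (≡.trans (≡.sym ≡i) ≡j)) h)) (zeroʳ _)

      supremum : ∃ (IsSupremum λ t → ∃ λ B → Feasible B × total B ≈ t)
      supremum = complete _
        (total (proj₁ feasible₀) , proj₁ feasible₀ , proj₂ feasible₀ , refl)
        (_ , λ x (B , feas , eq) → ≤-resp eq refl (Bounds.total≤ feas))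

      s : Carrier
      s = proj₁ supremum

      Near : Carrier → Matrix → Set
      Near ε B = Feasible B × s < total B + ε

      near : ∀ ε → 0# < ε → ∃ (Near ε)
      near ε p =
        let t , (B , feas , eq) , h = proj₂ (proj₂ supremum) (s - ε)
              (<-resp₂ refl (y-x+x≈y ε s) (x<x+ε (s - ε) p))
        in B , feas ,
           <-resp₂ (y-x+x≈y ε s) refl (+-monoˡ-< ε (<-resp₂ refl (sym eq) h))

      limit : ∃ λ (V : Matrix) → ∀ ε → 0# < ε →
                ∃ λ B → Near ε B × ∀ i j → Close ε (B i j) (V i j)
      limit = V , λ ε p → let B , n , c = proj₂ v ε p in B , n , λ i j →
                ≡.subst (λ x → Close ε x (V i j)) (coord B i j) (c (Fin.combine (to i) (to j)))
        where
        f : Fin (order ℕ.* order) → Matrix → Carrier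
        f a B = let b , c = Fin.remQuot {order} order a in B (from b) (from c)
        v = cluster (order ℕ.* order) f Near
              (λ h (feas , q) → feas , <-≤-trans q (+-monoʳ-≤ _ h)) near (- 1#) 1#
              (λ (feas , _) a → Bounds.lower feas _ _ , Bounds.upper feas _ _)
        V : Matrix
        V i j = proj₁ v (Fin.combine (to i) (to j))
        coord : ∀ B i j → f (Fin.combine (to i) (to j)) B ≡ B i j
        coord B i j = ≡.trans
          (≡.cong (λ (b , c) → B (from b) (from c)) (Finₚ.remQuot-combine (to i) (to j)))
          (≡.cong₂ B (from-to i) (from-to j))

      module Limit (V : Matrix)
        (lim : ∀ ε → 0# < ε → ∃ λ B → Near ε B × (∀ i j → Close ε (B i j) (V i j))) where

        Continuous : (Matrix → Carrier) → Set
        Continuous g = ∀ ε → 0# < ε → ∃ λ η → 0# < η ×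
          ∀ B → (∀ i j → Close η (B i j) (V i j)) → Close ε (g B) (g V)

        cont-resp : ∀ {g h} → (∀ B → g B ≈ h B) → Continuous g → Continuous h
        cont-resp eq c ε p = let η , 0<η , k = c ε p in η , 0<η , λ B cl →
          let l , r = k B cl in
          <-resp₂ (eq B) (+-congʳ (eq V)) l , <-resp₂ (eq V) (+-congʳ (eq B)) r

        cont-entry : ∀ i j → Continuous (λ B → B i j)
        cont-entry i j ε p = ε , p , λ B cl → cl i j

        cont-const : ∀ c → Continuous (λ _ → c)
        cont-const c ε p = 1# , 0<1 , λ _ _ → x<x+ε c p , x<x+ε c p

        cont-+ : ∀ {g h} → Continuous g → Continuous h → Continuous (λ B → g B + h B)
        cont-+ {g} {h} cg ch ε p =
          let ε′ , 0<ε′ , eq = half p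
              η₁ , p₁ , k₁   = cg ε′ 0<ε′
              η₂ , p₂ , k₂   = ch ε′ 0<ε′
              η , 0<η , q₁ , q₂ = min p₁ p₂
          in η , 0<η , λ B cl →
             let l₁ , r₁ = k₁ B (λ i j → Close-mono q₁ (cl i j))
                 l₂ , r₂ = k₂ B (λ i j → Close-mono q₂ (cl i j))
             in add eq l₁ l₂ , add eq r₁ r₂
          where
          add : ∀ {a b a′ b′ ε′} → ε′ + ε′ ≈ ε → a < b + ε′ → a′ < b′ + ε′ →
                a + a′ < b + b′ + ε
          add {a} {b} {a′} {b′} {ε′} eq x y = begin-strict
            a + a′                 <⟨ +-mono-< x y ⟩
            (b + ε′) + (b′ + ε′)   ≈⟨ +-assoc b ε′ _ ⟩
            b + (ε′ + (b′ + ε′))   ≈⟨ +-congˡ (+-assoc ε′ b′ ε′) ⟨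
            b + (ε′ + b′ + ε′)     ≈⟨ +-congˡ (+-congʳ (+-comm ε′ b′)) ⟩
            b + (b′ + ε′ + ε′)     ≈⟨ +-congˡ (+-assoc b′ ε′ ε′) ⟩
            b + (b′ + (ε′ + ε′))   ≈⟨ +-assoc b b′ _ ⟨
            b + b′ + (ε′ + ε′)     ≈⟨ +-congˡ eq ⟩
            b + b′ + ε             ∎

        cont-neg : ∀ {g} → Continuous g → Continuous (λ B → - g B)
        cont-neg {g} c ε p = let η , 0<η , k = c ε p in η , 0<η , λ B cl →
          let l , r = k B cl in flip r , flip l
          where
          flip : ∀ {a b} → a < b + ε → - b < - a + ε
          flip {a} {b} h = begin-strict
            - b                   ≈⟨ cancel a (- b) ⟨
            - a + (a + - b)       <⟨ +-monoʳ-< (- a) (+-monoˡ-< (- b) h) ⟩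
            - a + (b + ε + - b)   ≈⟨ +-congˡ (+-comm _ _) ⟩
            - a + (- b + (b + ε)) ≈⟨ +-congˡ (cancel b ε) ⟩
            - a + ε               ∎

        cont-*pos : ∀ {g} a → 0# < a → Continuous g → Continuous (λ B → a * g B)
        cont-*pos {g} a 0<a c ε p =
          let η , 0<η , k = c (a ⁻¹ * ε) (*-pos (⁻¹-pos 0<a) p) in
          η , 0<η , λ B cl → let l , r = k B cl in scale l , scale r
          where
          scale : ∀ {x y} → x < y + a ⁻¹ * ε → a * x < a * y + ε
          scale {x} {y} h = begin-strict
            a * x                    <⟨ *-monoʳ-<-pos 0<a h ⟩
            a * (y + a ⁻¹ * ε)       ≈⟨ distribˡ _ _ _ ⟩
            a * y + a * (a ⁻¹ * ε)   ≈⟨ +-congˡ (*-assoc _ _ _) ⟨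
            a * y + a * a ⁻¹ * ε     ≈⟨ +-congˡ (*-congʳ (⁻¹-inverseʳ (pos⇒≉0 0<a))) ⟩
            a * y + 1# * ε           ≈⟨ +-congˡ (*-identityˡ ε) ⟩
            a * y + ε                ∎

        cont-* : ∀ {g} a → Continuous g → Continuous (λ B → a * g B)
        cont-* {g} a c with compare a 0#
        ... | tri> _ _ h = cont-*pos {g} a h c
        ... | tri≈ _ h _ = cont-resp {λ _ → 0#} {λ B → a * g B}
          (λ B → sym (trans (*-congʳ h) (zeroˡ (g B)))) (cont-const 0#)
        ... | tri< h _ _ = cont-resp {λ B → - (- a * g B)} {λ B → a * g B}
          (λ B → trans (-‿cong (sym (-‿distribˡ-* a (g B)))) (-‿involutive (a * g B)))
          (cont-neg {λ B → - a * g B} (cont-*pos {g} (- a) (neg-pos h) c))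

        cont-sum : ∀ {n} (g : Fin n → Matrix → Carrier) → (∀ a → Continuous (g a)) →
                   Continuous (λ B → sum (λ a → g a B))
        cont-sum {zero}  g c = cont-const 0#
        cont-sum {suc n} g c =
          cont-+ {g zero} {λ B → sum (λ a → g (suc a) B)} (c zero) (cont-sum (g ∘ suc) (c ∘ suc))

        closed≥ : ∀ {g} c → Continuous g → (∀ B → Feasible B → c ≤ g B) → c ≤ g V
        closed≥ {g} c cg h = ≮⇒≥ λ lt →
          let η , 0<η , k = cg (c - g V) (x<y⇒0<y-x lt)
              B , (feas , _) , cl = lim η 0<η
          in ≤⇒≯ (h B feas)
               (<-resp₂ refl (trans (+-comm _ _) (y-x+x≈y (g V) c)) (proj₁ (k B cl)))

        closed≤ : ∀ {g} c → Continuous g → (∀ B → Feasible B → g B ≤ c) → g V ≤ c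
        closed≤ {g} c cg h = ≮⇒≥ λ lt →
          let η , 0<η , k = cg (g V - c) (x<y⇒0<y-x lt)
              B , (feas , _) , cl = lim η 0<η
          in <-irrefl refl (begin-strict
               g V             <⟨ proj₂ (k B cl) ⟩
               g B + (g V - c) ≤⟨ +-mono-≤ (h B feas) (inj₂ refl) ⟩
               c + (g V - c)   ≈⟨ trans (+-comm _ _) (y-x+x≈y c (g V)) ⟩
               g V             ∎)

        closed≈ : ∀ {g} c → Continuous g → (∀ B → Feasible B → g B ≈ c) → g V ≈ c
        closed≈ {g} c cg h = ≤-antisym (closed≤ {g} c cg (λ B f → inj₂ (h B f)))
                                       (closed≥ {g} c cg (λ B f → inj₂ (sym (h B f))))

        V-feasible : Feasible V
        V-feasible = (symm , psd) , tr , edge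
          where
          symm : ∀ i j → V i j ≈ V j i
          symm i j = trans (sym (y-x+x≈y (V j i) (V i j))) (trans (+-congʳ diff) (+-identityˡ _))
            where
            diff : V i j - V j i ≈ 0#
            diff = closed≈ {λ B → B i j - B j i} 0#
              (cont-+ {λ B → B i j} {λ B → - B j i} (cont-entry i j)
                (cont-neg {λ B → B j i} (cont-entry j i)))
              (λ B ((sy , _) , _) → trans (+-congʳ (sy i j)) (-‿inverseʳ _))
          psd : ∀ x → 0# ≤ form V x x
          psd x = closed≥ {λ B → form B x x} 0#
            (cont-sum (λ a B → ∑ᵥ λ j → x (from a) * B (from a) j * x j) λ a →
             cont-sum (λ b B → x (from a) * B (from a) (from b) * x (from b)) λ b →
               cont-term (from a) (from b))
            (λ B ((_ , q) , _) → q x)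
            where
            cont-term : ∀ i j → Continuous (λ B → x i * B i j * x j)
            cont-term i j =
              cont-resp {λ B → x j * (x i * B i j)} {λ B → x i * B i j * x j}
                (λ B → *-comm (x j) (x i * B i j))
                (cont-* {λ B → x i * B i j} (x j)
                  (cont-* {λ B → B i j} (x i) (cont-entry i j)))
          tr : trace V ≈ 1#
          tr = closed≈ {trace} 1# (cont-sum (λ a B → B (from a) (from a)) λ a →
                 cont-entry (from a) (from a)) (λ B (_ , t , _) → t)
          edge : ∀ i j → i ~ j → V i j ≈ 0#
          edge i j h = closed≈ {λ B → B i j} 0# (cont-entry i j) (λ B (_ , _ , z) → z i j h)

        total-cont : Continuous total
        total-cont =
          cont-sum (λ a B → ∑ᵥ λ j → B (from a) j) λ a →
          cont-sum (λ b B → B (from a) (from b)) λ b →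
            cont-entry (from a) (from b)

        s≤total : s ≤ total V
        s≤total = ≮⇒≥ λ lt →
          let ε , 0<ε , eq      = half (x<y⇒0<y-x lt)
              η , 0<η , k       = total-cont ε 0<ε
              η′ , 0<η′ , q , r = min 0<η 0<ε
              B , (_ , nr) , cl = lim η′ 0<η′
          in <-irrefl refl (begin-strict
               s                     <⟨ nr ⟩
               total B + η′          ≤⟨ +-monoʳ-≤ _ r ⟩
               total B + ε           <⟨ +-monoˡ-< ε
                                          (proj₁ (k B (λ i j → Close-mono q (cl i j)))) ⟩
               total V + ε + ε       ≈⟨ +-assoc _ _ _ ⟩
               total V + (ε + ε)     ≈⟨ +-congˡ eq ⟩
               total V + (s - total V) ≈⟨ trans (+-comm _ _) (y-x+x≈y (total V) s) ⟩
               s                     ∎)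

        maximal : IsLovászNumber (total V)
        maximal = (V , V-feasible , refl) , λ B feas →
          ≮⇒≥ λ lt → ≤⇒≯ (proj₁ (proj₂ supremum) _ (B , feas , refl)) (≤-<-trans s≤total lt)

      attained : ∃ IsLovászNumber
      attained = total (proj₁ limit) , Limit.maximal (proj₁ limit) (proj₂ limit)

    abstract
      ϑ : Carrier
      ϑ = proj₁ Attained.attained

      ϑ-isLovászNumber : IsLovászNumber ϑ
      ϑ-isLovászNumber = proj₂ Attained.attained

  K : ℕ → List ℕ → Carrier
  K k L = ⟦ K-numerator k L ⟧ * ⟦ K-denominator k L ⟧ ⁻¹

  -- f(n) = Θ(g(n)) as n → ∞, for a function f defined for n > k only.
  IsΘ : ∀ {k} → (∀ n → k ℕ.< n → Carrier) → (ℕ → Carrier) → Set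
  IsΘ {k} f g = ∃₂ λ a b → 0# < a × 0# < b × ∃ λ n₀ →
    ∀ n (k<n : k ℕ.< n) → n₀ ℕ.≤ n → a * g n ≤ f n k<n × f n k<n ≤ b * g n

{-# OPTIONS --safe #-}

-- Let β i be the function C(x , i) of x = |A ∩ B|; its matrix is the Gram matrix of the vectors
-- [E ⊆ A] with |E| = i, hence positive semidefinite.  A function of x that is t for x = k and 0 for
-- x ∈ L, and from which 1 can be subtracted within the positive semidefinite functions, certifies
-- ϑ(G(n,k,L)) ≤ t; scaled by 1 / (t C(n,k)) it is a feasible matrix for the complementary set
-- [0,k−1] ∖ L, so that ϑ is at least C(n,k) / t there.  Both bounds therefore follow from one
-- asymptotic construction of certificates for arbitrary sets, together with the identity
-- K(k,L) K(k,[0,k−1] ∖ L) = 1 / k!.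
--
-- The certificate is found in the order f ≼ g: g − f agrees on L ∪ {k} with a positive semidefinite
-- function.  A gap of L from i to the next element i′ gives β i = C(i′,i) β i′ + (higher terms).
-- A run of length m starting at ℓ gives, from the Gram matrix of the vectors
-- [E ⊆ A] − τ #{S ⊆ E ∩ A : |S| = ℓ} with |E| = ℓ + m and τ of order n^(−m),
--   β ℓ ≼ n^m / (m! C(k−ℓ,m)²) β (ℓ+m) + O(n^(j−ℓ) β j for j < ℓ).
-- Alternating the two steps leads from 1 = β 0 to 1 ≼ (K n^s + O(n^(s−1))) β k.

module Submission where

open import Defs
open import Data.Integer.Base using (+_; pred)
open import Data.List.Base using (List; length)
open import Data.List.Relation.Unary.All using (All)
open import Data.List.Relation.Unary.Linked using (Linked)
open import Data.Nat.Base as ℕ using (ℕ)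
open import Data.Nat.Properties using (<⇒≤)
open import Data.Product.Base using (∃; _×_)

import Algebra.Properties.Semiring.Exp as SemiringExp
import Algebra.Properties.Semiring.Mult as SemiringMult
import Algebra.Solver.Ring.NaturalCoefficients.Default as SemiringSolver
open import Data.Bool.Base using (Bool; true; false; not; if_then_else_)
open import Data.Empty using (⊥-elim)
open import Data.Fin.Base using (Fin; zero; suc; toℕ)
import Data.Fin.Properties as Finₚ
open import Data.Fin.Subset using (Subset; inside; outside; ∣_∣; _∩_; _∪_; ⊤)
open import Data.Fin.Subset.Properties
  using (∣⊤∣≡n; ∣p∩q∣≤∣p∣; ∣p∩q∣≤∣q∣; ∩-comm; ∩-idem)
open import Data.List.Base
  using ([]; _∷_; map; allFin; cartesianProduct; filter; lookup)
open import Data.List.Membership.DecPropositional using (_∈?_)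
open import Data.List.Membership.Propositional using (_∉_)
open import Data.List.Properties using (map-tabulate; map-∘; map-++)
open import Data.List.Relation.Unary.All as All using ([]; _∷_)
open import Data.List.Relation.Unary.Any using (here; there)
open import Data.List.Relation.Unary.Linked using ([]; [-]; _∷_)
open import Data.List.Relation.Unary.Linked.Properties using (Linked⇒All)
open import Data.Nat.Base using (zero; suc; _∸_; _!)
open import Data.Nat.Combinatorics
  using (_C_; nCn≡1; nC1≡n; k>n⇒nCk≡0; nCk+nC[k+1]≡[n+1]C[k+1])
open import Data.Nat.ListAction using (product)
open import Data.Nat.ListAction.Properties using (product-++)
import Data.Nat.Properties as ℕₚ
open import Data.Nat.Solver using (module +-*-Solver)
open import Data.Product.Base using (_,_; proj₁; proj₂; uncurry)
open import Data.Sum.Base using (_⊎_; inj₁; inj₂)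
open import Data.Vec.Base using ([]; _∷_)
open import Function.Base using (_∘_; id)
open import Function.Bundles using (mk⇔; _⇔_)
open import Level using (0ℓ)
open import Relation.Binary.Definitions using (tri<; tri≈; tri>)
open import Relation.Binary.PropositionalEquality as ≡ using (_≡_; _≢_)
open import Relation.Nullary.Decidable using (does-⇔; dec-false; dec-true)
open import Relation.Nullary.Decidable.Core using (Dec; does; yes; no)
open import Relation.Nullary.Negation using (¬_)
open import Relation.Unary using (Pred; Decidable)

-- The obstacle is the debris that a run step leaves in lower `β j`: it must not reach the leading
-- term. Hence two passes. A crude one, by single steps with no care for constants, bounds `β j` by
-- n to the number of selected positions in [j,k-1]. The sharp one uses that a run starts at 0 or
-- just after an unselected position: among the positions j, ..., ℓ-1 one is unselected, so n^(j-ℓ)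
-- `β j` stays at least one power of n below the bound for `β ℓ`. The scalar τ solves a quadratic
-- optimum: with σ = τ n^m and N = C(k-ℓ,m), the Gram matrix yields the coefficient 2σN - σ²/m! for
-- `β ℓ`; its maximum m! N², at σ = N m!, is the constant of the run step. The constant of the whole
-- chain is split into one factor per position, in which the current length of a run enters as a
-- factor and that of a gap as a divisor. Complementation exchanges runs and gaps, so the lengths
-- cancel; this is why the constants of a set and its complement have the fixed product 1/k!. The n
-- below 2k, where n - |S ∪ T| may not be expandable around n - 2ℓ, are finitely many and go into
-- the error constants.

module Binomials where

  open import Data.Nat.Base
  open import Data.Nat.Properties
  open import Relation.Binary.PropositionalEquality
  open +-*-Solver using (solve; _:+_; _:*_; _:=_; con)

  -- Binomial identities and estimates

  pascal : ∀ n k → suc n C suc k ≡ n C k + n C suc k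
  pascal n k = sym (nCk+nC[k+1]≡[n+1]C[k+1] n k)

  absorption : ∀ n k → suc k * (suc n C suc k) ≡ suc n * (n C k)
  absorption zero    zero    = refl
  absorption zero    (suc k) = begin-equality
    suc (suc k) * (1 C suc (suc k)) ≡⟨ cong (suc (suc k) *_) (k>n⇒nCk≡0 {n = 1} {k = suc (suc k)} (s≤s (s≤s z≤n))) ⟩
    suc (suc k) * 0                 ≡⟨ *-zeroʳ (suc (suc k)) ⟩
    0                               ≡⟨⟩
    1 * (0 C suc k)                 ∎
    where open ≤-Reasoning
  absorption (suc n) zero    = begin-equality
    1 * (suc (suc n) C 1)    ≡⟨ cong (1 *_) (pascal (suc n) 0) ⟩
    1 * (1 + suc n C 1)      ≡⟨ cong (λ z → 1 * (1 + z)) (*-identityˡ _) ⟨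
    1 * (1 + 1 * (suc n C 1)) ≡⟨ cong (λ z → 1 * (1 + z)) (absorption n 0) ⟩
    1 * (1 + suc n * 1)      ≡⟨ solve 1 (λ n → con 1 :* (con 1 :+ (con 1 :+ n) :* con 1) := (con 2 :+ n) :* con 1) refl n ⟩
    suc (suc n) * 1          ∎
    where open ≤-Reasoning
  absorption (suc n) (suc k) = begin-equality
    suc (suc k) * (suc (suc n) C suc (suc k))
      ≡⟨ cong (suc (suc k) *_) (pascal (suc n) (suc k)) ⟩
    suc (suc k) * (suc n C suc k + suc n C suc (suc k))
      ≡⟨ solve 3 (λ k x y → (con 2 :+ k) :* (x :+ y) :=
           (con 1 :+ k) :* x :+ (x :+ (con 2 :+ k) :* y)) refl k (suc n C suc k) (suc n C suc (suc k)) ⟩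
    suc k * (suc n C suc k) + (suc n C suc k + suc (suc k) * (suc n C suc (suc k)))
      ≡⟨ cong₂ (λ x y → x + (suc n C suc k + y)) (absorption n k) (absorption n (suc k)) ⟩
    suc n * (n C k) + (suc n C suc k + suc n * (n C suc k))
      ≡⟨ solve 4 (λ n x y z → (con 1 :+ n) :* x :+ (z :+ (con 1 :+ n) :* y) :=
           z :+ (con 1 :+ n) :* (x :+ y)) refl n (n C k) (n C suc k) (suc n C suc k) ⟩
    suc n C suc k + suc n * (n C k + n C suc k)
      ≡⟨ cong (λ z → suc n C suc k + suc n * z) (pascal n k) ⟨
    suc (suc n) * (suc n C suc k) ∎
    where open ≤-Reasoning

  -- This is (k+1) C(n,k+1) = (n-k) C(n,k) with the subtraction moved across, so that no truncation
  -- occurs. Adding C(n,k) to both sides reduces it to `absorption`.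
  absorption′ : ∀ n k → suc k * (n C suc k) + k * (n C k) ≡ n * (n C k)
  absorption′ n k = +-cancelˡ-≡ (n C k) _ _ (begin-equality
    n C k + (suc k * (n C suc k) + k * (n C k))
      ≡⟨ solve 3 (λ k x y → x :+ ((con 1 :+ k) :* y :+ k :* x) := (con 1 :+ k) :* (x :+ y))
           refl k (n C k) (n C suc k) ⟩
    suc k * (n C k + n C suc k)
      ≡⟨ cong (suc k *_) (pascal n k) ⟨
    suc k * (suc n C suc k)
      ≡⟨ absorption n k ⟩
    n C k + n * (n C k) ∎)
    where open ≤-Reasoning

  absorption-+ : ∀ i m → suc i * ((i + m) C suc i) ≡ m * ((i + m) C i)
  absorption-+ i m = +-cancelʳ-≡ (i * ((i + m) C i)) _ _ (trans (absorption′ (i + m) i)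
    (solve 3 (λ i m x → (i :+ m) :* x := m :* x :+ i :* x) refl i m ((i + m) C i)))

  C*!≤^ : ∀ a b → (a C b) * b ! ≤ a ^ b
  C*!≤^ a       zero    = ≤-refl
  C*!≤^ zero    (suc b) = z≤n
  C*!≤^ (suc a) (suc b) = begin
    (suc a C suc b) * (suc b * b !)
      ≡⟨ solve 3 (λ x b y → x :* ((con 1 :+ b) :* y) := (con 1 :+ b) :* x :* y) refl (suc a C suc b) b (b !) ⟩
    suc b * (suc a C suc b) * b !   ≡⟨ cong (_* b !) (absorption a b) ⟩
    suc a * (a C b) * b !           ≡⟨ *-assoc (suc a) (a C b) (b !) ⟩
    suc a * ((a C b) * b !)         ≤⟨ *-monoʳ-≤ (suc a) (C*!≤^ a b) ⟩
    suc a * a ^ b                   ≤⟨ *-monoʳ-≤ (suc a) (^-monoˡ-≤ b (n≤1+n a)) ⟩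
    suc a * suc a ^ b               ∎
    where open ≤-Reasoning

  -- Together with `C*!≤^` this says C(n,k) k! = n^k + O(n^(k-1)). The induction multiplies by n and
  -- rewrites n C(n,k+1) by `absorption′`; the surplus (k+1) C(n,k+1) (k+1)! is at most (k+1)
  -- n^(k+1), so the constant grows by k+1.
  ^≤C*! : ∀ k → ∃ λ c → ∀ n → n ^ suc k ≤ (n C suc k) * suc k ! + c * n ^ k
  ^≤C*! zero    = 0 , λ n → ≤-reflexive (trans (*-identityʳ n)
    (sym (trans (+-identityʳ _) (trans (*-identityʳ _) (trans (sym (*-identityˡ _))
      (trans (sym (+-identityʳ _)) (trans (absorption′ n 0) (*-identityʳ n))))))))
  ^≤C*! (suc k) with ^≤C*! k
  ... | c , h = suc k + c , λ n → begin
    n * n ^ suc k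
      ≤⟨ *-monoʳ-≤ n (h n) ⟩
    n * ((n C suc k) * suc k ! + c * n ^ k)
      ≡⟨ solve 5 (λ n x f c p → n :* (x :* f :+ c :* p) := n :* x :* f :+ c :* (n :* p))
           refl n (n C suc k) (suc k !) c (n ^ k) ⟩
    n * (n C suc k) * suc k ! + c * n ^ suc k
      ≡⟨ cong (λ z → z * suc k ! + c * n ^ suc k) (absorption′ n (suc k)) ⟨
    (suc (suc k) * (n C suc (suc k)) + suc k * (n C suc k)) * suc k ! + c * n ^ suc k
      ≡⟨ solve 6 (λ k y x f c p → ((con 2 :+ k) :* y :+ (con 1 :+ k) :* x) :* f :+ c :* p :=
           y :* ((con 2 :+ k) :* f) :+ ((con 1 :+ k) :* (x :* f) :+ c :* p))
           refl k (n C suc (suc k)) (n C suc k) (suc k !) c (n ^ suc k) ⟩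
    (n C suc (suc k)) * suc (suc k) ! + (suc k * ((n C suc k) * suc k !) + c * n ^ suc k)
      ≤⟨ +-monoʳ-≤ ((n C suc (suc k)) * suc (suc k) !)
           (+-monoˡ-≤ (c * n ^ suc k) (*-monoʳ-≤ (suc k) (C*!≤^ n (suc k)))) ⟩
    (n C suc (suc k)) * suc (suc k) ! + (suc k * n ^ suc k + c * n ^ suc k)
      ≡⟨ cong (λ z → (n C suc (suc k)) * suc (suc k) ! + z) (*-distribʳ-+ (n ^ suc k) (suc k) c) ⟨
    (n C suc (suc k)) * suc (suc k) ! + (suc k + c) * n ^ suc k ∎
    where open ≤-Reasoning

  -- The binomial coefficient a choose b − c, read as 0 when b < c.
  shiftedC : ℕ → ℕ → ℕ → ℕ
  shiftedC a b       zero    = a C b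
  shiftedC a zero    (suc c) = 0
  shiftedC a (suc b) (suc c) = shiftedC a b c

  shiftedC-pascal : ∀ a b c → shiftedC (suc a) b c ≡ shiftedC a b c + shiftedC a b (suc c)
  shiftedC-pascal a zero    zero    = refl
  shiftedC-pascal a (suc b) zero    = trans (pascal a b) (+-comm (a C b) _)
  shiftedC-pascal a zero    (suc c) = refl
  shiftedC-pascal a (suc b) (suc c) = shiftedC-pascal a b c

  shiftedC-+ : ∀ a b c → shiftedC a (c + b) c ≡ a C b
  shiftedC-+ a b zero    = refl
  shiftedC-+ a b (suc c) = shiftedC-+ a b c

  C≤^ : ∀ a b → a C b ≤ a ^ b
  C≤^ a b = ≤-trans (≤-trans (≤-reflexive (sym (*-identityʳ _))) (*-monoʳ-≤ (a C b) (n!>0 b))) (C*!≤^ a b)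
    where
    n!>0 : ∀ b → 1 ≤ b !
    n!>0 b = 1≤n! b

  -- A division-free form of C(a,b-c) ≤ n^(b-c). For b < c the left side is 0, and no negative power
  -- of n has to be written.
  shiftedC-bound : ∀ {a n} → a ≤ n → ∀ b c → shiftedC a b c * n ^ c ≤ n ^ b
  shiftedC-bound {a} h b zero = ≤-trans (≤-reflexive (*-identityʳ _)) (≤-trans (C≤^ a b) (^-monoˡ-≤ b h))
  shiftedC-bound h zero (suc c) = z≤n
  shiftedC-bound {a} {n} h (suc b) (suc c) = begin
    shiftedC a b c * (n * n ^ c)
      ≡⟨ solve 3 (λ x n y → x :* (n :* y) := n :* (x :* y)) refl (shiftedC a b c) n (n ^ c) ⟩
    n * (shiftedC a b c * n ^ c) ≤⟨ *-monoʳ-≤ n (shiftedC-bound h b c) ⟩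
    n * n ^ b                    ∎
    where open ≤-Reasoning

  0<nCk : ∀ {n k} → k ≤ n → 0 < n C k
  0<nCk {n}     {zero}  _       = s≤s z≤n
  0<nCk {suc n} {suc k} (s≤s p) = subst (0 <_) (sym (pascal n k)) (≤-trans (0<nCk p) (m≤m+n (n C k) _))

open Binomials

-- Factorials of run lengths, one list element at a time

module RunProducts where

  open import Data.Nat.Base using (_+_; _*_)
  open import Relation.Binary.PropositionalEquality

  ∏ : ∀ n → (Fin n → ℕ) → ℕ
  ∏ zero    f = 1
  ∏ (suc n) f = f zero * ∏ n (f ∘ suc)

  ∏-cong : ∀ n {f g : Fin n → ℕ} → (∀ i → f i ≡ g i) → ∏ n f ≡ ∏ n g
  ∏-cong zero    h = refl
  ∏-cong (suc n) h = cong₂ _*_ (h zero) (∏-cong n (h ∘ suc))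

  ∏-1 : ∀ n {f : Fin n → ℕ} → (∀ i → f i ≡ 1) → ∏ n f ≡ 1
  ∏-1 zero    h = refl
  ∏-1 (suc n) h = trans (cong₂ _*_ (h zero) (∏-1 n (h ∘ suc))) refl

  product-allFin : ∀ n (f : Fin n → ℕ) → product (map f (allFin n)) ≡ ∏ n f
  product-allFin zero    f = refl
  product-allFin (suc n) f = cong (f zero *_) (trans
    (cong product (trans (map-tabulate suc f) (sym (map-tabulate id (f ∘ suc)))))
    (product-allFin n (f ∘ suc)))

  ifYes : {P : Set} → Dec P → ℕ → ℕ
  ifYes p? x = if does p? then x else 1

  product-filter : ∀ {A : Set} {P : Pred A 0ℓ} (P? : Decidable P) (f : A → ℕ) xs →
    product (map f (filter P? xs)) ≡ product (map (λ x → ifYes (P? x) (f x)) xs)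
  product-filter P? f []       = refl
  product-filter P? f (x ∷ xs) with does (P? x)
  ... | true  = cong (f x *_) (product-filter P? f xs)
  ... | false = trans (product-filter P? f xs) (sym (ℕₚ.*-identityˡ _))

  product-cartesian : ∀ {A B : Set} (f : A × B → ℕ) xs ys →
    product (map f (cartesianProduct xs ys)) ≡ product (map (λ x → product (map (λ y → f (x , y)) ys)) xs)
  product-cartesian f []       ys = refl
  product-cartesian f (x ∷ xs) ys = trans
    (cong product (map-++ f (map (x ,_) ys) (cartesianProduct xs ys)))
    (trans (product-++ (map f (map (x ,_) ys)) _)
      (cong₂ _*_ (cong product (sym (map-∘ ys))) (product-cartesian f xs ys)))

  runFactorials : List ℕ → ℕ
  runFactorials L = product (map _! (Runs.runLengths L))

  -- The neutral value 1 off the full runs turns the filtered product into a plain double product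
  -- over indices, which can be split at the first index.
  weight : (L : List ℕ) → (m e : Fin (length L)) → ℕ
  weight L m e = ifYes (Runs.isFullRun? L m e) (suc (toℕ e ∸ toℕ m) !)

  runFactorials-∏ : ∀ L → let s = length L in
    runFactorials L ≡ ∏ s (λ m → ∏ s (weight L m))
  runFactorials-∏ L = begin
    product (map _! (map _ (Runs.fullRuns L)))
      ≡⟨ cong product (map-∘ (Runs.fullRuns L)) ⟨
    product (map h (Runs.fullRuns L))
      ≡⟨ product-filter (uncurry (Runs.isFullRun? L)) h (cartesianProduct (allFin s) (allFin s)) ⟩
    product (map (λ (m , e) → weight L m e) (cartesianProduct (allFin s) (allFin s)))
      ≡⟨ product-cartesian (λ (m , e) → weight L m e) (allFin s) (allFin s) ⟩
    product (map (λ m → product (map (weight L m) (allFin s))) (allFin s))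
      ≡⟨ product-allFin s _ ⟩
    ∏ s (λ m → product (map (weight L m) (allFin s)))
      ≡⟨ ∏-cong s (λ m → product-allFin s (weight L m)) ⟩
    ∏ s (λ m → ∏ s (weight L m)) ∎
    where
    open ≡-Reasoning
    s = length L
    h : Fin s × Fin s → ℕ
    h (m , e) = suc (toℕ e ∸ toℕ m) !

  -- For a sorted list `ℓ ∷ L`, the first full run has length `suc (runFrom (suc ℓ) L)`.
  runFrom : ℕ → List ℕ → ℕ
  runFrom i []      = 0
  runFrom i (ℓ ∷ L) with ℓ ℕₚ.≟ i
  ... | yes _ = suc (runFrom (suc i) L)
  ... | no  _ = 0

  ifYes-cong : {P Q : Set} → P ⇔ Q → (p? : Dec P) (q? : Dec Q) → ∀ x → ifYes p? x ≡ ifYes q? x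
  ifYes-cong eq p? q? x = cong (if_then x else 1) (does-⇔ eq p? q?)

  ifYes-no : {P : Set} → ¬ P → (p? : Dec P) → ∀ x → ifYes p? x ≡ 1
  ifYes-no ¬p p? x = cong (if_then x else 1) (dec-false p? ¬p)

  ifYes-yes : {P : Set} → P → (p? : Dec P) → ∀ x → ifYes p? x ≡ x
  ifYes-yes p p? x = cong (if_then x else 1) (dec-true p? p)

  module Cons (ℓ : ℕ) (L : List ℕ) where
    private
      module R  = Runs (ℓ ∷ L)
      module R′ = Runs L

    -- Prepending ℓ can only affect a full run at the first index of L, which acquires ℓ as left
    -- neighbour; this is the extra condition for m = 0.
    suc-suc⇒ : ∀ {m e} → R.IsFullRun (suc m) (suc e) →
      R′.IsFullRun m e × (toℕ m ≡ 0 → ℓ + 1 ℕ.< lookup L m)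
    suc-suc⇒ ((ℕ.s≤s m≤e , run) , before , after) =
      ((m≤e , λ i p q → run (suc i) (ℕ.s≤s p) (ℕ.s≤s q)) ,
       (λ i p → before (suc i) (cong suc p)) , (λ i p → after (suc i) (cong suc p))) ,
      λ p → before zero (cong suc (sym p))

    suc-suc⇐ : ∀ {m e} → R′.IsFullRun m e → (toℕ m ≡ 0 → ℓ + 1 ℕ.< lookup L m) →
      R.IsFullRun (suc m) (suc e)
    suc-suc⇐ ((m≤e , run) , before , after) first =
      (ℕ.s≤s m≤e , λ { zero () _ ; (suc i) (ℕ.s≤s p) (ℕ.s≤s q) → run i p q }) ,
      (λ { zero p → first (sym (ℕₚ.suc-injective p)) ; (suc i) p → before i (ℕₚ.suc-injective p) }) ,
      (λ { zero () ; (suc i) p → after i (ℕₚ.suc-injective p) })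

    ¬suc-zero : ∀ {m} → ¬ R.IsFullRun (suc m) zero
    ¬suc-zero ((() , _) , _)

    weight-suc-suc : ∀ {m e} → (toℕ m ≡ 0 → ℓ + 1 ℕ.< lookup L m) →
      weight (ℓ ∷ L) (suc m) (suc e) ≡ weight L m e
    weight-suc-suc {m} {e} first = ifYes-cong (mk⇔ (proj₁ ∘ suc-suc⇒) (λ p → suc-suc⇐ p first))
      (R.isFullRun? (suc m) (suc e)) (R′.isFullRun? m e) _

    weight-suc-zero : ∀ {m} → weight (ℓ ∷ L) (suc m) zero ≡ 1
    weight-suc-zero {m} = ifYes-no ¬suc-zero (R.isFullRun? (suc m) zero) (suc (zero ∸ suc (toℕ m)) !)

  -- At most one factor differs from 1, since a full run starting at the first index has only one
  -- possible end. The function `f` of that end is kept general because prepending an adjacent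
  -- element shifts the index by one.
  firstRun : (ℕ → ℕ) → List ℕ → ℕ
  firstRun f []      = 1
  firstRun f (ℓ ∷ L) = ∏ (suc (length L)) (λ e → ifYes (Runs.isFullRun? (ℓ ∷ L) zero e) (f (toℕ e)))

  laterRuns : List ℕ → ℕ
  laterRuns []      = 1
  laterRuns (ℓ ∷ L) = ∏ (length L) (λ m → ∏ (suc (length L)) (weight (ℓ ∷ L) (suc m)))

  ¬separated : ∀ ℓ → ¬ (ℓ + 1 ℕ.< suc ℓ)
  ¬separated ℓ p = ℕₚ.<-irrefl (ℕₚ.+-comm ℓ 1) p

  module Adjacent (ℓ : ℕ) (L : List ℕ) where
    L⁺ = suc ℓ ∷ L
    private
      module R  = Runs (ℓ ∷ L⁺)
      module R′ = Runs L⁺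

    ¬zero-zero : ¬ R.IsFullRun zero zero
    ¬zero-zero (_ , _ , after) = ¬separated ℓ (after (suc zero) refl)

    zero-suc⇒ : ∀ {e} → R.IsFullRun zero (suc e) → R′.IsFullRun zero e
    zero-suc⇒ ((_ , run) , _ , after) =
      (ℕ.z≤n , λ i _ q → trans (run (suc i) ℕ.z≤n (ℕ.s≤s q)) (ℕₚ.+-suc ℓ (toℕ i))) ,
      (λ i ()) , λ i p → after (suc i) (cong suc p)

    zero-suc⇐ : ∀ {e} → R′.IsFullRun zero e → R.IsFullRun zero (suc e)
    zero-suc⇐ ((_ , run) , _ , after) =
      (ℕ.z≤n , λ { zero _ _ → sym (ℕₚ.+-identityʳ ℓ)
                 ; (suc i) _ (ℕ.s≤s q) → trans (run i ℕ.z≤n q) (sym (ℕₚ.+-suc ℓ (toℕ i))) }) ,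
      (λ i ()) , λ { zero () ; (suc i) p → after i (ℕₚ.suc-injective p) }

    firstRun-adjacent : ∀ f → firstRun f (ℓ ∷ L⁺) ≡ firstRun (f ∘ suc) L⁺
    firstRun-adjacent f = trans
      (cong₂ _*_ (ifYes-no ¬zero-zero (R.isFullRun? zero zero) _)
        (∏-cong (length L⁺) (λ e → ifYes-cong (mk⇔ zero-suc⇒ zero-suc⇐)
          (R.isFullRun? zero (suc e)) (R′.isFullRun? zero e) (f (suc (toℕ e))))))
      (ℕₚ.*-identityˡ _)

    laterRuns-adjacent : laterRuns (ℓ ∷ L⁺) ≡ laterRuns L⁺
    laterRuns-adjacent = trans
      (cong₂ _*_ (trans (cong₂ _*_ (weight-suc-zero {zero})
                    (∏-1 (length L⁺) (λ e → ifYes-no (λ p → ¬separated ℓ (proj₂ (suc-suc⇒ p) refl))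
                      (R.isFullRun? (suc zero) (suc e)) (suc (toℕ e) !)))) refl)
        (∏-cong (length L) (λ m → trans
          (cong₂ _*_ (weight-suc-zero {suc m}) (∏-cong (length L⁺) (λ e → weight-suc-suc {suc m} {e} λ ())))
          (ℕₚ.*-identityˡ _))))
      (ℕₚ.*-identityˡ _)
      where open Cons ℓ L⁺

  module Separated (ℓ ℓ′ : ℕ) (L : List ℕ) (sep : ℓ + 1 ℕ.< ℓ′) where
    private
      module R = Runs (ℓ ∷ ℓ′ ∷ L)

    zero-zero : R.IsFullRun zero zero
    zero-zero = (ℕ.z≤n , λ { zero _ _ → sym (ℕₚ.+-identityʳ ℓ) ; (suc i) _ () }) ,
      (λ i ()) , λ { zero () ; (suc zero) _ → sep ; (suc (suc i)) () }

    ¬zero-suc : ∀ {e} → ¬ R.IsFullRun zero (suc e)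
    ¬zero-suc ((_ , run) , _) = ℕₚ.<-irrefl (sym (run (suc zero) ℕ.z≤n (ℕ.s≤s ℕ.z≤n))) sep

    firstRun-separated : ∀ f → firstRun f (ℓ ∷ ℓ′ ∷ L) ≡ f 0
    firstRun-separated f = trans
      (cong₂ _*_ (ifYes-yes zero-zero (R.isFullRun? zero zero) _)
        (∏-1 (suc (length L)) (λ e → ifYes-no ¬zero-suc (R.isFullRun? zero (suc e)) (f (suc (toℕ e))))))
      (ℕₚ.*-identityʳ _)

    laterRuns-separated : laterRuns (ℓ ∷ ℓ′ ∷ L) ≡ runFactorials (ℓ′ ∷ L)
    laterRuns-separated = trans
      (∏-cong (suc (length L)) (λ m → trans
        (cong₂ _*_ (weight-suc-zero {m}) (∏-cong (suc (length L)) (λ e → weight-suc-suc {m} {e} (first m))))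
        (ℕₚ.*-identityˡ _)))
      (sym (runFactorials-∏ (ℓ′ ∷ L)))
      where
      open Cons ℓ (ℓ′ ∷ L)
      first : ∀ m → toℕ m ≡ 0 → ℓ + 1 ℕ.< lookup (ℓ′ ∷ L) m
      first zero _ = sep

  runFactorials-split : ∀ ℓ L → runFactorials (ℓ ∷ L) ≡ firstRun (λ t → suc t !) (ℓ ∷ L) * laterRuns (ℓ ∷ L)
  runFactorials-split ℓ L = runFactorials-∏ (ℓ ∷ L)

  firstRun≡ : ∀ f ℓ L → Linked ℕ._<_ (ℓ ∷ L) → firstRun f (ℓ ∷ L) ≡ f (runFrom (suc ℓ) L)
  firstRun≡ f ℓ [] _ = trans (ℕₚ.*-identityʳ _) (ifYes-yes single (Runs.isFullRun? (ℓ ∷ []) zero zero) _)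
    where
    single : Runs.IsFullRun (ℓ ∷ []) zero zero
    single = (ℕ.z≤n , λ { zero _ _ → sym (ℕₚ.+-identityʳ ℓ) }) , (λ i ()) , λ { zero () }
  firstRun≡ f ℓ (ℓ′ ∷ L) (ℓ<ℓ′ ∷ sorted) with ℓ′ ℕₚ.≟ suc ℓ
  ... | yes refl = trans (Adjacent.firstRun-adjacent ℓ L f) (firstRun≡ (f ∘ suc) (suc ℓ) L sorted)
  ... | no  ℓ′≢  = Separated.firstRun-separated ℓ ℓ′ L
    (subst (ℕ._< ℓ′) (ℕₚ.+-comm 1 ℓ) (ℕₚ.≤∧≢⇒< ℓ<ℓ′ (ℓ′≢ ∘ sym))) f

  -- If the first full run has length r+1, then (r+1)! = (r+1) r!, and r! is the contribution of
  -- what is left of that run in L. Thus the factorials grow by one factor per element, in step with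
  -- `factor` below.
  runFactorials-∷ : ∀ ℓ L → Linked ℕ._<_ (ℓ ∷ L) →
    runFactorials (ℓ ∷ L) ≡ suc (runFrom (suc ℓ) L) * runFactorials L
  runFactorials-∷ ℓ L sorted = trans (runFactorials-split ℓ L) (trans
    (cong (_* laterRuns (ℓ ∷ L)) (firstRun≡ (λ t → suc t !) ℓ L sorted)) (rest L sorted))
    where
    rest : ∀ L → Linked ℕ._<_ (ℓ ∷ L) →
      suc (runFrom (suc ℓ) L) ! * laterRuns (ℓ ∷ L) ≡ suc (runFrom (suc ℓ) L) * runFactorials L
    rest [] _ = refl
    rest (ℓ′ ∷ L) (ℓ<ℓ′ ∷ sorted) with ℓ′ ℕₚ.≟ suc ℓ
    ... | no ℓ′≢ = cong (1 *_) (Separated.laterRuns-separated ℓ ℓ′ L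
            (subst (ℕ._< ℓ′) (ℕₚ.+-comm 1 ℓ) (ℕₚ.≤∧≢⇒< ℓ<ℓ′ (ℓ′≢ ∘ sym))))
    ... | yes refl = begin
      suc (suc r) * suc r ! * laterRuns (ℓ ∷ suc ℓ ∷ L)
        ≡⟨ cong (suc (suc r) * suc r ! *_) (Adjacent.laterRuns-adjacent ℓ L) ⟩
      suc (suc r) * suc r ! * laterRuns (suc ℓ ∷ L)
        ≡⟨ ℕₚ.*-assoc (suc (suc r)) (suc r !) _ ⟩
      suc (suc r) * (suc r ! * laterRuns (suc ℓ ∷ L))
        ≡⟨ cong (λ z → suc (suc r) * (z * laterRuns (suc ℓ ∷ L))) (firstRun≡ (λ t → suc t !) (suc ℓ) L sorted) ⟨
      suc (suc r) * (firstRun (λ t → suc t !) (suc ℓ ∷ L) * laterRuns (suc ℓ ∷ L))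
        ≡⟨ cong (suc (suc r) *_) (runFactorials-split (suc ℓ) L) ⟨
      suc (suc r) * runFactorials (suc ℓ ∷ L) ∎
      where
      open ≡-Reasoning
      r = runFrom (suc (suc ℓ)) L

open RunProducts

module Proof (ℝ : CompleteOrderedField) where

  open Lovász ℝ public
  open RealFacts ℝ public
  open SemiringExp semiring public using (^-homo-*)
  open SemiringMult semiring public using (×-homo-+; ×1-homo-*)
  open module Solver = SemiringSolver commutativeSemiring public
    using (solve; _:+_; _:*_; _:=_; con)

  -- Ordered-field arithmetic and the embedded natural numbers

  ≤-refl : ∀ {x} → x ≤ x
  ≤-refl = inj₂ refl

  ≤-reflexive : ∀ {x y} → x ≈ y → x ≤ y
  ≤-reflexive = inj₂

  ≤-trans : ∀ {x y z} → x ≤ y → y ≤ z → x ≤ z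
  ≤-trans {x} {y} {z} p q = begin x ≤⟨ p ⟩ y ≤⟨ q ⟩ z ∎
    where open <R

  +-monoˡ-≤ : ∀ z {x y} → x ≤ y → x + z ≤ y + z
  +-monoˡ-≤ z p = +-mono-≤ p ≤-refl

  +-nonneg : ∀ {x y} → 0# ≤ x → 0# ≤ y → 0# ≤ x + y
  +-nonneg p q = ≤-resp (+-identityˡ 0#) refl (+-mono-≤ p q)

  x≤x+y : ∀ x {y} → 0# ≤ y → x ≤ x + y
  x≤x+y x p = ≤-resp (+-identityʳ x) refl (+-monoʳ-≤ x p)

  *-monoˡ-≤ : ∀ {a x y} → 0# ≤ a → x ≤ y → a * x ≤ a * y
  *-monoˡ-≤ (inj₁ p) (inj₁ q) = inj₁ (*-monoʳ-<-pos p q)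
  *-monoˡ-≤ {a} {x} {y} (inj₂ p) q = inj₂ (trans (*-congʳ (sym p)) (trans (zeroˡ x)
    (trans (sym (zeroˡ y)) (*-congʳ p))))
  *-monoˡ-≤ p (inj₂ q) = inj₂ (*-congˡ q)

  *-monoʳ-≤ : ∀ {a x y} → 0# ≤ a → x ≤ y → x * a ≤ y * a
  *-monoʳ-≤ p q = ≤-resp (*-comm _ _) (*-comm _ _) (*-monoˡ-≤ p q)

  *-nonneg : ∀ {x y} → 0# ≤ x → 0# ≤ y → 0# ≤ x * y
  *-nonneg {x} p q = ≤-resp (zeroʳ x) refl (*-monoˡ-≤ p q)

  *-cancelˡ-≤ : ∀ {a x y} → 0# < a → a * x ≤ a * y → x ≤ y
  *-cancelˡ-≤ p q = ≮⇒≥ λ y<x → ≤⇒≯ q (*-monoʳ-<-pos p y<x)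

  ^-nonneg : ∀ {x} → 0# ≤ x → ∀ n → 0# ≤ x ^ n
  ^-nonneg p zero    = inj₁ 0<1
  ^-nonneg p (suc n) = *-nonneg p (^-nonneg p n)

  ^-pos : ∀ {x} → 0# < x → ∀ n → 0# < x ^ n
  ^-pos p zero    = 0<1
  ^-pos p (suc n) = *-pos p (^-pos p n)

  ⁻¹-inverseˡ : ∀ {x} → x ≉ 0# → x ⁻¹ * x ≈ 1#
  ⁻¹-inverseˡ p = trans (*-comm _ _) (⁻¹-inverseʳ p)

  *-cancelˡ : ∀ {a x y} → a ≉ 0# → a * x ≈ a * y → x ≈ y
  *-cancelˡ {a} {x} {y} p q = begin-equality
    x              ≈⟨ *-identityˡ x ⟨
    1# * x         ≈⟨ *-congʳ (⁻¹-inverseˡ p) ⟨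
    a ⁻¹ * a * x   ≈⟨ *-assoc _ _ _ ⟩
    a ⁻¹ * (a * x) ≈⟨ *-congˡ q ⟩
    a ⁻¹ * (a * y) ≈⟨ *-assoc _ _ _ ⟨
    a ⁻¹ * a * y   ≈⟨ *-congʳ (⁻¹-inverseˡ p) ⟩
    1# * y         ≈⟨ *-identityˡ y ⟩
    y              ∎
    where open <R

  +-cancelʳ : ∀ {x y} z → x + z ≈ y + z → x ≈ y
  +-cancelʳ {x} {y} z h = trans (lemma x) (trans (+-congʳ h) (sym (lemma y)))
    where
    lemma : ∀ w → w ≈ w + z + - z
    lemma w = sym (trans (+-assoc _ _ _) (trans (+-congˡ (-‿inverseʳ z)) (+-identityʳ w)))

  bound± : ∀ x → ∃ λ a → 0# ≤ a × x ≤ a × - x ≤ a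
  bound± x with compare x 0#
  ... | tri< h _ _ = - x , inj₁ (neg-pos h) , inj₁ (<-trans h (neg-pos h)) , ≤-refl
  ... | tri≈ _ h _ = 0# , ≤-refl , inj₂ h , inj₂ (trans (-‿cong h) -0#≈0#)
  ... | tri> _ _ h = x , inj₁ h , ≤-refl , inj₁ (<-trans neg h)
    where
    neg : - x < 0#
    neg = <-resp₂ (+-identityʳ _) (-‿inverseˡ x) (+-monoʳ-< (- x) h)

  ⟦⟧-+ : ∀ m n → ⟦ m ℕ.+ n ⟧ ≈ ⟦ m ⟧ + ⟦ n ⟧
  ⟦⟧-+ = ×-homo-+ 1#

  ⟦⟧-* : ∀ m n → ⟦ m ℕ.* n ⟧ ≈ ⟦ m ⟧ * ⟦ n ⟧
  ⟦⟧-* = ×1-homo-*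

  ⟦1⟧ : ⟦ 1 ⟧ ≈ 1#
  ⟦1⟧ = +-identityʳ 1#

  ⟦⟧-^ : ∀ m n → ⟦ m ℕ.^ n ⟧ ≈ ⟦ m ⟧ ^ n
  ⟦⟧-^ m zero    = ⟦1⟧
  ⟦⟧-^ m (suc n) = trans (⟦⟧-* m (m ℕ.^ n)) (*-congˡ (⟦⟧-^ m n))

  ⟦⟧-nonneg : ∀ n → 0# ≤ ⟦ n ⟧
  ⟦⟧-nonneg zero    = ≤-refl
  ⟦⟧-nonneg (suc n) = +-nonneg (inj₁ 0<1) (⟦⟧-nonneg n)

  ⟦⟧-pos : ∀ {n} → 0 ℕ.< n → 0# < ⟦ n ⟧
  ⟦⟧-pos {suc n} _ = <-≤-trans 0<1 (x≤x+y 1# (⟦⟧-nonneg n))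

  ⟦⟧-mono : ∀ {m n} → m ℕ.≤ n → ⟦ m ⟧ ≤ ⟦ n ⟧
  ⟦⟧-mono {n = n} ℕ.z≤n = ⟦⟧-nonneg n
  ⟦⟧-mono (ℕ.s≤s h) = +-monoʳ-≤ 1# (⟦⟧-mono h)

  archimedean : ∀ x → ∃ λ n → x < ⟦ n ⟧
  archimedean x with em (∃ λ n → x < ⟦ n ⟧)
  ... | yes h = h
  ... | no ¬h = ⊥-elim (contra (complete (λ y → ∃ λ n → y ≈ ⟦ n ⟧) (0# , 0 , refl)
      (x , λ { y (n , eq) → ≮⇒≥ λ x<y → ¬h (n , <-resp₂ refl eq x<y) })))
    where
    contra : ∃ (IsSupremum λ y → ∃ λ n → y ≈ ⟦ n ⟧) → _
    contra (s , ub , approx) with approx (s - 1#) (<-resp₂ refl (y-x+x≈y 1# s) (x<x+ε (s - 1#) 0<1))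
    ... | y , (n , eq) , s-1<y = ≤⇒≯ (ub ⟦ suc n ⟧ (suc n , refl))
      (<-resp₂ (y-x+x≈y 1# s) (trans (+-congʳ eq) (+-comm ⟦ n ⟧ 1#)) (+-monoˡ-< 1# s-1<y))

  initial-segment-bound : ∀ (f : ℕ → Carrier) m → ∃ λ u → 0# ≤ u × ∀ n → n ℕ.< m → f n ≤ u
  initial-segment-bound f zero = 0# , ≤-refl , λ n ()
  initial-segment-bound f (suc m) =
    let u , 0≤u , h     = initial-segment-bound f m
        a , 0≤a , b , _ = bound± (f m)
    in u + a , +-nonneg 0≤u 0≤a , λ n n<m → case (ℕₚ.m≤n⇒m<n∨m≡n (ℕₚ.≤-pred n<m)) u a 0≤u 0≤a h b
    where
    case : ∀ {n} → n ℕ.< m ⊎ n ≡ m → ∀ u a → 0# ≤ u → 0# ≤ a → (∀ n → n ℕ.< m → f n ≤ u) →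
           f m ≤ a → f n ≤ u + a
    case (inj₁ n<m) u a 0≤u 0≤a h b = ≤-trans (h _ n<m) (x≤x+y u 0≤a)
    case (inj₂ ≡.refl) u a 0≤u 0≤a h b = ≤-trans b (≤-resp refl (+-comm a u) (x≤x+y a 0≤u))

  -- Sums over subsets

  -- Interchange of summations is proved once against this interface; it is applied both to the sum
  -- over vertices and to `∑ₛ` itself.
  record Additive {X : Set} (T : (X → Carrier) → Carrier) : Set where
    field
      cong   : ∀ {f g} → (∀ x → f x ≈ g x) → T f ≈ T g
      +-homo : ∀ f g → T (λ x → f x + g x) ≈ T f + T g
      0-homo : T (λ _ → 0#) ≈ 0#

  sum-additive : ∀ {n} → Additive (sum {n})
  sum-additive {n} = record
    { cong   = sum-cong-≋
    ; +-homo = ∑-distrib-+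
    ; 0-homo = sum-0 {n} (λ _ → 0#) (λ _ → refl)
    }

  ∑< : ℕ → (ℕ → Carrier) → Carrier
  ∑< zero    f = 0#
  ∑< (suc m) f = ∑< m f + f m

  ∑<-cong : ∀ m {f g : ℕ → Carrier} → (∀ j → j ℕ.< m → f j ≈ g j) → ∑< m f ≈ ∑< m g
  ∑<-cong zero    h = refl
  ∑<-cong (suc m) h = +-cong (∑<-cong m (λ j p → h j (ℕₚ.m<n⇒m<1+n p))) (h m ℕₚ.≤-refl)

  interchange : ∀ a b c d → (a + b) + (c + d) ≈ (a + c) + (b + d)
  interchange = solve 4 (λ a b c d → (a :+ b) :+ (c :+ d) := (a :+ c) :+ (b :+ d)) refl

  ∑<-*ˡ : ∀ m c f → ∑< m (λ j → c * f j) ≈ c * ∑< m f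
  ∑<-*ˡ zero    c f = sym (zeroʳ c)
  ∑<-*ˡ (suc m) c f = trans (+-congʳ (∑<-*ˡ m c f)) (sym (distribˡ c _ _))

  ∑<-swap : ∀ {X : Set} {T : (X → Carrier) → Carrier} → Additive T → ∀ m (f : ℕ → X → Carrier) →
    T (λ x → ∑< m (λ j → f j x)) ≈ ∑< m (λ j → T (f j))
  ∑<-swap A zero    f = Additive.0-homo A
  ∑<-swap A (suc m) f = trans (Additive.+-homo A _ _) (+-congʳ (∑<-swap A m f))

  -- The recursion decides whether the first element belongs to the set. It runs parallel to that of
  -- `[_⊆_]`, so that counts reduce coordinate by coordinate to Pascal's rule.
  ∑ₛ : ∀ n (e : ℕ) → (Subset n → Carrier) → Carrier
  ∑ₛ zero    zero    f = f []
  ∑ₛ zero    (suc e) f = 0#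
  ∑ₛ (suc n) zero    f = ∑ₛ n zero (f ∘ (outside ∷_))
  ∑ₛ (suc n) (suc e) f = ∑ₛ n e (f ∘ (inside ∷_)) + ∑ₛ n (suc e) (f ∘ (outside ∷_))

  ∑ₛ-cong : ∀ n e {f g : Subset n → Carrier} → (∀ E → ∣ E ∣ ≡ e → f E ≈ g E) → ∑ₛ n e f ≈ ∑ₛ n e g
  ∑ₛ-cong zero    zero    h = h [] ≡.refl
  ∑ₛ-cong zero    (suc e) h = refl
  ∑ₛ-cong (suc n) zero    h = ∑ₛ-cong n zero (λ E → h (outside ∷ E))
  ∑ₛ-cong (suc n) (suc e) h = +-cong (∑ₛ-cong n e (λ E p → h (inside ∷ E) (≡.cong suc p)))
                                     (∑ₛ-cong n (suc e) (λ E → h (outside ∷ E)))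

  ∑ₛ-additive : ∀ n e → Additive (∑ₛ n e)
  ∑ₛ-additive n e = record
    { cong = λ h → ∑ₛ-cong n e (λ E _ → h E) ; +-homo = plus n e ; 0-homo = nil n e }
    where
    plus : ∀ n e f g → ∑ₛ n e (λ E → f E + g E) ≈ ∑ₛ n e f + ∑ₛ n e g
    plus zero    zero    f g = refl
    plus zero    (suc e) f g = sym (+-identityˡ 0#)
    plus (suc n) zero    f g = plus n zero _ _
    plus (suc n) (suc e) f g = trans (+-cong (plus n e _ _) (plus n (suc e) _ _)) (interchange _ _ _ _)
    nil : ∀ n e → ∑ₛ n e (λ _ → 0#) ≈ 0#
    nil zero    zero    = refl
    nil zero    (suc e) = refl
    nil (suc n) zero    = nil n zero
    nil (suc n) (suc e) = trans (+-cong (nil n e) (nil n (suc e))) (+-identityˡ 0#)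

  ∑ₛ-*ˡ : ∀ n e c f → ∑ₛ n e (λ E → c * f E) ≈ c * ∑ₛ n e f
  ∑ₛ-*ˡ zero    zero    c f = refl
  ∑ₛ-*ˡ zero    (suc e) c f = sym (zeroʳ c)
  ∑ₛ-*ˡ (suc n) zero    c f = ∑ₛ-*ˡ n zero c _
  ∑ₛ-*ˡ (suc n) (suc e) c f = trans (+-cong (∑ₛ-*ˡ n e c _) (∑ₛ-*ˡ n (suc e) c _)) (sym (distribˡ c _ _))

  ∑ₛ-*ʳ : ∀ n e c f → ∑ₛ n e (λ E → f E * c) ≈ ∑ₛ n e f * c
  ∑ₛ-*ʳ n e c f = trans (Additive.cong (∑ₛ-additive n e) (λ E → *-comm (f E) c))
    (trans (∑ₛ-*ˡ n e c f) (*-comm c _))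

  ∑ₛ-swap : ∀ {X : Set} {T : (X → Carrier) → Carrier} → Additive T → ∀ n e (f : Subset n → X → Carrier) →
    T (λ x → ∑ₛ n e (λ E → f E x)) ≈ ∑ₛ n e (λ E → T (f E))
  ∑ₛ-swap A zero    zero    f = refl
  ∑ₛ-swap A zero    (suc e) f = Additive.0-homo A
  ∑ₛ-swap A (suc n) zero    f = ∑ₛ-swap A n zero _
  ∑ₛ-swap A (suc n) (suc e) f = trans (Additive.+-homo A _ _)
    (+-cong (∑ₛ-swap A n e _) (∑ₛ-swap A n (suc e) _))

  ∑ₛ-nonneg : ∀ n e f → (∀ E → 0# ≤ f E) → 0# ≤ ∑ₛ n e f
  ∑ₛ-nonneg zero    zero    f h = h []
  ∑ₛ-nonneg zero    (suc e) f h = ≤-refl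
  ∑ₛ-nonneg (suc n) zero    f h = ∑ₛ-nonneg n zero _ (λ E → h (outside ∷ E))
  ∑ₛ-nonneg (suc n) (suc e) f h = +-nonneg (∑ₛ-nonneg n e _ (λ E → h (inside ∷ E)))
                                           (∑ₛ-nonneg n (suc e) _ (λ E → h (outside ∷ E)))

  [_⊆_] : ∀ {n} → Subset n → Subset n → Carrier
  [ []          ⊆ []          ] = 1#
  [ outside ∷ E ⊆ _ ∷ A       ] = [ E ⊆ A ]
  [ inside ∷ E  ⊆ inside ∷ A  ] = [ E ⊆ A ]
  [ inside ∷ E  ⊆ outside ∷ A ] = 0#

  ⊆-∩ : ∀ {n} (E A B : Subset n) → [ E ⊆ A ] * [ E ⊆ B ] ≈ [ E ⊆ A ∩ B ]
  ⊆-∩ []            []            []            = *-identityˡ 1#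
  ⊆-∩ (outside ∷ E) (_ ∷ A)       (_ ∷ B)       = ⊆-∩ E A B
  ⊆-∩ (inside ∷ E)  (inside ∷ A)  (inside ∷ B)  = ⊆-∩ E A B
  ⊆-∩ (inside ∷ E)  (inside ∷ A)  (outside ∷ B) = zeroʳ _
  ⊆-∩ (inside ∷ E)  (outside ∷ A) (_ ∷ B)       = zeroˡ _

  ∪-⊆ : ∀ {n} (S T E : Subset n) → [ S ⊆ E ] * [ T ⊆ E ] ≈ [ S ∪ T ⊆ E ]
  ∪-⊆ []            []            []            = *-identityˡ 1#
  ∪-⊆ (outside ∷ S) (outside ∷ T) (_ ∷ E)       = ∪-⊆ S T E
  ∪-⊆ (outside ∷ S) (inside ∷ T)  (inside ∷ E)  = ∪-⊆ S T E
  ∪-⊆ (outside ∷ S) (inside ∷ T)  (outside ∷ E) = zeroʳ _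
  ∪-⊆ (inside ∷ S)  (outside ∷ T) (inside ∷ E)  = ∪-⊆ S T E
  ∪-⊆ (inside ∷ S)  (inside ∷ T)  (inside ∷ E)  = ∪-⊆ S T E
  ∪-⊆ (inside ∷ S)  (_ ∷ T)       (outside ∷ E) = zeroˡ _

  ∣∪∣+∣∩∣ : ∀ {n} (S T : Subset n) → ∣ S ∪ T ∣ ℕ.+ ∣ S ∩ T ∣ ≡ ∣ S ∣ ℕ.+ ∣ T ∣
  ∣∪∣+∣∩∣ []            []            = ≡.refl
  ∣∪∣+∣∩∣ (outside ∷ S) (outside ∷ T) = ∣∪∣+∣∩∣ S T
  ∣∪∣+∣∩∣ (outside ∷ S) (inside ∷ T)  = ≡.trans (≡.cong suc (∣∪∣+∣∩∣ S T)) (≡.sym (ℕₚ.+-suc ∣ S ∣ ∣ T ∣))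
  ∣∪∣+∣∩∣ (inside ∷ S)  (outside ∷ T) = ≡.cong suc (∣∪∣+∣∩∣ S T)
  ∣∪∣+∣∩∣ (inside ∷ S)  (inside ∷ T)  = ≡.cong suc (≡.trans (ℕₚ.+-suc ∣ S ∪ T ∣ ∣ S ∩ T ∣)
    (≡.trans (≡.cong suc (∣∪∣+∣∩∣ S T)) (≡.sym (ℕₚ.+-suc ∣ S ∣ ∣ T ∣))))

  ⊆-size : ∀ {n} (R A : Subset n) → [ R ⊆ A ] ≈ 0# ⊎ ∣ R ∣ ℕ.≤ ∣ A ∣
  ⊆-size []            []            = inj₂ ℕ.z≤n
  ⊆-size (outside ∷ R) (outside ∷ A) = ⊆-size R A
  ⊆-size (outside ∷ R) (inside ∷ A)  with ⊆-size R A
  ... | inj₁ z = inj₁ z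
  ... | inj₂ h = inj₂ (ℕₚ.m≤n⇒m≤1+n h)
  ⊆-size (inside ∷ R)  (outside ∷ A) = inj₁ refl
  ⊆-size (inside ∷ R)  (inside ∷ A)  with ⊆-size R A
  ... | inj₁ z = inj₁ z
  ... | inj₂ h = inj₂ (ℕ.s≤s h)

  ⊤-⊆ : ∀ {n} (R : Subset n) → [ R ⊆ ⊤ ] ≈ 1#
  ⊤-⊆ []            = refl
  ⊤-⊆ (inside ∷ R)  = ⊤-⊆ R
  ⊤-⊆ (outside ∷ R) = ⊤-⊆ R

  ∑ₛ-0 : ∀ n e {f : Subset n → Carrier} → (∀ E → f E ≈ 0#) → ∑ₛ n e f ≈ 0#
  ∑ₛ-0 n e h = trans (Additive.cong (∑ₛ-additive n e) h) (Additive.0-homo (∑ₛ-additive n e))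

  ⟦pascal⟧ : ∀ a b c → ⟦ shiftedC (suc a) b c ⟧ ≈ ⟦ shiftedC a b c ⟧ + ⟦ shiftedC a b (suc c) ⟧
  ⟦pascal⟧ a b c = trans (reflexive (≡.cong ⟦_⟧ (shiftedC-pascal a b c))) (⟦⟧-+ (shiftedC a b c) (shiftedC a b (suc c)))

  ∑ₛ-between : ∀ n ℓ (R A : Subset n) → ∑ₛ n ℓ (λ S → [ R ⊆ S ] * [ S ⊆ A ]) ≈
    [ R ⊆ A ] * ⟦ shiftedC (∣ A ∣ ∸ ∣ R ∣) ℓ ∣ R ∣ ⟧
  ∑ₛ-between zero zero    [] [] = *-congˡ (sym ⟦1⟧)
  ∑ₛ-between zero (suc ℓ) [] [] = sym (zeroʳ _)
  ∑ₛ-between (suc n) zero    (outside ∷ R) (outside ∷ A) = ∑ₛ-between n zero R A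
  ∑ₛ-between (suc n) (suc ℓ) (outside ∷ R) (outside ∷ A) =
    trans (+-cong (∑ₛ-0 n ℓ (λ S → zeroʳ _)) (∑ₛ-between n (suc ℓ) R A)) (+-identityˡ _)
  ∑ₛ-between (suc n) zero    (inside ∷ R) (outside ∷ A) = trans (∑ₛ-0 n zero (λ S → zeroˡ _)) (sym (zeroˡ _))
  ∑ₛ-between (suc n) (suc ℓ) (inside ∷ R) (outside ∷ A) = trans
    (+-cong (∑ₛ-0 n ℓ (λ S → zeroʳ _)) (∑ₛ-0 n (suc ℓ) (λ S → zeroˡ _)))
    (trans (+-identityˡ 0#) (sym (zeroˡ _)))
  ∑ₛ-between (suc n) zero    (inside ∷ R) (inside ∷ A) = trans (∑ₛ-0 n zero (λ S → zeroˡ _)) (sym (zeroʳ _))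
  ∑ₛ-between (suc n) (suc ℓ) (inside ∷ R) (inside ∷ A) = trans
    (+-cong (∑ₛ-between n ℓ R A) (∑ₛ-0 n (suc ℓ) (λ S → zeroˡ _))) (+-identityʳ _)
  -- Only here is the first coordinate of S free, and Pascal's rule enters. It needs |R| ≤ |A|, to
  -- move the successor through the truncated subtraction; otherwise [R ⊆ A] is 0 and everything
  -- vanishes.
  ∑ₛ-between (suc n) ℓ       (outside ∷ R) (inside ∷ A) with ⊆-size R A
  ... | inj₁ z = trans (vanish ℓ) (sym (trans (*-congʳ z) (zeroˡ _)))
    where
    vanish′ : ∀ ℓ → ∑ₛ n ℓ (λ S → [ R ⊆ S ] * [ S ⊆ A ]) ≈ 0#
    vanish′ ℓ = trans (∑ₛ-between n ℓ R A) (trans (*-congʳ z) (zeroˡ _))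
    vanish : ∀ ℓ → ∑ₛ (suc n) ℓ (λ S → [ outside ∷ R ⊆ S ] * [ S ⊆ inside ∷ A ]) ≈ 0#
    vanish zero    = vanish′ zero
    vanish (suc ℓ) = trans (+-cong (vanish′ ℓ) (vanish′ (suc ℓ))) (+-identityˡ 0#)
  ∑ₛ-between (suc n) zero    (outside ∷ R) (inside ∷ A) | inj₂ h = begin-equality
    ∑ₛ n zero (λ S → [ R ⊆ S ] * [ S ⊆ A ])
      ≈⟨ ∑ₛ-between n zero R A ⟩
    [ R ⊆ A ] * ⟦ shiftedC (∣ A ∣ ∸ ∣ R ∣) 0 ∣ R ∣ ⟧
      ≈⟨ *-congˡ (trans (⟦pascal⟧ (∣ A ∣ ∸ ∣ R ∣) 0 ∣ R ∣) (+-identityʳ _)) ⟨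
    [ R ⊆ A ] * ⟦ shiftedC (suc (∣ A ∣ ∸ ∣ R ∣)) 0 ∣ R ∣ ⟧
      ≡⟨ ≡.cong (λ a → [ R ⊆ A ] * ⟦ shiftedC a 0 ∣ R ∣ ⟧) (ℕₚ.+-∸-assoc 1 h) ⟨
    [ R ⊆ A ] * ⟦ shiftedC (suc ∣ A ∣ ∸ ∣ R ∣) 0 ∣ R ∣ ⟧ ∎
    where open <R
  ∑ₛ-between (suc n) (suc ℓ) (outside ∷ R) (inside ∷ A) | inj₂ h = begin-equality
    ∑ₛ n ℓ (λ S → [ R ⊆ S ] * [ S ⊆ A ]) + ∑ₛ n (suc ℓ) (λ S → [ R ⊆ S ] * [ S ⊆ A ])
      ≈⟨ +-cong (∑ₛ-between n ℓ R A) (∑ₛ-between n (suc ℓ) R A) ⟩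
    [ R ⊆ A ] * ⟦ shiftedC (∣ A ∣ ∸ ∣ R ∣) ℓ ∣ R ∣ ⟧ + [ R ⊆ A ] * ⟦ shiftedC (∣ A ∣ ∸ ∣ R ∣) (suc ℓ) ∣ R ∣ ⟧
      ≈⟨ distribˡ _ _ _ ⟨
    [ R ⊆ A ] * (⟦ shiftedC (∣ A ∣ ∸ ∣ R ∣) ℓ ∣ R ∣ ⟧ + ⟦ shiftedC (∣ A ∣ ∸ ∣ R ∣) (suc ℓ) ∣ R ∣ ⟧)
      ≈⟨ *-congˡ (trans (⟦pascal⟧ (∣ A ∣ ∸ ∣ R ∣) (suc ℓ) ∣ R ∣) (+-comm _ _)) ⟨
    [ R ⊆ A ] * ⟦ shiftedC (suc (∣ A ∣ ∸ ∣ R ∣)) (suc ℓ) ∣ R ∣ ⟧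
      ≡⟨ ≡.cong (λ a → [ R ⊆ A ] * ⟦ shiftedC a (suc ℓ) ∣ R ∣ ⟧) (ℕₚ.+-∸-assoc 1 h) ⟨
    [ R ⊆ A ] * ⟦ shiftedC (suc ∣ A ∣ ∸ ∣ R ∣) (suc ℓ) ∣ R ∣ ⟧ ∎
    where open <R

  ∑ₛ-⊆ : ∀ n e (A : Subset n) → ∑ₛ n e (λ E → [ E ⊆ A ]) ≈ ⟦ ∣ A ∣ C e ⟧
  ∑ₛ-⊆ zero    zero    []            = sym ⟦1⟧
  ∑ₛ-⊆ zero    (suc e) []            = refl
  ∑ₛ-⊆ (suc n) zero    (_ ∷ A)       = ∑ₛ-⊆ n zero A
  ∑ₛ-⊆ (suc n) (suc e) (outside ∷ A) = trans (+-cong (∑ₛ-0 n e (λ _ → refl)) (∑ₛ-⊆ n (suc e) A)) (+-identityˡ _)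
  ∑ₛ-⊆ (suc n) (suc e) (inside ∷ A)  = trans (+-cong (∑ₛ-⊆ n e A) (∑ₛ-⊆ n (suc e) A))
    (sym (trans (reflexive (≡.cong ⟦_⟧ (pascal ∣ A ∣ e))) (⟦⟧-+ (∣ A ∣ C e) (∣ A ∣ C suc e))))

  ∑ₛ-⊇ : ∀ n e (U : Subset n) → ∑ₛ n e (λ E → [ U ⊆ E ]) ≈ ⟦ shiftedC (n ∸ ∣ U ∣) e ∣ U ∣ ⟧
  ∑ₛ-⊇ n e U = begin-equality
    ∑ₛ n e (λ E → [ U ⊆ E ])
      ≈⟨ Additive.cong (∑ₛ-additive n e) (λ E → trans (*-congˡ (⊤-⊆ E)) (*-identityʳ _)) ⟨
    ∑ₛ n e (λ E → [ U ⊆ E ] * [ E ⊆ ⊤ ])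
      ≈⟨ ∑ₛ-between n e U ⊤ ⟩
    [ U ⊆ ⊤ ] * ⟦ shiftedC (∣ ⊤ {n} ∣ ∸ ∣ U ∣) e ∣ U ∣ ⟧
      ≈⟨ trans (*-congʳ (⊤-⊆ U)) (*-identityˡ _) ⟩
    ⟦ shiftedC (∣ ⊤ {n} ∣ ∸ ∣ U ∣) e ∣ U ∣ ⟧
      ≡⟨ ≡.cong (λ a → ⟦ shiftedC (a ∸ ∣ U ∣) e ∣ U ∣ ⟧) (∣⊤∣≡n n) ⟩
    ⟦ shiftedC (n ∸ ∣ U ∣) e ∣ U ∣ ⟧ ∎
    where open <R

  binomialSum : ℕ → ℕ → (ℕ → Carrier) → Carrier
  binomialSum J i h = ∑< J (λ j → ⟦ i C j ⟧ * h j)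

  binomialSum-suc : ∀ J i h →
    binomialSum (suc J) (suc i) h ≈ binomialSum (suc J) i h + binomialSum J i (h ∘ suc)
  binomialSum-suc zero    i h = sym (+-identityʳ _)
  binomialSum-suc (suc J) i h = begin-equality
    binomialSum (suc J) (suc i) h + ⟦ suc i C suc J ⟧ * h (suc J)
      ≈⟨ +-cong (binomialSum-suc J i h) (*-congʳ (trans (reflexive (≡.cong ⟦_⟧ (pascal i J))) (⟦⟧-+ (i C J) (i C suc J)))) ⟩
    binomialSum (suc J) i h + binomialSum J i (h ∘ suc) + (⟦ i C J ⟧ + ⟦ i C suc J ⟧) * h (suc J)
      ≈⟨ solve 5 (λ a b c d e → a :+ b :+ (c :+ d) :* e := (a :+ d :* e) :+ (b :+ c :* e)) refl
           (binomialSum (suc J) i h) (binomialSum J i (h ∘ suc)) ⟦ i C J ⟧ ⟦ i C suc J ⟧ (h (suc J)) ⟩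
    binomialSum (suc (suc J)) i h + binomialSum (suc J) i (h ∘ suc) ∎
    where open <R

  binomialSum-0 : ∀ J h → binomialSum (suc J) 0 h ≈ h 0
  binomialSum-0 zero    h = trans (+-identityˡ _) (trans (*-congʳ ⟦1⟧) (*-identityˡ _))
  binomialSum-0 (suc J) h = trans (+-cong (binomialSum-0 J h) (zeroˡ _)) (+-identityʳ _)

  -- Vandermonde's C(a+i, b-w+i+d) = Σ C(i,j) C(a, b-w+j+d). The shift `d` is kept free because
  -- Pascal's rule in `i` leads to d+1; any range `J` above i will do, as C(i,j) = 0 for j > i.
  vandermonde : ∀ a b w i d J → i ℕ.< J → i ℕ.+ d ℕ.≤ w →
    ⟦ shiftedC (a ℕ.+ i) b (w ∸ (i ℕ.+ d)) ⟧ ≈ binomialSum J i (λ j → ⟦ shiftedC a b (w ∸ (j ℕ.+ d)) ⟧)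
  vandermonde a b w zero d (suc J) i<J h = trans
    (reflexive (≡.cong (λ z → ⟦ shiftedC z b (w ∸ d) ⟧) (ℕₚ.+-identityʳ a)))
    (sym (binomialSum-0 J _))
  vandermonde a b w (suc i) d (suc J) (ℕ.s≤s i<J) h = begin-equality
    ⟦ shiftedC (a ℕ.+ suc i) b (w ∸ suc (i ℕ.+ d)) ⟧
      ≡⟨ ≡.cong (λ z → ⟦ shiftedC z b (w ∸ suc (i ℕ.+ d)) ⟧) (ℕₚ.+-suc a i) ⟩
    ⟦ shiftedC (suc (a ℕ.+ i)) b (w ∸ suc (i ℕ.+ d)) ⟧
      ≈⟨ ⟦pascal⟧ (a ℕ.+ i) b (w ∸ suc (i ℕ.+ d)) ⟩
    ⟦ shiftedC (a ℕ.+ i) b (w ∸ suc (i ℕ.+ d)) ⟧ + ⟦ shiftedC (a ℕ.+ i) b (suc (w ∸ suc (i ℕ.+ d))) ⟧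
      ≈⟨ +-comm _ _ ⟩
    ⟦ shiftedC (a ℕ.+ i) b (suc (w ∸ suc (i ℕ.+ d))) ⟧ + ⟦ shiftedC (a ℕ.+ i) b (w ∸ suc (i ℕ.+ d)) ⟧
      ≡⟨ ≡.cong₂ (λ y z → ⟦ shiftedC (a ℕ.+ i) b y ⟧ + ⟦ shiftedC (a ℕ.+ i) b (w ∸ z) ⟧)
           (≡.sym (ℕₚ.+-∸-assoc 1 h)) (≡.sym (ℕₚ.+-suc i d)) ⟩
    ⟦ shiftedC (a ℕ.+ i) b (w ∸ (i ℕ.+ d)) ⟧ + ⟦ shiftedC (a ℕ.+ i) b (w ∸ (i ℕ.+ suc d)) ⟧
      ≈⟨ +-cong (vandermonde a b w i d (suc J) (ℕₚ.m<n⇒m<1+n i<J) (ℕₚ.<⇒≤ h))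
                (vandermonde a b w i (suc d) J i<J (≡.subst (ℕ._≤ w) (≡.sym (ℕₚ.+-suc i d)) h)) ⟩
    binomialSum (suc J) i g + binomialSum J i (λ j → ⟦ shiftedC a b (w ∸ (j ℕ.+ suc d)) ⟧)
      ≈⟨ +-congˡ (∑<-cong J (λ j _ → *-congˡ (reflexive
           (≡.cong (λ z → ⟦ shiftedC a b (w ∸ z) ⟧) (ℕₚ.+-suc j d))))) ⟩
    binomialSum (suc J) i g + binomialSum J i (g ∘ suc)
      ≈⟨ binomialSum-suc J i g ⟨
    binomialSum (suc J) (suc i) g ∎
    where
    g : ℕ → Carrier
    g j = ⟦ shiftedC a b (w ∸ (j ℕ.+ d)) ⟧
    open <R

  ∑ₛ≈ : ∀ n e {f g : Subset n → Carrier} → (∀ E → f E ≈ g E) → ∑ₛ n e f ≈ ∑ₛ n e g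
  ∑ₛ≈ n e = Additive.cong (∑ₛ-additive n e)

  ∑ₛ-product : ∀ n a b (f g : Subset n → Carrier) →
    ∑ₛ n a f * ∑ₛ n b g ≈ ∑ₛ n a (λ S → ∑ₛ n b (λ T → f S * g T))
  ∑ₛ-product n a b f g = sym (trans (∑ₛ≈ n a (λ S → ∑ₛ-*ˡ n b (f S) g)) (∑ₛ-*ʳ n a (∑ₛ n b g) f))

  -- Gram matrices of inclusion vectors

  module Gram {n : ℕ} where

    common : ℕ → Subset n → Subset n → Carrier
    common ℓ E A = ∑ₛ n ℓ (λ S → [ S ⊆ E ] * [ S ⊆ A ])

    common≈ : ∀ ℓ A B → common ℓ A B ≈ ⟦ ∣ A ∩ B ∣ C ℓ ⟧
    common≈ ℓ A B = trans (∑ₛ≈ n ℓ (λ S → ⊆-∩ S A B)) (∑ₛ-⊆ n ℓ (A ∩ B))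

    -- After interchanging the sums, each ℓ-set S ⊆ A ∩ B is counted once for every e-set between S
    -- and A, which is C(k-ℓ,e-ℓ) times.
    gram-⊆-common : ∀ {k} e ℓ (A B : Subset n) → ∣ A ∣ ≡ k →
      ∑ₛ n e (λ E → [ E ⊆ A ] * common ℓ E B) ≈ ⟦ shiftedC (k ∸ ℓ) e ℓ ⟧ * ⟦ ∣ A ∩ B ∣ C ℓ ⟧
    gram-⊆-common {k} e ℓ A B ∣A∣≡k = begin-equality
      ∑ₛ n e (λ E → [ E ⊆ A ] * ∑ₛ n ℓ (λ S → [ S ⊆ E ] * [ S ⊆ B ]))
        ≈⟨ ∑ₛ≈ n e (λ E → ∑ₛ-*ˡ n ℓ _ _) ⟨
      ∑ₛ n e (λ E → ∑ₛ n ℓ (λ S → [ E ⊆ A ] * ([ S ⊆ E ] * [ S ⊆ B ])))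
        ≈⟨ ∑ₛ-swap (∑ₛ-additive n e) n ℓ _ ⟩
      ∑ₛ n ℓ (λ S → ∑ₛ n e (λ E → [ E ⊆ A ] * ([ S ⊆ E ] * [ S ⊆ B ])))
        ≈⟨ ∑ₛ≈ n ℓ (λ S → trans
             (∑ₛ≈ n e (λ E → solve 3 (λ a b c → a :* (b :* c) := c :* (b :* a)) refl _ _ _))
             (∑ₛ-*ˡ n e [ S ⊆ B ] _)) ⟩
      ∑ₛ n ℓ (λ S → [ S ⊆ B ] * ∑ₛ n e (λ E → [ S ⊆ E ] * [ E ⊆ A ]))
        ≈⟨ ∑ₛ-cong n ℓ (λ S ∣S∣≡ℓ → trans
             (*-congˡ (trans (∑ₛ-between n e S A) (*-congˡ (reflexive (≡.cong₂
               (λ a s → ⟦ shiftedC (a ∸ s) e s ⟧) ∣A∣≡k ∣S∣≡ℓ)))))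
             (solve 3 (λ a b c → a :* (b :* c) := c :* (b :* a)) refl _ _ _)) ⟩
      ∑ₛ n ℓ (λ S → ⟦ shiftedC (k ∸ ℓ) e ℓ ⟧ * ([ S ⊆ A ] * [ S ⊆ B ]))
        ≈⟨ ∑ₛ-*ˡ n ℓ _ _ ⟩
      ⟦ shiftedC (k ∸ ℓ) e ℓ ⟧ * common ℓ A B
        ≈⟨ *-congˡ (common≈ ℓ A B) ⟩
      ⟦ shiftedC (k ∸ ℓ) e ℓ ⟧ * ⟦ ∣ A ∩ B ∣ C ℓ ⟧ ∎
      where open <R

    -- The count depends on |S ∪ T| = 2ℓ − |S ∩ T| only; Vandermonde expands it in |S ∩ T|.
    ∑ₛ-⊇² : ∀ e ℓ (S T : Subset n) → ℓ ℕ.+ ℓ ℕ.≤ n → ∣ S ∣ ≡ ℓ → ∣ T ∣ ≡ ℓ →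
      ∑ₛ n e (λ E → [ S ⊆ E ] * [ T ⊆ E ]) ≈
      ∑< (suc ℓ) (λ j → ⟦ ∣ S ∩ T ∣ C j ⟧ * ⟦ shiftedC (n ∸ (ℓ ℕ.+ ℓ)) e ((ℓ ℕ.+ ℓ) ∸ j) ⟧)
    ∑ₛ-⊇² e ℓ S T 2ℓ≤n ∣S∣ ∣T∣ = begin-equality
      ∑ₛ n e (λ E → [ S ⊆ E ] * [ T ⊆ E ])
        ≈⟨ ∑ₛ≈ n e (λ E → ∪-⊆ S T E) ⟩
      ∑ₛ n e (λ E → [ S ∪ T ⊆ E ])
        ≈⟨ ∑ₛ-⊇ n e (S ∪ T) ⟩
      ⟦ shiftedC (n ∸ ∣ S ∪ T ∣) e ∣ S ∪ T ∣ ⟧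
        ≡⟨ ≡.cong₂ (λ a b → ⟦ shiftedC a e b ⟧) n∸u u≡ ⟩
      ⟦ shiftedC (n ∸ w ℕ.+ i) e (w ∸ (i ℕ.+ 0)) ⟧
        ≈⟨ vandermonde (n ∸ w) e w i 0 (suc ℓ) (ℕ.s≤s i≤ℓ)
             (≡.subst (ℕ._≤ w) (≡.sym (ℕₚ.+-identityʳ i)) (ℕₚ.≤-trans i≤ℓ (ℕₚ.m≤m+n ℓ ℓ))) ⟩
      binomialSum (suc ℓ) i (λ j → ⟦ shiftedC (n ∸ w) e (w ∸ (j ℕ.+ 0)) ⟧)
        ≈⟨ ∑<-cong (suc ℓ) (λ j _ → *-congˡ (reflexive
             (≡.cong (λ z → ⟦ shiftedC (n ∸ w) e (w ∸ z) ⟧) (ℕₚ.+-identityʳ j)))) ⟩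
      ∑< (suc ℓ) (λ j → ⟦ i C j ⟧ * ⟦ shiftedC (n ∸ w) e (w ∸ j) ⟧) ∎
      where
      open <R
      w = ℓ ℕ.+ ℓ
      i = ∣ S ∩ T ∣
      u+i≡w : ∣ S ∪ T ∣ ℕ.+ i ≡ w
      u+i≡w = ≡.trans (∣∪∣+∣∩∣ S T) (≡.cong₂ ℕ._+_ ∣S∣ ∣T∣)
      i≤ℓ : i ℕ.≤ ℓ
      i≤ℓ = ≡.subst (i ℕ.≤_) ∣S∣ (∣p∩q∣≤∣p∣ S T)
      u≡ : ∣ S ∪ T ∣ ≡ w ∸ (i ℕ.+ 0)
      u≡ = ≡.trans (≡.sym (ℕₚ.m+n∸n≡m ∣ S ∪ T ∣ i))
             (≡.cong₂ _∸_ u+i≡w (≡.sym (ℕₚ.+-identityʳ i)))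
      n∸u : n ∸ ∣ S ∪ T ∣ ≡ n ∸ w ℕ.+ i
      n∸u = ≡.trans (≡.cong (_∸ ∣ S ∪ T ∣) n≡) (ℕₚ.m+n∸n≡m (n ∸ w ℕ.+ i) ∣ S ∪ T ∣)
        where
        n≡ : n ≡ n ∸ w ℕ.+ i ℕ.+ ∣ S ∪ T ∣
        n≡ = ≡.trans (≡.sym (ℕₚ.m∸n+n≡m 2ℓ≤n)) (≡.trans
               (≡.cong (n ∸ w ℕ.+_) (≡.trans (≡.sym u+i≡w) (ℕₚ.+-comm ∣ S ∪ T ∣ i)))
               (≡.sym (ℕₚ.+-assoc (n ∸ w) i ∣ S ∪ T ∣)))

    -- Summing over E first leaves a function of |S ∩ T|. Reading C(|S ∩ T|,j) as the number of
    -- j-sets R ⊆ S ∩ T uncouples S from T: for fixed R they range independently over the ℓ-sets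
    -- between R and A, and between R and B.
    gram-common : ∀ {k} e ℓ (A B : Subset n) → ℓ ℕ.+ ℓ ℕ.≤ n → ∣ A ∣ ≡ k → ∣ B ∣ ≡ k →
      ∑ₛ n e (λ E → common ℓ E A * common ℓ E B) ≈
      ∑< (suc ℓ) (λ j → ⟦ shiftedC (n ∸ (ℓ ℕ.+ ℓ)) e ((ℓ ℕ.+ ℓ) ∸ j) ⟧ *
        (⟦ shiftedC (k ∸ j) ℓ j ⟧ * ⟦ shiftedC (k ∸ j) ℓ j ⟧) * ⟦ ∣ A ∩ B ∣ C j ⟧)
    gram-common {k} e ℓ A B 2ℓ≤n ∣A∣≡k ∣B∣≡k = begin-equality
      ∑ₛ n e (λ E → common ℓ E A * common ℓ E B)
        ≈⟨ ∑ₛ≈ n e (λ E → ∑ₛ-product n ℓ ℓ _ _) ⟩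
      ∑ₛ n e (λ E → ∑ₛ n ℓ (λ S → ∑ₛ n ℓ (λ T → ([ S ⊆ E ] * [ S ⊆ A ]) * ([ T ⊆ E ] * [ T ⊆ B ]))))
        ≈⟨ ∑ₛ-swap (∑ₛ-additive n e) n ℓ _ ⟩
      ∑ₛ n ℓ (λ S → ∑ₛ n e (λ E → ∑ₛ n ℓ (λ T → ([ S ⊆ E ] * [ S ⊆ A ]) * ([ T ⊆ E ] * [ T ⊆ B ]))))
        ≈⟨ ∑ₛ≈ n ℓ (λ S → ∑ₛ-swap (∑ₛ-additive n e) n ℓ _) ⟩
      ∑ₛ n ℓ (λ S → ∑ₛ n ℓ (λ T → ∑ₛ n e (λ E → ([ S ⊆ E ] * [ S ⊆ A ]) * ([ T ⊆ E ] * [ T ⊆ B ]))))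
        ≈⟨ ∑ₛ-cong n ℓ (λ S ∣S∣ → ∑ₛ-cong n ℓ (λ T ∣T∣ → trans
             (∑ₛ≈ n e (λ E → solve 4 (λ a b c d → (a :* b) :* (c :* d) := (b :* d) :* (a :* c)) refl _ _ _ _))
             (trans (∑ₛ-*ˡ n e _ _) (trans (*-congˡ (∑ₛ-⊇² e ℓ S T 2ℓ≤n ∣S∣ ∣T∣))
             (sym (∑<-*ˡ (suc ℓ) _ _)))))) ⟩
      ∑ₛ n ℓ (λ S → ∑ₛ n ℓ (λ T → ∑< (suc ℓ) (λ j → ([ S ⊆ A ] * [ T ⊆ B ]) * (⟦ ∣ S ∩ T ∣ C j ⟧ * d j))))
        ≈⟨ ∑ₛ≈ n ℓ (λ S → ∑<-swap (∑ₛ-additive n ℓ) (suc ℓ) _) ⟩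
      ∑ₛ n ℓ (λ S → ∑< (suc ℓ) (λ j → ∑ₛ n ℓ (λ T → ([ S ⊆ A ] * [ T ⊆ B ]) * (⟦ ∣ S ∩ T ∣ C j ⟧ * d j))))
        ≈⟨ ∑<-swap (∑ₛ-additive n ℓ) (suc ℓ) _ ⟩
      ∑< (suc ℓ) (λ j → ∑ₛ n ℓ (λ S → ∑ₛ n ℓ (λ T → ([ S ⊆ A ] * [ T ⊆ B ]) * (⟦ ∣ S ∩ T ∣ C j ⟧ * d j))))
        ≈⟨ ∑<-cong (suc ℓ) (λ j _ → level j) ⟩
      ∑< (suc ℓ) (λ j → d j * (c j * c j) * ⟦ ∣ A ∩ B ∣ C j ⟧) ∎
      where
      open <R
      d c : ℕ → Carrier
      d j = ⟦ shiftedC (n ∸ (ℓ ℕ.+ ℓ)) e ((ℓ ℕ.+ ℓ) ∸ j) ⟧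
      c j = ⟦ shiftedC (k ∸ j) ℓ j ⟧
      pairs : ∀ j → ∑ₛ n ℓ (λ S → ∑ₛ n ℓ (λ T → ([ S ⊆ A ] * [ T ⊆ B ]) * common j S T)) ≈
                    (c j * c j) * ⟦ ∣ A ∩ B ∣ C j ⟧
      pairs j = begin-equality
        ∑ₛ n ℓ (λ S → ∑ₛ n ℓ (λ T → ([ S ⊆ A ] * [ T ⊆ B ]) * common j S T))
          ≈⟨ ∑ₛ≈ n ℓ (λ S → ∑ₛ≈ n ℓ (λ T → trans (sym (∑ₛ-*ˡ n j _ _))
               (∑ₛ≈ n j (λ R → solve 4 (λ a b c d → (a :* b) :* (c :* d) := (c :* a) :* (d :* b)) refl _ _ _ _)))) ⟩
        ∑ₛ n ℓ (λ S → ∑ₛ n ℓ (λ T → ∑ₛ n j (λ R → ([ R ⊆ S ] * [ S ⊆ A ]) * ([ R ⊆ T ] * [ T ⊆ B ]))))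
          ≈⟨ ∑ₛ≈ n ℓ (λ S → ∑ₛ-swap (∑ₛ-additive n ℓ) n j _) ⟩
        ∑ₛ n ℓ (λ S → ∑ₛ n j (λ R → ∑ₛ n ℓ (λ T → ([ R ⊆ S ] * [ S ⊆ A ]) * ([ R ⊆ T ] * [ T ⊆ B ]))))
          ≈⟨ ∑ₛ-swap (∑ₛ-additive n ℓ) n j _ ⟩
        ∑ₛ n j (λ R → ∑ₛ n ℓ (λ S → ∑ₛ n ℓ (λ T → ([ R ⊆ S ] * [ S ⊆ A ]) * ([ R ⊆ T ] * [ T ⊆ B ]))))
          ≈⟨ ∑ₛ≈ n j (λ R → ∑ₛ-product n ℓ ℓ _ _) ⟨
        ∑ₛ n j (λ R → ∑ₛ n ℓ (λ S → [ R ⊆ S ] * [ S ⊆ A ]) * ∑ₛ n ℓ (λ T → [ R ⊆ T ] * [ T ⊆ B ]))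
          ≈⟨ ∑ₛ-cong n j (λ R ∣R∣ → *-cong (between R A ∣A∣≡k ∣R∣) (between R B ∣B∣≡k ∣R∣)) ⟩
        ∑ₛ n j (λ R → ([ R ⊆ A ] * c j) * ([ R ⊆ B ] * c j))
          ≈⟨ ∑ₛ≈ n j (λ R → solve 3 (λ a b c → (a :* c) :* (b :* c) := (c :* c) :* (a :* b)) refl _ _ _) ⟩
        ∑ₛ n j (λ R → (c j * c j) * ([ R ⊆ A ] * [ R ⊆ B ]))
          ≈⟨ ∑ₛ-*ˡ n j _ _ ⟩
        (c j * c j) * common j A B
          ≈⟨ *-congˡ (common≈ j A B) ⟩
        (c j * c j) * ⟦ ∣ A ∩ B ∣ C j ⟧ ∎
        where
        between : ∀ R A → ∣ A ∣ ≡ k → ∣ R ∣ ≡ j →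
          ∑ₛ n ℓ (λ S → [ R ⊆ S ] * [ S ⊆ A ]) ≈ [ R ⊆ A ] * c j
        between R A ∣A∣ ∣R∣ = trans (∑ₛ-between n ℓ R A) (*-congˡ (reflexive
          (≡.cong₂ (λ a r → ⟦ shiftedC (a ∸ r) ℓ r ⟧) ∣A∣ ∣R∣)))
      level : ∀ j → ∑ₛ n ℓ (λ S → ∑ₛ n ℓ (λ T → ([ S ⊆ A ] * [ T ⊆ B ]) * (⟦ ∣ S ∩ T ∣ C j ⟧ * d j))) ≈
                    d j * (c j * c j) * ⟦ ∣ A ∩ B ∣ C j ⟧
      level j = begin-equality
        ∑ₛ n ℓ (λ S → ∑ₛ n ℓ (λ T → ([ S ⊆ A ] * [ T ⊆ B ]) * (⟦ ∣ S ∩ T ∣ C j ⟧ * d j)))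
          ≈⟨ ∑ₛ≈ n ℓ (λ S → trans (∑ₛ≈ n ℓ (λ T → trans
               (*-congˡ (*-congʳ (sym (common≈ j S T))))
               (solve 3 (λ a b c → a :* (b :* c) := c :* (a :* b)) refl _ _ _)))
               (∑ₛ-*ˡ n ℓ _ _)) ⟩
        ∑ₛ n ℓ (λ S → d j * ∑ₛ n ℓ (λ T → ([ S ⊆ A ] * [ T ⊆ B ]) * common j S T))
          ≈⟨ ∑ₛ-*ˡ n ℓ _ _ ⟩
        d j * ∑ₛ n ℓ (λ S → ∑ₛ n ℓ (λ T → ([ S ⊆ A ] * [ T ⊆ B ]) * common j S T))
          ≈⟨ *-congˡ (pairs j) ⟩
        d j * ((c j * c j) * ⟦ ∣ A ∩ B ∣ C j ⟧)
          ≈⟨ *-assoc _ _ _ ⟨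
        d j * (c j * c j) * ⟦ ∣ A ∩ B ∣ C j ⟧ ∎

  -- The positive semidefinite order

  β : ℕ → ℕ → Carrier
  β i x = ⟦ x C i ⟧

  -- The intersection sizes at which functions are compared. χ selects L for the upper bound and its
  -- complement for the lower bound; the diagonal value k always belongs.
  Support : ℕ → (ℕ → Bool) → ℕ → Set
  Support k χ x = (x ℕ.< k × χ x ≡ true) ⊎ x ≡ k

  module Pairing {k : ℕ} (L : List ℕ) {n : ℕ} (k≤n : k ℕ.≤ n) where

    G : Graph
    G = johnson n k L k≤n

    open Attained G using (∑-cong; ∑-+; ∑-*ˡ; ∑-*ʳ; from) public

    V : Set
    V = KSubset n k

    ∑ⱽ : (V → Carrier) → Carrier
    ∑ⱽ = ∑ᵥ G

    ∑ⱽ-additive : Additive ∑ⱽ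
    ∑ⱽ-additive = record
      { cong   = ∑-cong
      ; +-homo = ∑-+
      ; 0-homo = Additive.0-homo (sum-additive {Graph.order G})
      }

    ⟨_,_⟩ : (V → V → Carrier) → (ℕ → Carrier) → Carrier
    ⟨ B , f ⟩ = ∑ⱽ λ A → ∑ⱽ λ A′ → B A A′ * f ∣ proj₁ A ∩ proj₁ A′ ∣

    -- Positive semidefiniteness in dual form. Tested against a feasible matrix it gives the upper
    -- bound directly; tested against rank-one matrices it gives back the usual quadratic form.
    record Psd (f : ℕ → Carrier) : Set where
      constructor psd
      field nonneg : ∀ B → PositiveSemidefinite G B → 0# ≤ ⟨ B , f ⟩
    open Psd public

    ∑∑-cong : ∀ (f g : V → V → Carrier) → (∀ A A′ → f A A′ ≈ g A A′) →
      ∑ⱽ (λ A → ∑ⱽ (f A)) ≈ ∑ⱽ (λ A → ∑ⱽ (g A))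
    ∑∑-cong f g h = ∑-cong (λ A → ∑-cong (h A))

    ∑∑-+ : ∀ (f g : V → V → Carrier) → ∑ⱽ (λ A → ∑ⱽ (λ A′ → f A A′ + g A A′)) ≈
      ∑ⱽ (λ A → ∑ⱽ (f A)) + ∑ⱽ (λ A → ∑ⱽ (g A))
    ∑∑-+ f g = trans (∑-cong (λ A → ∑-+ (f A) (g A))) 
      (∑-+ (λ A → ∑ⱽ (f A)) (λ A → ∑ⱽ (g A)))

    ∑∑-*ˡ : ∀ c (f : V → V → Carrier) → ∑ⱽ (λ A → ∑ⱽ (λ A′ → c * f A A′)) ≈ c * ∑ⱽ (λ A → ∑ⱽ (f A))
    ∑∑-*ˡ c f = trans (∑-cong (λ A → ∑-*ˡ c (f A))) 
      (∑-*ˡ c (λ A → ∑ⱽ (f A)))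

    _∙_ : (V → V → Carrier) → (ℕ → Carrier) → V → V → Carrier
    (B ∙ f) A A′ = B A A′ * f ∣ proj₁ A ∩ proj₁ A′ ∣

    ⟨⟩-+ : ∀ B f g → ⟨ B , (λ x → f x + g x) ⟩ ≈ ⟨ B , f ⟩ + ⟨ B , g ⟩
    ⟨⟩-+ B f g = trans
      (∑∑-cong (B ∙ (λ x → f x + g x)) (λ A A′ → (B ∙ f) A A′ + (B ∙ g) A A′) (λ A A′ → distribˡ _ _ _))
      (∑∑-+ (B ∙ f) (B ∙ g))

    ⟨⟩-* : ∀ B c f → ⟨ B , (λ x → c * f x) ⟩ ≈ c * ⟨ B , f ⟩
    ⟨⟩-* B c f = trans
      (∑∑-cong (B ∙ (λ x → c * f x)) (λ A A′ → c * (B ∙ f) A A′)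
        (λ A A′ → solve 3 (λ a b c → a :* (b :* c) := b :* (a :* c)) refl (B A A′) c _))
      (∑∑-*ˡ c (B ∙ f))

    Psd-0 : Psd (λ _ → 0#)
    Psd-0 = psd λ B _ → ≤-reflexive (sym (trans
      (∑∑-cong (B ∙ (λ _ → 0#)) (λ _ _ → 0#) (λ A A′ → zeroʳ (B A A′)))
      (trans (∑-cong {λ _ → ∑ⱽ (λ _ → 0#)} {λ _ → 0#} (λ _ → Additive.0-homo ∑ⱽ-additive))
             (Additive.0-homo ∑ⱽ-additive))))

    Psd-+ : ∀ {f g} → Psd f → Psd g → Psd (λ x → f x + g x)
    Psd-+ {f} {g} p q = psd λ B h → ≤-resp refl (sym (⟨⟩-+ B f g)) (+-nonneg (nonneg p B h) (nonneg q B h))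

    Psd-* : ∀ {c f} → 0# ≤ c → Psd f → Psd (λ x → c * f x)
    Psd-* {c} {f} 0≤c p = psd λ B h → ≤-resp refl (sym (⟨⟩-* B c f)) (*-nonneg 0≤c (nonneg p B h))

    -- The pairing of B with a Gram matrix is the sum of the quadratic form of B over the vectors
    -- `y E`, so no factorisation of B is required.
    Psd-gram : ∀ {f} e (y : Subset n → V → Carrier) →
      (∀ A A′ → f ∣ proj₁ A ∩ proj₁ A′ ∣ ≈ ∑ₛ n e (λ E → y E A * y E A′)) → Psd f
    Psd-gram {f} e y h = psd λ B (_ , form≥0) → ≤-resp refl (sym (eq B))
      (∑ₛ-nonneg n e (λ E → ∑ⱽ λ A → ∑ⱽ λ A′ → y E A * B A A′ * y E A′) (λ E → form≥0 (y E)))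
      where
      open <R
      eq : ∀ B → ⟨ B , f ⟩ ≈ ∑ₛ n e (λ E → ∑ⱽ λ A → ∑ⱽ λ A′ → y E A * B A A′ * y E A′)
      eq B = begin-equality
        ⟨ B , f ⟩
          ≈⟨ ∑∑-cong (B ∙ f) (λ A A′ → ∑ₛ n e (λ E → y E A * B A A′ * y E A′))
               (λ A A′ → trans (*-congˡ (h A A′)) (trans (sym (∑ₛ-*ˡ n e _ _))
                 (∑ₛ≈ n e (λ E → solve 3 (λ a b c → a :* (b :* c) := b :* a :* c) refl
                   (B A A′) (y E A) (y E A′))))) ⟩
        (∑ⱽ λ A → ∑ⱽ λ A′ → ∑ₛ n e (λ E → y E A * B A A′ * y E A′))
          ≈⟨ ∑-cong {λ A → ∑ⱽ λ A′ → ∑ₛ n e (λ E → y E A * B A A′ * y E A′)}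
               {λ A → ∑ₛ n e (λ E → ∑ⱽ λ A′ → y E A * B A A′ * y E A′)}
               (λ A → ∑ₛ-swap ∑ⱽ-additive n e (λ E A′ → y E A * B A A′ * y E A′)) ⟩
        (∑ⱽ λ A → ∑ₛ n e (λ E → ∑ⱽ λ A′ → y E A * B A A′ * y E A′))
          ≈⟨ ∑ₛ-swap ∑ⱽ-additive n e (λ E A → ∑ⱽ λ A′ → y E A * B A A′ * y E A′) ⟩
        ∑ₛ n e (λ E → ∑ⱽ λ A → ∑ⱽ λ A′ → y E A * B A A′ * y E A′) ∎

    Psd-β : ∀ i → Psd (β i)
    Psd-β i = Psd-gram i (λ E A → [ E ⊆ proj₁ A ]) (λ A A′ → sym (trans
      (∑ₛ≈ n i (λ E → ⊆-∩ E (proj₁ A) (proj₁ A′))) (∑ₛ-⊆ n i _)))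

    -- The Gram matrix of the vectors A ↦ [E ⊆ A] + θ · #{S ⊆ E ∩ A : |S| = ℓ}, |E| = e.
    Psd-square : ∀ e ℓ θ → ℓ ℕ.+ ℓ ℕ.≤ n → Psd (λ x →
      β e x + (θ + θ) * (⟦ shiftedC (k ∸ ℓ) e ℓ ⟧ * β ℓ x) +
      (θ * θ) * ∑< (suc ℓ) (λ j → ⟦ shiftedC (n ∸ (ℓ ℕ.+ ℓ)) e ((ℓ ℕ.+ ℓ) ∸ j) ⟧ *
        (⟦ shiftedC (k ∸ j) ℓ j ⟧ * ⟦ shiftedC (k ∸ j) ℓ j ⟧) * β j x))
    Psd-square e ℓ θ 2ℓ≤n = Psd-gram e (λ E A → [ E ⊆ proj₁ A ] + θ * common ℓ E (proj₁ A)) entry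
      where
      open Gram {n}
      open <R
      entry : ∀ (A A′ : V) → _ ≈ ∑ₛ n e (λ E → _)
      entry (A , ∣A∣) (A′ , ∣A′∣) = sym (begin-equality
        ∑ₛ n e (λ E → ([ E ⊆ A ] + θ * common ℓ E A) * ([ E ⊆ A′ ] + θ * common ℓ E A′))
          ≈⟨ ∑ₛ≈ n e (λ E → solve 5 (λ a a′ z z′ θ → (a :+ θ :* z) :* (a′ :+ θ :* z′) :=
               a :* a′ :+ (θ :* (a :* z′) :+ (θ :* (a′ :* z) :+ (θ :* θ) :* (z :* z′))))
               refl [ E ⊆ A ] [ E ⊆ A′ ] (common ℓ E A) (common ℓ E A′) θ) ⟩
        ∑ₛ n e (λ E → [ E ⊆ A ] * [ E ⊆ A′ ] + (θ * ([ E ⊆ A ] * common ℓ E A′) +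
          (θ * ([ E ⊆ A′ ] * common ℓ E A) + (θ * θ) * (common ℓ E A * common ℓ E A′))))
          ≈⟨ trans (plus _ _) (+-congˡ (trans (plus _ _) (+-congˡ (plus _ _)))) ⟩
        ∑ₛ n e (λ E → [ E ⊆ A ] * [ E ⊆ A′ ]) + (∑ₛ n e (λ E → θ * ([ E ⊆ A ] * common ℓ E A′)) +
          (∑ₛ n e (λ E → θ * ([ E ⊆ A′ ] * common ℓ E A)) +
           ∑ₛ n e (λ E → (θ * θ) * (common ℓ E A * common ℓ E A′))))
          ≈⟨ +-cong (trans (∑ₛ≈ n e (λ E → ⊆-∩ E A A′)) (∑ₛ-⊆ n e _))
               (+-cong (trans (∑ₛ-*ˡ n e θ _) (*-congˡ (gram-⊆-common e ℓ A A′ ∣A∣)))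
               (+-cong (trans (∑ₛ-*ˡ n e θ _) (*-congˡ (trans (gram-⊆-common e ℓ A′ A ∣A′∣)
                          (*-congˡ (reflexive (≡.cong (λ D → β ℓ ∣ D ∣) (∩-comm A′ A)))))))
                       (trans (∑ₛ-*ˡ n e (θ * θ) _) (*-congˡ (gram-common e ℓ A A′ 2ℓ≤n ∣A∣ ∣A′∣))))) ⟩
        β e x + (θ * (N * β ℓ x) + (θ * (N * β ℓ x) + (θ * θ) * R))
          ≈⟨ solve 4 (λ a θ m r → a :+ (θ :* m :+ (θ :* m :+ (θ :* θ) :* r)) :=
               a :+ (θ :+ θ) :* m :+ (θ :* θ) :* r) refl (β e x) θ (N * β ℓ x) R ⟩
        β e x + (θ + θ) * (N * β ℓ x) + (θ * θ) * R ∎)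
        where
        x = ∣ A ∩ A′ ∣
        N = ⟦ shiftedC (k ∸ ℓ) e ℓ ⟧
        R = ∑< (suc ℓ) (λ j → ⟦ shiftedC (n ∸ (ℓ ℕ.+ ℓ)) e ((ℓ ℕ.+ ℓ) ∸ j) ⟧ *
              (⟦ shiftedC (k ∸ j) ℓ j ⟧ * ⟦ shiftedC (k ∸ j) ℓ j ⟧) * β j x)
        plus : ∀ f g → ∑ₛ n e (λ E → f E + g E) ≈ ∑ₛ n e f + ∑ₛ n e g
        plus = Additive.+-homo (∑ₛ-additive n e)

    module Order (χ : ℕ → Bool) where

      infix 4 _≼_
      record _≼_ (f g : ℕ → Carrier) : Set where
        constructor slack
        field
          gap     : ℕ → Carrier
          gap-psd : Psd gap
          f+gap≈g : ∀ x → Support k χ x → f x + gap x ≈ g x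

      ≼-reflexive : ∀ {f g} → (∀ x → Support k χ x → f x ≈ g x) → f ≼ g
      ≼-reflexive h = slack (λ _ → 0#) Psd-0 λ x s → trans (+-identityʳ _) (h x s)

      ≼-trans : ∀ {f g h} → f ≼ g → g ≼ h → f ≼ h
      ≼-trans (slack u p eq) (slack v q eq′) = slack (λ x → u x + v x) (Psd-+ p q) λ x s →
        trans (sym (+-assoc _ _ _)) (trans (+-congʳ (eq x s)) (eq′ x s))

      ≼-+ : ∀ {f f′ g g′} → f ≼ g → f′ ≼ g′ → (λ x → f x + f′ x) ≼ (λ x → g x + g′ x)
      ≼-+ (slack u p eq) (slack v q eq′) = slack (λ x → u x + v x) (Psd-+ p q) λ x s →
        trans (interchange _ _ _ _) (+-cong (eq x s) (eq′ x s))

      ≼-* : ∀ {c f g} → 0# ≤ c → f ≼ g → (λ x → c * f x) ≼ (λ x → c * g x)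
      ≼-* {c} 0≤c (slack u p eq) = slack (λ x → c * u x) (Psd-* 0≤c p) λ x s →
        trans (sym (distribˡ _ _ _)) (*-congˡ (eq x s))

      ≼-cancelʳ : ∀ {f g} (h : ℕ → Carrier) → (λ x → f x + h x) ≼ (λ x → g x + h x) → f ≼ g
      ≼-cancelʳ {f} {g} h (slack u p eq) = slack u p λ x s → +-cancelʳ (h x)
        (trans (solve 3 (λ a b c → (a :+ b) :+ c := (a :+ c) :+ b) refl (f x) (u x) (h x)) (eq x s))

      ≼-resp : ∀ {f f′ g g′} → (∀ x → f x ≈ f′ x) → (∀ x → g x ≈ g′ x) → f ≼ g → f′ ≼ g′
      ≼-resp h h′ (slack u p eq) = slack u p λ x s →
        trans (+-congʳ (sym (h x))) (trans (eq x s) (h′ x))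

      β-scale-mono : ∀ {a b} i → a ≤ b → (λ x → a * β i x) ≼ (λ x → b * β i x)
      β-scale-mono {a} {b} i h = slack (λ x → (b - a) * β i x) (Psd-* 0≤b-a (Psd-β i)) λ x _ →
        trans (sym (distribʳ _ _ _)) (*-congʳ (trans (+-comm _ _) (y-x+x≈y a b)))
        where
        0≤b-a : 0# ≤ b - a
        0≤b-a = ≤-resp (-‿inverseʳ a) refl (+-monoˡ-≤ (- a) h)

      ∑<-≼ : ∀ m {f g : ℕ → ℕ → Carrier} → (∀ j → j ℕ.< m → f j ≼ g j) →
        (λ x → ∑< m (λ j → f j x)) ≼ (λ x → ∑< m (λ j → g j x))
      ∑<-≼ zero    h = ≼-reflexive (λ _ _ → refl)
      ∑<-≼ (suc m) h = ≼-+ (∑<-≼ m (λ j p → h j (ℕₚ.m<n⇒m<1+n p))) (h m ℕₚ.≤-refl)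

  -- Asymptotic estimates

  -- The hypothesis k + k ≤ n keeps n ∸ 2ℓ from being truncated for ℓ ≤ k.
  module Asymptotics (k : ℕ) (0<k : 0 ℕ.< k) (L : List ℕ) (χ : ℕ → Bool) where

    k≤n : ∀ {n} → k ℕ.+ k ℕ.≤ n → k ℕ.≤ n
    k≤n h = ℕₚ.≤-trans (ℕₚ.m≤m+n k k) h

    0<n : ∀ {n} → k ℕ.+ k ℕ.≤ n → 0 ℕ.< n
    0<n h = ℕₚ.≤-trans 0<k (k≤n h)

    ν ι : ℕ → Carrier
    ν n = ⟦ n ⟧
    ι n = ⟦ n ⟧ ⁻¹

    module At {n : ℕ} (h : k ℕ.+ k ℕ.≤ n) where
      open Pairing L (k≤n h) public
      open Order χ public

      0<ν : 0# < ν n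
      0<ν = ⟦⟧-pos (0<n h)

      0<ι : 0# < ι n
      0<ι = ⁻¹-pos 0<ν

      1≤ν : 1# ≤ ν n
      1≤ν = ≤-resp ⟦1⟧ refl (⟦⟧-mono (0<n h))

      νι : ν n * ι n ≈ 1#
      νι = ⁻¹-inverseʳ (pos⇒≉0 0<ν)

      ν^ι^ : ∀ a → ν n ^ a * ι n ^ a ≈ 1#
      ν^ι^ zero    = *-identityˡ 1#
      ν^ι^ (suc a) = trans
        (solve 4 (λ x y z w → x :* y :* (z :* w) := x :* z :* (y :* w)) refl (ν n) (ν n ^ a) (ι n) (ι n ^ a))
        (trans (*-cong νι (ν^ι^ a)) (*-identityˡ 1#))

      0≤ν^ : ∀ a → 0# ≤ ν n ^ a
      0≤ν^ a = ^-nonneg (inj₁ 0<ν) a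

      0≤ι^ : ∀ a → 0# ≤ ι n ^ a
      0≤ι^ a = ^-nonneg (inj₁ 0<ι) a

      ν^-mono : ∀ {a b} → a ℕ.≤ b → ν n ^ a ≤ ν n ^ b
      ν^-mono {b = zero}  ℕ.z≤n     = ≤-refl
      ν^-mono {b = suc b} ℕ.z≤n     = ≤-trans (ν^-mono {0} {b} ℕ.z≤n)
        (≤-resp (*-identityˡ _) refl (*-monoʳ-≤ (0≤ν^ b) 1≤ν))
      ν^-mono             (ℕ.s≤s p) = *-monoˡ-≤ (inj₁ 0<ν) (ν^-mono p)

      move-ν : ∀ a {x y} → x * ν n ^ a ≤ y → x ≤ y * ι n ^ a
      move-ν a {x} {y} p = begin
        x                       ≈⟨ *-identityʳ x ⟨
        x * 1#                  ≈⟨ *-congˡ (ν^ι^ a) ⟨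
        x * (ν n ^ a * ι n ^ a) ≈⟨ *-assoc _ _ _ ⟨
        x * ν n ^ a * ι n ^ a   ≤⟨ *-monoʳ-≤ (0≤ι^ a) p ⟩
        y * ι n ^ a             ∎
        where open <R

      move-ι : ∀ a {x y} → x ≤ y * ν n ^ a → x * ι n ^ a ≤ y
      move-ι a {x} {y} p = begin
        x * ι n ^ a             ≤⟨ *-monoʳ-≤ (0≤ι^ a) p ⟩
        y * ν n ^ a * ι n ^ a   ≈⟨ *-assoc _ _ _ ⟩
        y * (ν n ^ a * ι n ^ a) ≈⟨ *-congˡ (ν^ι^ a) ⟩
        y * 1#                  ≈⟨ *-identityʳ y ⟩
        y                       ∎
        where open <R

      ι^ν^-≤ : ∀ a b c → suc b ℕ.≤ c ℕ.+ a → ι n ^ a * ν n ^ b ≤ ν n ^ c * ι n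
      ι^ν^-≤ a b c p = begin
        ι n ^ a * ν n ^ b ≈⟨ *-comm _ _ ⟩
        ν n ^ b * ι n ^ a ≤⟨ move-ι a (≤-trans (move-ν 1 le) (≤-reflexive swap)) ⟩
        ν n ^ c * ι n     ∎
        where
        open <R
        le : ν n ^ b * ν n ^ 1 ≤ ν n ^ c * ν n ^ a
        le = ≤-resp
          (trans (*-comm (ν n) _) (*-congˡ (sym (*-identityʳ _)))) (^-homo-* (ν n) c a) (ν^-mono p)
        swap : ν n ^ c * ν n ^ a * ι n ^ 1 ≈ ν n ^ c * ι n * ν n ^ a
        swap = trans (*-congˡ (*-identityʳ _))
          (solve 3 (λ x y z → x :* y :* z := x :* z :* y) refl (ν n ^ c) (ν n ^ a) (ι n))

      -- `Psd-square` with θ = -σ/n^m, multiplied by n^m. In the quadratic part the index j = ℓ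
      -- contributes n^(-m) C(n-2ℓ,m) ≤ 1/m!, and each j < ℓ at most n^(-(ℓ-j)). σ stays free
      -- because the crude and the sharp estimates choose it differently.
      square-≼ : ∀ ℓ m σ → ℓ ℕ.+ m ℕ.≤ k →
        (λ x → (σ + σ) * (⟦ (k ∸ ℓ) C m ⟧ * β ℓ x)) ≼
        (λ x → ν n ^ m * β (ℓ ℕ.+ m) x + (σ * σ) * (⟦ m ! ⟧ ⁻¹ * β ℓ x +
          ∑< ℓ (λ j → (⟦ shiftedC (k ∸ j) ℓ j ⟧ * ⟦ shiftedC (k ∸ j) ℓ j ⟧) * (ι n ^ (ℓ ∸ j) * β j x))))
      square-≼ ℓ m σ ℓ+m≤k = ≼-trans exact (≼-+ (≼-reflexive (λ _ _ → refl)) tail)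
        where
        open <R
        e = ℓ ℕ.+ m
        2ℓ = ℓ ℕ.+ ℓ
        ℓ≤k : ℓ ℕ.≤ k
        ℓ≤k = ℕₚ.≤-trans (ℕₚ.m≤m+n ℓ m) ℓ+m≤k
        2ℓ≤n : 2ℓ ℕ.≤ n
        2ℓ≤n = ℕₚ.≤-trans (ℕₚ.+-mono-≤ ℓ≤k ℓ≤k) h
        θ = - (σ * ι n ^ m)
        c D : ℕ → Carrier
        c j = ⟦ shiftedC (k ∸ j) ℓ j ⟧ * ⟦ shiftedC (k ∸ j) ℓ j ⟧
        D j = ⟦ shiftedC (n ∸ 2ℓ) e (2ℓ ∸ j) ⟧
        νθ : ν n ^ m * θ + σ ≈ 0#
        νθ = begin-equality
          ν n ^ m * - (σ * ι n ^ m) + σ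
            ≈⟨ +-congʳ (trans (sym (-‿distribʳ-* _ _)) (-‿cong (trans
                 (solve 3 (λ a b c → a :* (b :* c) := b :* (a :* c)) refl _ _ _)
                 (trans (*-congˡ (ν^ι^ m)) (*-identityʳ σ))))) ⟩
          - σ + σ ≈⟨ -‿inverseˡ σ ⟩
          0#      ∎
        θ² : θ * θ ≈ (σ * σ) * (ι n ^ m * ι n ^ m)
        θ² = trans (neg*neg _ _)
          (solve 2 (λ a b → a :* b :* (a :* b) := a :* a :* (b :* b)) refl σ (ι n ^ m))
        R : ℕ → Carrier
        R x = ∑< (suc ℓ) (λ j → D j * c j * β j x)
        exact : (λ x → (σ + σ) * (⟦ (k ∸ ℓ) C m ⟧ * β ℓ x)) ≼
                (λ x → ν n ^ m * β e x + (σ * σ) * (ι n ^ m * R x))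
        exact = slack _ (Psd-* (0≤ν^ m) (Psd-square e ℓ θ 2ℓ≤n)) λ x _ → begin-equality
          (σ + σ) * (⟦ (k ∸ ℓ) C m ⟧ * β ℓ x) +
            ν n ^ m * (β e x + (θ + θ) * (⟦ shiftedC (k ∸ ℓ) e ℓ ⟧ * β ℓ x) + (θ * θ) * R x)
            ≡⟨ ≡.cong (λ N → (σ + σ) * (⟦ (k ∸ ℓ) C m ⟧ * β ℓ x) +
                 ν n ^ m * (β e x + (θ + θ) * (⟦ N ⟧ * β ℓ x) + (θ * θ) * R x)) (shiftedC-+ (k ∸ ℓ) m ℓ) ⟩
          (σ + σ) * (⟦ (k ∸ ℓ) C m ⟧ * β ℓ x) +
            ν n ^ m * (β e x + (θ + θ) * (⟦ (k ∸ ℓ) C m ⟧ * β ℓ x) + (θ * θ) * R x)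
            ≈⟨ solve 7 (λ s N v b t tt r → (s :+ s) :* N :+ v :* (b :+ (t :+ t) :* N :+ tt :* r) :=
                 v :* b :+ (v :* t :+ s) :* (N :+ N) :+ v :* tt :* r) refl
                 σ (⟦ (k ∸ ℓ) C m ⟧ * β ℓ x) (ν n ^ m) (β e x) θ (θ * θ) (R x) ⟩
          ν n ^ m * β e x + (ν n ^ m * θ + σ) * _ + ν n ^ m * (θ * θ) * R x
            ≈⟨ +-cong (trans (+-congˡ (trans (*-congʳ νθ) (zeroˡ _))) (+-identityʳ _))
                 (trans (*-congʳ (*-congˡ θ²))
                   (solve 4 (λ v s i r → v :* (s :* (i :* i)) :* r := (v :* i) :* (s :* (i :* r)))
                     refl (ν n ^ m) (σ * σ) (ι n ^ m) (R x))) ⟩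
          ν n ^ m * β e x + (ν n ^ m * ι n ^ m) * ((σ * σ) * (ι n ^ m * R x))
            ≈⟨ +-congˡ (trans (*-congʳ (ν^ι^ m)) (*-identityˡ _)) ⟩
          ν n ^ m * β e x + (σ * σ) * (ι n ^ m * R x) ∎
        D-ℓ : ι n ^ m * D ℓ ≤ ⟦ m ! ⟧ ⁻¹
        D-ℓ = begin
          ι n ^ m * D ℓ
            ≡⟨ ≡.cong (λ z → ι n ^ m * ⟦ z ⟧) (≡.trans
                 (≡.cong (shiftedC (n ∸ 2ℓ) e) (ℕₚ.m+n∸n≡m ℓ ℓ)) (shiftedC-+ (n ∸ 2ℓ) m ℓ)) ⟩
          ι n ^ m * ⟦ (n ∸ 2ℓ) C m ⟧
            ≈⟨ *-comm _ _ ⟩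
          ⟦ (n ∸ 2ℓ) C m ⟧ * ι n ^ m
            ≤⟨ move-ι m (*-cancelˡ-≤ 0<m! (begin
                 ⟦ m ! ⟧ * ⟦ (n ∸ 2ℓ) C m ⟧   ≈⟨ trans (*-comm _ _) (sym (⟦⟧-* ((n ∸ 2ℓ) C m) (m !))) ⟩
                 ⟦ ((n ∸ 2ℓ) C m) ℕ.* m ! ⟧   ≤⟨ ⟦⟧-mono (ℕₚ.≤-trans (C*!≤^ (n ∸ 2ℓ) m)
                                                  (ℕₚ.^-monoˡ-≤ m (ℕₚ.m∸n≤m n 2ℓ))) ⟩
                 ⟦ n ℕ.^ m ⟧                   ≈⟨ ⟦⟧-^ n m ⟩
                 ν n ^ m                       ≈⟨ *-identityˡ _ ⟨
                 1# * ν n ^ m                  ≈⟨ *-congʳ (⁻¹-inverseʳ (pos⇒≉0 0<m!)) ⟨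
                 ⟦ m ! ⟧ * ⟦ m ! ⟧ ⁻¹ * ν n ^ m ≈⟨ *-assoc _ _ _ ⟩
                 ⟦ m ! ⟧ * (⟦ m ! ⟧ ⁻¹ * ν n ^ m) ∎)) ⟩
          ⟦ m ! ⟧ ⁻¹ ∎
          where
          0<m! : 0# < ⟦ m ! ⟧
          0<m! = ⟦⟧-pos (ℕₚ.1≤n! m)
        -- `D j` is C(n-2ℓ, m-(ℓ-j)), hence at most n^(m-(ℓ-j)), and 0 if m < ℓ-j.
        D-j : ∀ j → j ℕ.< ℓ → ι n ^ m * D j ≤ ι n ^ (ℓ ∸ j)
        D-j j j<ℓ = begin
          ι n ^ m * D j
            ≈⟨ *-comm _ _ ⟩
          D j * ι n ^ m
            ≤⟨ move-ι m (begin
                 D j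
                   ≤⟨ move-ν (2ℓ ∸ j) (begin
                        D j * ν n ^ (2ℓ ∸ j)
                          ≈⟨ trans (⟦⟧-* (shiftedC (n ∸ 2ℓ) e (2ℓ ∸ j)) (n ℕ.^ (2ℓ ∸ j)))
                               (*-congˡ (⟦⟧-^ n (2ℓ ∸ j))) ⟨
                        ⟦ shiftedC (n ∸ 2ℓ) e (2ℓ ∸ j) ℕ.* n ℕ.^ (2ℓ ∸ j) ⟧
                          ≤⟨ ⟦⟧-mono (shiftedC-bound (ℕₚ.m∸n≤m n 2ℓ) e (2ℓ ∸ j)) ⟩
                        ⟦ n ℕ.^ e ⟧
                          ≈⟨ ⟦⟧-^ n e ⟩
                        ν n ^ e ∎) ⟩
                 ν n ^ e * ι n ^ (2ℓ ∸ j)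
                   ≈⟨ *-cong (^-homo-* (ν n) ℓ m)
                        (reflexive (≡.cong (ι n ^_) (ℕₚ.+-∸-assoc ℓ (ℕₚ.<⇒≤ j<ℓ)))) ⟩
                 ν n ^ ℓ * ν n ^ m * ι n ^ (ℓ ℕ.+ (ℓ ∸ j)) ≈⟨ *-congˡ (^-homo-* (ι n) ℓ (ℓ ∸ j)) ⟩
                 ν n ^ ℓ * ν n ^ m * (ι n ^ ℓ * ι n ^ (ℓ ∸ j))
                   ≈⟨ solve 4 (λ a b c d → a :* b :* (c :* d) := (a :* c) :* (d :* b)) refl _ _ _ _ ⟩
                 ν n ^ ℓ * ι n ^ ℓ * (ι n ^ (ℓ ∸ j) * ν n ^ m) ≈⟨ trans (*-congʳ (ν^ι^ ℓ)) (*-identityˡ _) ⟩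
                 ι n ^ (ℓ ∸ j) * ν n ^ m                ∎) ⟩
          ι n ^ (ℓ ∸ j) ∎
        0≤c : ∀ j → 0# ≤ c j
        0≤c j = *-nonneg (⟦⟧-nonneg (shiftedC (k ∸ j) ℓ j)) (⟦⟧-nonneg (shiftedC (k ∸ j) ℓ j))
        c-ℓ : c ℓ ≈ 1#
        c-ℓ = trans (*-cong one one) (*-identityˡ 1#)
          where
          one : ⟦ shiftedC (k ∸ ℓ) ℓ ℓ ⟧ ≈ 1#
          one = trans (reflexive (≡.cong ⟦_⟧ (≡.trans
            (≡.cong (λ z → shiftedC (k ∸ ℓ) z ℓ) (≡.sym (ℕₚ.+-identityʳ ℓ))) (shiftedC-+ (k ∸ ℓ) 0 ℓ)))) ⟦1⟧
        tail : (λ x → (σ * σ) * (ι n ^ m * R x)) ≼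
          (λ x → (σ * σ) * (⟦ m ! ⟧ ⁻¹ * β ℓ x + ∑< ℓ (λ j → c j * (ι n ^ (ℓ ∸ j) * β j x))))
        tail = ≼-* (0≤x*x σ) (≼-resp
          (λ x → sym (trans (distribˡ _ _ _) (+-cong (sym (∑<-*ˡ ℓ _ _))
            (trans (*-congˡ (trans (*-congʳ (trans (*-congˡ c-ℓ) (*-identityʳ _))) refl)) (sym (*-assoc _ _ _))))))
          (λ x → +-comm _ _)
          (≼-+ (∑<-≼ ℓ λ j j<ℓ → ≼-resp
                  (λ x → solve 4 (λ i d c b → c :* (i :* d :* b) := i :* (d :* c :* b)) refl (ι n ^ m) (D j) (c j) (β j x))
                  (λ x → refl)
                  (≼-* (0≤c j) (β-scale-mono j (D-j j j<ℓ))))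
               (β-scale-mono ℓ D-ℓ)))

  -- Crude growth bounds with unspecified constants

  module Calculus (k : ℕ) (0<k : 0 ℕ.< k) (L : List ℕ) (χ : ℕ → Bool) where
    open Asymptotics k 0<k L χ public

    -- On the support `β k` is the indicator of x = k, so a bound by a multiple of it is a
    -- certificate of the final kind, for `f n` in place of 1. The constant does not depend on n.
    record O (f : ℕ → ℕ → Carrier) (g : ℕ → Carrier) : Set where
      constructor big
      field
        const    : Carrier
        0≤const  : 0# ≤ const
        bounded  : ∀ {n} (h : k ℕ.+ k ℕ.≤ n) → At._≼_ h (f n) (λ x → (const * g n) * β k x)

    O-≼ : ∀ {f f′ g} → (∀ {n} (h : k ℕ.+ k ℕ.≤ n) → At._≼_ h (f n) (f′ n)) → O f′ g → O f g
    O-≼ p (big a 0≤a b) = big a 0≤a λ h → At.≼-trans h (p h) (b h)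

    O-0 : ∀ {g} → O (λ _ _ → 0#) g
    O-0 = big 0# ≤-refl λ h → At.≼-reflexive h λ x _ → sym (trans (*-congʳ (zeroˡ _)) (zeroˡ _))

    O-+ : ∀ {f f′ g} → O f g → O f′ g → O (λ n x → f n x + f′ n x) g
    O-+ (big a p b) (big a′ p′ b′) = big (a + a′) (+-nonneg p p′) λ h →
      At.≼-resp h (λ _ → refl)
        (λ x → solve 4 (λ p q c d → p :* c :* d :+ q :* c :* d := (p :+ q) :* c :* d) refl a a′ _ (β k x))
        (At.≼-+ h (b h) (b′ h))

    O-mono : ∀ {f g g′} → (∀ {n} → k ℕ.+ k ℕ.≤ n → g n ≤ g′ n) → O f g → O f g′
    O-mono p (big a 0≤a b) = big a 0≤a λ h →
      At.≼-trans h (b h) (At.β-scale-mono h k (*-monoˡ-≤ 0≤a (p h)))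

    O-scale : ∀ {f g} (w : ℕ → Carrier) → (∀ {n} → k ℕ.+ k ℕ.≤ n → 0# ≤ w n) → O f g →
      O (λ n x → w n * f n x) (λ n → w n * g n)
    O-scale w p (big a 0≤a b) = big a 0≤a λ h → At.≼-resp h (λ _ → refl)
      (λ x → solve 4 (λ w c g b → w :* (c :* g :* b) := c :* (w :* g) :* b) refl (w _) a _ (β k x))
      (At.≼-* h (p h) (b h))

    O-* : ∀ {f g c} → 0# ≤ c → O f g → O (λ n x → c * f n x) g
    O-* {c = c} p (big a 0≤a b) = big (c * a) (*-nonneg p 0≤a) λ h → At.≼-resp h (λ _ → refl)
      (λ x → solve 4 (λ w c g b → w :* (c :* g :* b) := w :* c :* g :* b) refl c a _ (β k x))
      (At.≼-* h p (b h))

    O-∑ : ∀ m {f : ℕ → ℕ → ℕ → Carrier} {g} → (∀ j → j ℕ.< m → O (f j) g) →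
      O (λ n x → ∑< m (λ j → f j n x)) g
    O-∑ zero    p = O-0
    O-∑ (suc m) p = O-+ (O-∑ m (λ j j<m → p j (ℕₚ.m<n⇒m<1+n j<m))) (p m ℕₚ.≤-refl)

    coeff : ℕ → ℕ → Carrier
    coeff i j = ⟦ shiftedC (k ∸ j) i j ⟧ * ⟦ shiftedC (k ∸ j) i j ⟧

    0≤coeff : ∀ i j → 0# ≤ coeff i j
    0≤coeff i j = *-nonneg (⟦⟧-nonneg (shiftedC (k ∸ j) i j)) (⟦⟧-nonneg (shiftedC (k ∸ j) i j))

    -- Passing from `β j` up to `β i` costs at most one factor n per level. All j ≤ i are carried
    -- together because the square at level i produces every lower `β j`.
    record Descent (i : ℕ) : Set where
      constructor descent
      field
        const   : Carrier
        0≤const : 0# ≤ const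
        bounded : ∀ {n} (h : k ℕ.+ k ℕ.≤ n) j → j ℕ.≤ i →
          At._≼_ h (λ x → ι n ^ (i ∸ j) * β j x) (λ x → const * β i x)

    module DescentStep {i : ℕ} (i<k : i ℕ.< k) (D : Descent i) where
      open Descent D renaming (const to E; 0≤const to 0≤E)
      open <R

      -- For this σ the σ²-terms of square-≼ absorb half of its left-hand side.
      ∑c Q N σ W : Carrier
      ∑c = ∑< i (coeff i)
      Q = ⟦ 1 ! ⟧ ⁻¹ + E * ∑c
      N = ⟦ (k ∸ i) C 1 ⟧
      σ = N * Q ⁻¹
      W = (σ * N) ⁻¹

      ∑-nonneg : ∀ m (f : ℕ → Carrier) → (∀ j → 0# ≤ f j) → 0# ≤ ∑< m f
      ∑-nonneg zero    f p = ≤-refl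
      ∑-nonneg (suc m) f p = +-nonneg (∑-nonneg m f p) (p m)

      0<Q : 0# < Q
      0<Q = <-≤-trans (⁻¹-pos (⟦⟧-pos {1} ℕₚ.≤-refl))
              (x≤x+y _ (*-nonneg 0≤E (∑-nonneg i (coeff i) (0≤coeff i))))

      0<N : 0# < N
      0<N = ⟦⟧-pos (≡.subst (0 ℕ.<_) (≡.sym (nC1≡n (k ∸ i))) (ℕₚ.m<n⇒0<n∸m i<k))

      0<σ : 0# < σ
      0<σ = *-pos 0<N (⁻¹-pos 0<Q)

      0<σN : 0# < σ * N
      0<σN = *-pos 0<σ 0<N

      σσQ : (σ * σ) * Q ≈ σ * N
      σσQ = begin-equality
        (N * Q ⁻¹ * (N * Q ⁻¹)) * Q
          ≈⟨ solve 3 (λ n q p → (n :* q :* (n :* q)) :* p := n :* q :* n :* (p :* q)) refl N (Q ⁻¹) Q ⟩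
        N * Q ⁻¹ * N * (Q * Q ⁻¹) ≈⟨ *-congˡ (⁻¹-inverseʳ (pos⇒≉0 0<Q)) ⟩
        N * Q ⁻¹ * N * 1#         ≈⟨ *-identityʳ _ ⟩
        σ * N                     ∎

      module _ {n : ℕ} (h : k ℕ.+ k ℕ.≤ n) where
        open At h

        lower : (λ x → ∑< i (λ j → coeff i j * (ι n ^ (i ∸ j) * β j x))) ≼ (λ x → (E * ∑c) * β i x)
        lower = ≼-resp (λ _ → refl)
          (λ x → trans (∑<-cong i (λ j _ → solve 3 (λ a b c → a :* (b :* c) := b :* c :* a) refl _ E _))
            (trans (∑<-*ˡ i (E * β i x) _) (solve 3 (λ a b c → a :* b :* c := a :* c :* b) refl E (β i x) ∑c)))
          (∑<-≼ i λ j j<i → ≼-* (0≤coeff i j) (bounded h j (ℕₚ.<⇒≤ j<i)))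

        doubled : (λ x → (σ * N) * β i x + (σ * N) * β i x) ≼
                  (λ x → ν n ^ 1 * β (i ℕ.+ 1) x + (σ * N) * β i x)
        doubled = ≼-resp
          (λ x → solve 3 (λ s n b → (s :+ s) :* (n :* b) := s :* n :* b :+ s :* n :* b) refl σ N (β i x))
          (λ x → +-congˡ (trans
            (solve 4 (λ s a b c → s :* (a :* c :+ b :* c) := s :* (a :+ b) :* c) refl
              (σ * σ) (⟦ 1 ! ⟧ ⁻¹) (E * ∑c) (β i x)) (*-congʳ σσQ)))
          (≼-trans (square-≼ i 1 σ (≡.subst (ℕ._≤ k) (ℕₚ.+-comm 1 i) i<k))
            (≼-+ (≼-reflexive λ _ _ → refl)
              (≼-* (0≤x*x σ) (≼-+ (≼-reflexive λ _ _ → refl) lower))))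

        step : (λ x → ι n * β i x) ≼ (λ x → W * β (suc i) x)
        step = ≼-resp
          (λ x → trans (solve 4 (λ w i s b → w :* i :* (s :* b) := s :* w :* (i :* b)) refl W (ι n) (σ * N) (β i x))
            (trans (*-congʳ (⁻¹-inverseʳ (pos⇒≉0 0<σN))) (*-identityˡ _)))
          (λ x → trans (*-congˡ (*-cong (*-identityʳ (ν n))
              (reflexive (≡.cong (λ z → β z x) (ℕₚ.+-comm i 1)))))
            (trans (solve 4 (λ w i v b → w :* i :* (v :* b) := v :* i :* (w :* b)) refl W (ι n) (ν n) (β (suc i) x))
              (trans (*-congʳ νι) (*-identityˡ _))))
          (≼-* (*-nonneg (inj₁ (⁻¹-pos 0<σN)) (inj₁ 0<ι)) (≼-cancelʳ (λ x → (σ * N) * β i x) doubled))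

    all-descent : ∀ i → i ℕ.≤ k → Descent i
    all-descent zero _ = descent 1# (inj₁ 0<1) λ { h zero ℕ.z≤n → At.≼-reflexive h λ _ _ → refl }
    -- E W serves the j ≤ i, which pass through level i; the added 1 serves j = i+1 itself.
    all-descent (suc i) i<k = descent (E * W + 1#) (+-nonneg 0≤EW (inj₁ 0<1)) bound
      where
      D = all-descent i (ℕₚ.<⇒≤ i<k)
      open Descent D renaming (const to E; 0≤const to 0≤E)
      open DescentStep i<k D using (W; step; 0<σN)
      0≤EW : 0# ≤ E * W
      0≤EW = *-nonneg 0≤E (inj₁ (⁻¹-pos 0<σN))
      bound : ∀ {n} (h : k ℕ.+ k ℕ.≤ n) j → j ℕ.≤ suc i →
          At._≼_ h (λ x → ι n ^ (suc i ∸ j) * β j x) (λ x → (E * W + 1#) * β (suc i) x)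
      bound {n} h j j≤ with ℕₚ.m≤n⇒m<n∨m≡n j≤
      ... | inj₂ ≡.refl = ≼-trans
        (≼-reflexive λ x _ → *-congʳ (reflexive (≡.cong (ι n ^_) (ℕₚ.n∸n≡0 (suc i)))))
        (β-scale-mono (suc i) (≤-resp refl (+-comm 1# _) (x≤x+y 1# 0≤EW)))
        where open At h
      ... | inj₁ (ℕ.s≤s j≤i) = ≼-trans
        (≼-resp
          (λ x → trans (sym (*-assoc _ _ _)) (*-congʳ (reflexive (≡.cong (ι n ^_) (≡.sym (ℕₚ.+-∸-assoc 1 j≤i))))))
          (λ x → solve 3 (λ a b c → a :* (b :* c) := b :* (a :* c)) refl (ι n) E (β i x))
          (≼-* (inj₁ 0<ι) (bounded h j j≤i)))
        (≼-trans (≼-resp (λ _ → refl) (λ x → sym (*-assoc _ _ _)) (≼-* 0≤E (step h)))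
          (β-scale-mono (suc i) (x≤x+y _ (inj₁ 0<1))))
        where open At h

  -- The leading constant

  tally : Bool → ℕ → ℕ
  tally true  = suc
  tally false = id

  extend : Bool → Bool → ℕ → ℕ
  extend true  true  m = suc m
  extend false false m = suc m
  extend _     _     m = 0

  count : (ℕ → Bool) → ℕ → ℕ → ℕ
  count χ i zero    = 0
  count χ i (suc d) = tally (χ i) (count χ (suc i) d)

  runLength : (ℕ → Bool) → Bool → ℕ → ℕ → ℕ
  runLength χ b i zero    = 0
  runLength χ b i (suc d) = extend b (χ i) (runLength χ b (suc i) d)

  -- Asymptotically, and up to the power of n, the factor gained at position i:
  -- telescoping over a run of length m starting at ℓ it becomes
  -- 1 / (m! (k−ℓ choose m)²), over a gap of length m it becomes (i + m choose i).
  factor : (ℕ → Bool) → Bool → ℕ → ℕ → Carrier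
  factor χ true  i d = ⟦ suc (runLength χ true (suc i) d) ⟧ * (⟦ suc d ⟧ ⁻¹ * ⟦ suc d ⟧ ⁻¹)
  factor χ false i d = ⟦ suc i ⟧ * ⟦ suc (runLength χ false (suc i) d) ⟧ ⁻¹

  κ : (ℕ → Bool) → ℕ → ℕ → Carrier
  κ χ i zero    = 1#
  κ χ i (suc d) = κ χ (suc i) d * factor χ (χ i) i d

  0<suc : ∀ m → 0# < ⟦ suc m ⟧
  0<suc m = ⟦⟧-pos {suc m} (ℕ.s≤s ℕ.z≤n)

  suc≉0 : ∀ m → ⟦ suc m ⟧ ≉ 0#
  suc≉0 m = pos⇒≉0 (0<suc m)

  factor-pos : ∀ χ b i d → 0# < factor χ b i d
  factor-pos χ true  i d = *-pos (0<suc (runLength χ true (suc i) d)) (*-pos (⁻¹-pos (0<suc d)) (⁻¹-pos (0<suc d)))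
  factor-pos χ false i d = *-pos (0<suc i) (⁻¹-pos (0<suc (runLength χ false (suc i) d)))

  κ-pos : ∀ χ i d → 0# < κ χ i d
  κ-pos χ i zero    = 0<1
  κ-pos χ i (suc d) = *-pos (κ-pos χ (suc i) d) (factor-pos χ (χ i) i d)

  count-suc : ∀ χ i d → count χ (suc i) d ℕ.≤ count χ i (suc d)
  count-suc χ i d with χ i
  ... | true  = ℕₚ.n≤1+n _
  ... | false = ℕₚ.≤-refl

  count-≤ : ∀ χ t j d → count χ j (t ℕ.+ d) ℕ.≤ t ℕ.+ count χ (j ℕ.+ t) d
  count-≤ χ zero    j d = ℕₚ.≤-reflexive (≡.cong (λ z → count χ z d) (≡.sym (ℕₚ.+-identityʳ j)))
  count-≤ χ (suc t) j d with χ j | count-≤ χ t (suc j) d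
  ... | true  | p rewrite ℕₚ.+-suc j t = ℕ.s≤s p
  ... | false | p rewrite ℕₚ.+-suc j t = ℕₚ.m≤n⇒m≤1+n p

  record Block (χ : ℕ → Bool) (b : Bool) (i d m : ℕ) : Set where
    field
      m≤d    : m ℕ.≤ d
      within : ∀ t → t ℕ.< m → χ (i ℕ.+ t) ≡ b
      end    : m ≡ d ⊎ χ (i ℕ.+ m) ≡ not b

  block-suc : ∀ {χ b i d m} → χ i ≡ b → Block χ b (suc i) d m → Block χ b i (suc d) (suc m)
  block-suc {χ} {b} {i} {d} {m} eq B = record { m≤d = ℕ.s≤s m≤d ; within = ins ; end = en end }
    where
    open Block B
    ins : ∀ t → t ℕ.< suc m → χ (i ℕ.+ t) ≡ b
    ins zero    _ = ≡.trans (≡.cong χ (ℕₚ.+-identityʳ i)) eq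
    ins (suc t) (ℕ.s≤s p) = ≡.trans (≡.cong χ (ℕₚ.+-suc i t)) (within t p)
    en : m ≡ d ⊎ χ (suc i ℕ.+ m) ≡ not b → suc m ≡ suc d ⊎ χ (i ℕ.+ suc m) ≡ not b
    en (inj₁ p) = inj₁ (≡.cong suc p)
    en (inj₂ p) = inj₂ (≡.trans (≡.cong χ (ℕₚ.+-suc i m)) p)

  block-end : ∀ {χ b i d} → χ i ≡ not b → Block χ b i d 0
  block-end {χ} {b} {i} eq = record
    { m≤d = ℕ.z≤n ; within = λ t () ; end = inj₂ (≡.trans (≡.cong χ (ℕₚ.+-identityʳ i)) eq) }

  block : ∀ χ b i d → Block χ b i d (runLength χ b i d)
  block χ b i zero = record { m≤d = ℕ.z≤n ; within = λ t () ; end = inj₁ ≡.refl }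
  block χ b i (suc d) with χ i in eq
  block χ true  i (suc d) | true  = block-suc eq (block χ true (suc i) d)
  block χ true  i (suc d) | false = block-end eq
  block χ false i (suc d) | true  = block-end eq
  block χ false i (suc d) | false = block-suc eq (block χ false (suc i) d)

  count-run : ∀ χ i d → let m = runLength χ true i d in
    count χ i d ≡ m ℕ.+ count χ (i ℕ.+ m) (d ∸ m)
  count-run χ i zero = ≡.refl
  count-run χ i (suc d) with χ i in eq
  ... | true  = ≡.cong suc (≡.trans (count-run χ (suc i) d)
    (≡.cong (λ z → m ℕ.+ count χ z (d ∸ m)) (≡.sym (ℕₚ.+-suc i m))))
    where m = runLength χ true (suc i) d
  ... | false rewrite ℕₚ.+-identityʳ i | eq = ≡.refl

  count-gap : ∀ χ i d → let m = runLength χ false i d in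
    count χ i d ≡ count χ (i ℕ.+ m) (d ∸ m)
  count-gap χ i zero = ≡.refl
  count-gap χ i (suc d) with χ i in eq
  ... | true  rewrite ℕₚ.+-identityʳ i | eq = ≡.refl
  ... | false = ≡.trans (count-gap χ (suc i) d)
    (≡.cong (λ z → count χ z (d ∸ m)) (≡.sym (ℕₚ.+-suc i m)))
    where m = runLength χ false (suc i) d

  C-refl : ∀ i → ⟦ (i ℕ.+ 0) C i ⟧ ≈ 1#
  C-refl i = trans (reflexive (≡.cong ⟦_⟧ (≡.trans (≡.cong (_C i) (ℕₚ.+-identityʳ i)) (nCn≡1 i)))) ⟦1⟧

  -- Each position contributes (i+1)/(m+1), with m the length of the gap after it; the identity
  -- (i+1) C(i+1+m,i+1) = (m+1) C(i+1+m,i) makes the product telescope.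
  κ-gap : ∀ χ i d → let m = runLength χ false i d in
    κ χ i d ≈ ⟦ (i ℕ.+ m) C i ⟧ * κ χ (i ℕ.+ m) (d ∸ m)
  κ-gap χ i zero = sym (trans (*-identityʳ _) (C-refl i))
  κ-gap χ i (suc d) with χ i in eq
  ... | true  = sym (trans (*-congʳ (C-refl i)) (trans (*-identityˡ _) (reflexive lemma)))
    where
    lemma : κ χ (i ℕ.+ 0) (suc d) ≡ κ χ (suc i) d * factor χ true i d
    lemma rewrite ℕₚ.+-identityʳ i | eq = ≡.refl
  ... | false = begin-equality
    κ χ (suc i) d * (⟦ suc i ⟧ * ⟦ suc m ⟧ ⁻¹)
      ≈⟨ *-congʳ (κ-gap χ (suc i) d) ⟩
    ⟦ (suc i ℕ.+ m) C suc i ⟧ * κ χ (suc i ℕ.+ m) (d ∸ m) * (⟦ suc i ⟧ * ⟦ suc m ⟧ ⁻¹)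
      ≡⟨ ≡.cong (λ z → ⟦ z C suc i ⟧ * κ χ z (d ∸ m) * (⟦ suc i ⟧ * ⟦ suc m ⟧ ⁻¹)) (≡.sym (ℕₚ.+-suc i m)) ⟩
    ⟦ (i ℕ.+ suc m) C suc i ⟧ * κ′ * (⟦ suc i ⟧ * ⟦ suc m ⟧ ⁻¹)
      ≈⟨ solve 4 (λ c k s r → c :* k :* (s :* r) := (s :* c) :* r :* k) refl _ κ′ ⟦ suc i ⟧ (⟦ suc m ⟧ ⁻¹) ⟩
    (⟦ suc i ⟧ * ⟦ (i ℕ.+ suc m) C suc i ⟧) * ⟦ suc m ⟧ ⁻¹ * κ′
      ≈⟨ *-congʳ (*-congʳ (trans (sym (⟦⟧-* (suc i) ((i ℕ.+ suc m) C suc i)))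
           (trans (reflexive (≡.cong ⟦_⟧ (absorption-+ i (suc m)))) (⟦⟧-* (suc m) ((i ℕ.+ suc m) C i))))) ⟩
    (⟦ suc m ⟧ * ⟦ (i ℕ.+ suc m) C i ⟧) * ⟦ suc m ⟧ ⁻¹ * κ′
      ≈⟨ *-congʳ (trans (solve 3 (λ a c r → a :* c :* r := (a :* r) :* c) refl ⟦ suc m ⟧ _ (⟦ suc m ⟧ ⁻¹))
           (trans (*-congʳ (⁻¹-inverseʳ (suc≉0 m))) (*-identityˡ _))) ⟩
    ⟦ (i ℕ.+ suc m) C i ⟧ * κ′ ∎
    where
    open <R
    m = runLength χ false (suc i) d
    κ′ = κ χ (i ℕ.+ suc m) (d ∸ m)

  -- By `absorption`, (m+1)/(d+1) times C(d+1,m+1) is C(d,m). Hence the factor (m+1)/(d+1)² of one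
  -- position turns C(d+1,m+1)² (m+1)! into C(d,m)² m!.
  κ-run : ∀ χ i d → let m = runLength χ true i d in
    κ χ i d * (⟦ d C m ⟧ * ⟦ d C m ⟧ * ⟦ m ! ⟧) ≈ κ χ (i ℕ.+ m) (d ∸ m)
  κ-run χ i zero = trans (*-congˡ (trans (*-cong (trans (*-cong ⟦1⟧ ⟦1⟧) (*-identityˡ _)) ⟦1⟧) (*-identityˡ _))) (*-identityˡ _)
  κ-run χ i (suc d) with χ i in eq
  ... | false = trans (*-congˡ (trans (*-cong (trans (*-cong ⟦1⟧ ⟦1⟧) (*-identityˡ _)) ⟦1⟧) (*-identityˡ _)))
                  (trans (*-identityʳ _) (reflexive lemma))
    where
    lemma : κ χ (suc i) d * factor χ false i d ≡ κ χ (i ℕ.+ 0) (suc d)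
    lemma rewrite ℕₚ.+-identityʳ i | eq = ≡.refl
  ... | true  = begin-equality
    κ χ (suc i) d * (M * (r * r)) * (X * X * ⟦ suc m ! ⟧)
      ≈⟨ *-congˡ (*-congˡ (⟦⟧-* (suc m) (m !))) ⟩
    κ χ (suc i) d * (M * (r * r)) * (X * X * (M * ⟦ m ! ⟧))
      ≈⟨ solve 5 (λ k M r X f → k :* (M :* (r :* r)) :* (X :* X :* (M :* f)) :=
           k :* ((r :* (M :* X)) :* (r :* (M :* X)) :* f)) refl (κ χ (suc i) d) M r X ⟦ m ! ⟧ ⟩
    κ χ (suc i) d * ((r * (M * X)) * (r * (M * X)) * ⟦ m ! ⟧)
      ≈⟨ *-congˡ (*-congʳ (*-cong rMX rMX)) ⟩
    κ χ (suc i) d * (⟦ d C m ⟧ * ⟦ d C m ⟧ * ⟦ m ! ⟧)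
      ≈⟨ κ-run χ (suc i) d ⟩
    κ χ (suc i ℕ.+ m) (d ∸ m)
      ≡⟨ ≡.cong (λ z → κ χ z (d ∸ m)) (≡.sym (ℕₚ.+-suc i m)) ⟩
    κ χ (i ℕ.+ suc m) (d ∸ m) ∎
    where
    open <R
    m = runLength χ true (suc i) d
    M = ⟦ suc m ⟧
    r = ⟦ suc d ⟧ ⁻¹
    X = ⟦ suc d C suc m ⟧
    rMX : r * (M * X) ≈ ⟦ d C m ⟧
    rMX = begin-equality
      r * (M * X)                    ≈⟨ *-congˡ (⟦⟧-* (suc m) (suc d C suc m)) ⟨
      r * ⟦ suc m ℕ.* (suc d C suc m) ⟧ ≡⟨ ≡.cong (λ z → r * ⟦ z ⟧) (absorption d m) ⟩
      r * ⟦ suc d ℕ.* (d C m) ⟧      ≈⟨ *-congˡ (⟦⟧-* (suc d) (d C m)) ⟩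
      r * (⟦ suc d ⟧ * ⟦ d C m ⟧)    ≈⟨ *-assoc _ _ _ ⟨
      r * ⟦ suc d ⟧ * ⟦ d C m ⟧      ≈⟨ *-congʳ (⁻¹-inverseˡ (suc≉0 d)) ⟩
      1# * ⟦ d C m ⟧                 ≈⟨ *-identityˡ _ ⟩
      ⟦ d C m ⟧                      ∎

  -- Asymptotically sharp estimates

  β-< : ∀ {i x} → x ℕ.< i → β i x ≈ 0#
  β-< x<i = reflexive (≡.cong ⟦_⟧ (k>n⇒nCk≡0 x<i))

  β-diag : ∀ i → β i i ≈ 1#
  β-diag i = trans (reflexive (≡.cong ⟦_⟧ (nCn≡1 i))) ⟦1⟧

  not-both : ∀ {b : Bool} → b ≡ true → b ≡ false → ∀ {A : Set} → A
  not-both ≡.refl ()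

  runLength-suc : ∀ χ b i d → χ i ≡ b → runLength χ b i (suc d) ≡ suc (runLength χ b (suc i) d)
  runLength-suc χ true  i d eq rewrite eq = ≡.refl
  runLength-suc χ false i d eq rewrite eq = ≡.refl

  module Growth (k : ℕ) (0<k : 0 ℕ.< k) (L : List ℕ) (χ : ℕ → Bool) where
    open Calculus k 0<k L χ public

    support-≤ : ∀ {x} → Support k χ x → x ℕ.≤ k
    support-≤ (inj₁ (x<k , _)) = ℕₚ.<⇒≤ x<k
    support-≤ (inj₂ x≡k)       = ℕₚ.≤-reflexive x≡k

    Order-β : ℕ → ℕ → Set
    Order-β i d = O (λ _ → β i) (λ n → ν n ^ count χ i d)

    Vanishes : (ℕ → Carrier) → ℕ → Set
    Vanishes h a = ∀ x → Support k χ x → x ℕ.≤ a → h x ≈ 0#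

    x-x≈0 : ∀ {x y} → x ≈ y → x - y ≈ 0#
    x-x≈0 {y = y} p = trans (+-congʳ p) (-‿inverseʳ y)

    -- Newton expansion: h is a combination of the β i with i > a on the support.
    order-above : ∀ d a → a ℕ.+ d ≡ k → (∀ i d′ → i ℕ.+ d′ ≡ k → d′ ℕ.< d → Order-β i d′) →
      ∀ h → Vanishes h a → O (λ _ → h) (λ n → ν n ^ count χ (suc a) (ℕ.pred d))
    order-above zero a a+0≡k ih h van = O-≼
      (λ H → At.≼-reflexive H λ x s → van x s (≡.subst (x ℕ.≤_) (≡.trans (≡.sym a+0≡k) (ℕₚ.+-identityʳ a)) (support-≤ s)))
      O-0
    order-above (suc d) a a+d≡k ih h van = O-≼ split
      (O-+ (O-* 0≤w (ih (suc a) d a+d≡k′ ℕₚ.≤-refl))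
           (O-mono mono (order-above d (suc a) a+d≡k′ (λ i d′ p q → ih i d′ p (ℕₚ.m<n⇒m<1+n q)) h′ van′)))
      where
      a+d≡k′ : suc a ℕ.+ d ≡ k
      a+d≡k′ = ≡.trans (≡.sym (ℕₚ.+-suc a d)) a+d≡k
      v w : Carrier
      v = h (suc a)
      -- The Newton coefficient v may be negative; raising it to some w ≥ 0 is allowed because
      -- `β (suc a)` is positive semidefinite.
      w = proj₁ (bound± v)
      0≤w : 0# ≤ w
      0≤w = proj₁ (proj₂ (bound± v))
      v≤w : v ≤ w
      v≤w = proj₁ (proj₂ (proj₂ (bound± v)))
      h′ : ℕ → Carrier
      h′ x = h x - v * β (suc a) x
      van′ : Vanishes h′ (suc a)
      van′ x s x≤ with ℕₚ.m≤n⇒m<n∨m≡n x≤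
      ... | inj₁ (ℕ.s≤s x≤a) = x-x≈0 (trans (van x s x≤a)
              (sym (trans (*-congˡ (β-< (ℕ.s≤s x≤a))) (zeroʳ v))))
      ... | inj₂ ≡.refl = x-x≈0 (sym (trans (*-congˡ (β-diag (suc a))) (*-identityʳ v)))
      mono : ∀ {n} → k ℕ.+ k ℕ.≤ n → ν n ^ count χ (suc (suc a)) (ℕ.pred d) ≤ ν n ^ count χ (suc a) d
      mono {n} H = At.ν^-mono H (le d)
        where
        le : ∀ d → count χ (suc (suc a)) (ℕ.pred d) ℕ.≤ count χ (suc a) d
        le zero    = ℕ.z≤n
        le (suc d) = count-suc χ (suc a) d
      split : ∀ {n} (H : k ℕ.+ k ℕ.≤ n) → At._≼_ H h (λ x → w * β (suc a) x + h′ x)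
      split H = ≼-trans
        (≼-reflexive λ x _ → sym (trans (+-comm _ _) (y-x+x≈y (v * β (suc a) x) (h x))))
        (≼-+ (β-scale-mono (suc a) v≤w) (≼-reflexive λ _ _ → refl))
        where open At H

    -- A selected position is crossed by one descent step, at the cost of a factor n. At an
    -- unselected i < k, `β i` vanishes on the support up to i and is a combination of higher `β`,
    -- at no cost. `f` is fuel: `order-above` calls back at several smaller d.
    order-β : ∀ f i d → i ℕ.+ d ≡ k → d ℕ.≤ f → Order-β i d
    order-β f i zero i+0≡k _ = big 1# (inj₁ 0<1) λ H → At.≼-reflexive H λ x _ →
      trans (reflexive (≡.cong (λ z → β z x) (≡.trans (≡.sym (ℕₚ.+-identityʳ i)) i+0≡k)))
        (sym (trans (*-congʳ (*-identityˡ _)) (*-identityˡ _)))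
    order-β (suc f) i (suc d) i+d≡k (ℕ.s≤s d≤f) with χ i in eq
    ... | true = O-≼ lift (O-scale ν (λ H → inj₁ (At.0<ν H))
                   (O-* 0≤E (order-β f (suc i) d (≡.trans (≡.sym (ℕₚ.+-suc i d)) i+d≡k) d≤f)))
      where
      i<k : i ℕ.< k
      i<k = ≡.subst (i ℕ.<_) i+d≡k (ℕₚ.m<m+n i (ℕ.s≤s ℕ.z≤n))
      open Descent (all-descent (suc i) i<k) renaming (const to E; 0≤const to 0≤E)
      lift : ∀ {n} (H : k ℕ.+ k ℕ.≤ n) → At._≼_ H (β i) (λ x → ν n * (E * β (suc i) x))
      lift {n} H = ≼-resp
        (λ x → trans (*-congˡ (*-congʳ (trans (reflexive (≡.cong (ι n ^_) (≡.trans (ℕₚ.+-∸-assoc 1 {i} ℕₚ.≤-refl)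
                   (≡.cong suc (ℕₚ.n∸n≡0 i))))) (*-identityʳ _))))
                 (trans (sym (*-assoc _ _ _)) (trans (*-congʳ νι) (*-identityˡ _))))
        (λ x → refl)
        (≼-* (inj₁ 0<ν) (bounded H i (ℕₚ.n≤1+n i)))
        where open At H
    ... | false = order-above (suc d) i i+d≡k
                    (λ i′ d′ p q → order-β f i′ d′ p (ℕₚ.≤-trans (ℕₚ.≤-pred q) d≤f)) (β i) van
      where
      i<k : i ℕ.< k
      i<k = ≡.subst (i ℕ.<_) i+d≡k (ℕₚ.m<m+n i (ℕ.s≤s ℕ.z≤n))
      van : Vanishes (β i) i
      van x s x≤i with ℕₚ.m≤n⇒m<n∨m≡n x≤i
      ... | inj₁ x<i = β-< x<i
      van x (inj₁ (_ , χx)) x≤i | inj₂ ≡.refl = not-both χx eq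
      van x (inj₂ x≡k)      x≤i | inj₂ ≡.refl = ⊥-elim (ℕₚ.<-irrefl x≡k i<k)

    -- The selected position a is counted in the exponent, but a function vanishing through a
    -- involves only the `β` above it; this saves the factor n. For d = 0 the function vanishes on
    -- the whole support.
    order-above′ : ∀ d a → a ℕ.+ d ≡ k → d ≡ 0 ⊎ χ a ≡ true → ∀ h → Vanishes h a →
      O (λ _ → h) (λ n → ν n ^ count χ a d * ι n)
    order-above′ zero a a+0≡k _ h van = O-≼
      (λ H → At.≼-reflexive H λ x s → van x s (≡.subst (x ℕ.≤_) (≡.trans (≡.sym a+0≡k) (ℕₚ.+-identityʳ a)) (support-≤ s)))
      O-0
    order-above′ (suc d) a a+d≡k (inj₂ eq) h van = O-mono
      (λ {n} H → ≤-reflexive (sym (trans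
        (*-congʳ (reflexive (≡.cong (λ b → ν n ^ tally b (count χ (suc a) d)) eq)))
        (trans (solve 3 (λ v c i → v :* c :* i := v :* i :* c) refl (ν n) _ (ι n))
          (trans (*-congʳ (At.νι H)) (*-identityˡ _))))))
      (order-above (suc d) a a+d≡k (λ i d′ p _ → order-β d′ i d′ p ℕₚ.≤-refl) h van)

    record Estimate (i d : ℕ) : Set where
      constructor estimate
      field
        const   : Carrier
        0≤const : 0# ≤ const
        bounded : ∀ {n} (H : k ℕ.+ k ℕ.≤ n) →
          At._≼_ H (β i) (λ x → (ν n ^ count χ i d * (κ χ i d + const * ι n)) * β k x)

    -- The places where a run may be entered. The unselected predecessor is what saves a power of n
    -- in `lag`.
    Start : ℕ → Set
    Start i = i ≡ 0 ⊎ ∃ λ p → i ≡ suc p × χ p ≡ false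

    module Step {i d m : ℕ} (i+d≡k : i ℕ.+ d ≡ k) (m≤d : m ℕ.≤ d) where

      end+rest : (i ℕ.+ m) ℕ.+ (d ∸ m) ≡ k
      end+rest = ≡.trans (ℕₚ.+-assoc i m (d ∸ m)) (≡.trans (≡.cong (i ℕ.+_) (ℕₚ.m+[n∸m]≡n m≤d)) i+d≡k)

      end≤k : i ℕ.+ m ℕ.≤ k
      end≤k = ≡.subst (i ℕ.+ m ℕ.≤_) end+rest (ℕₚ.m≤m+n (i ℕ.+ m) (d ∸ m))

    -- With e the end of the gap, β i - C(e,i) β e vanishes on the support through e: below i both
    -- terms are 0, inside the gap nothing is compared unless x = k, and the coefficient cancels the
    -- value at e. The remainder is therefore one power of n smaller.
    gap-estimate : ∀ i d → i ℕ.+ d ≡ k → let m = runLength χ false i d in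
      Estimate (i ℕ.+ m) (d ∸ m) → Estimate i d
    gap-estimate i d i+d≡k (estimate a 0≤a b) = estimate (c * a + A) (+-nonneg (*-nonneg 0≤c 0≤a) 0≤A) λ {n} H →
      At.≼-trans H
        (At.≼-reflexive H λ x _ → sym (trans (+-comm _ _) (y-x+x≈y (c * β e x) (β i x))))
        (At.≼-resp H (λ _ → refl) (λ x → final {n} x)
          (At.≼-+ H (At.≼-* H 0≤c (b H)) (h-bounded H)))
      where
      m = runLength χ false i d
      e = i ℕ.+ m
      open Block (block χ false i d)
      open Step {i} {d} {m} i+d≡k m≤d
      c : Carrier
      c = ⟦ e C i ⟧
      0≤c : 0# ≤ c
      0≤c = ⟦⟧-nonneg (e C i)
      h : ℕ → Carrier
      h x = β i x - c * β e x
      van : Vanishes h e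
      van x s x≤e with ℕₚ.m≤n⇒m<n∨m≡n x≤e
      ... | inj₂ ≡.refl = x-x≈0 (sym (trans (*-congˡ (β-diag e)) (*-identityʳ c)))
      ... | inj₁ x<e with ℕₚ.<-≤-connex x i
      ...   | inj₁ x<i = x-x≈0 (trans (β-< x<i) (sym (trans (*-congˡ (β-< x<e)) (zeroʳ c))))
      van x (inj₂ ≡.refl) x≤e | inj₁ x<e | inj₂ i≤x = ⊥-elim (ℕₚ.<-irrefl ≡.refl (ℕₚ.<-≤-trans x<e end≤k))
      van x (inj₁ (_ , χx)) x≤e | inj₁ x<e | inj₂ i≤x = not-both χx
        (≡.subst (λ z → χ z ≡ false) (ℕₚ.m+[n∸m]≡n i≤x)
          (within (x ∸ i) (ℕₚ.+-cancelˡ-< i (x ∸ i) m (≡.subst (ℕ._< i ℕ.+ m) (≡.sym (ℕₚ.m+[n∸m]≡n i≤x)) x<e))))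
      end′ : m ≡ d ⊎ χ e ≡ true → d ∸ m ≡ 0 ⊎ χ e ≡ true
      end′ (inj₁ p) = inj₁ (≡.trans (≡.cong (d ∸_) p) (ℕₚ.n∸n≡0 d))
      end′ (inj₂ p) = inj₂ p
      open O (order-above′ (d ∸ m) e end+rest (end′ end) h van)
        renaming (const to A; 0≤const to 0≤A; bounded to h-bounded)
      s s′ : ℕ
      s  = count χ i d
      s′ = count χ e (d ∸ m)
      final : ∀ {n} x → c * (ν n ^ s′ * (κ χ e (d ∸ m) + a * ι n) * β k x) + A * (ν n ^ s′ * ι n) * β k x ≈
              ν n ^ s * (κ χ i d + (c * a + A) * ι n) * β k x
      final {n} x = trans
        (solve 7 (λ c v k′ a i b A → c :* (v :* (k′ :+ a :* i) :* b) :+ A :* (v :* i) :* b :=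
           v :* (c :* k′ :+ (c :* a :+ A) :* i) :* b) refl c (ν n ^ s′) (κ χ e (d ∸ m)) a (ι n) (β k x) A)
        (*-congʳ (*-cong (reflexive (≡.cong (ν n ^_) (≡.sym (count-gap χ i d)))) (+-congʳ (sym (κ-gap χ i d)))))

    -- At the optimum σ = N m! one has σ²/m! = σ N = P, so the σ² share of `β i` cancels half of 2P
    -- `β i`. What remains is P `β i` ≼ n^m `β e` + σ² S, and S has order only n^(s-1) because the
    -- run is entered at its start.
    run-estimate : ∀ i d → i ℕ.+ d ≡ k → Start i → let m = runLength χ true i d in
      Estimate (i ℕ.+ m) (d ∸ m) → Estimate i d
    run-estimate i d i+d≡k st (estimate a 0≤a b) =
      estimate (P ⁻¹ * a + P ⁻¹ * (σ * σ) * A)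
        (+-nonneg (*-nonneg 0≤P⁻¹ 0≤a) (*-nonneg (*-nonneg 0≤P⁻¹ (0≤x*x σ)) 0≤A)) λ {n} H →
      At.≼-trans H
        (At.≼-resp H (λ x → scaled x) (λ _ → refl) (At.≼-* H 0≤P⁻¹ (At.≼-cancelʳ H (λ x → P * β i x) (doubled H))))
        (At.≼-resp H (λ _ → refl) (λ x → final {n} x)
          (At.≼-* H 0≤P⁻¹ (At.≼-+ H (At.≼-* H (At.0≤ν^ H m) (b H)) (At.≼-* H (0≤x*x σ) (S-bounded H)))))
      where
      open <R
      m = runLength χ true i d
      e = i ℕ.+ m
      open Block (block χ true i d)
      open Step {i} {d} {m} i+d≡k m≤d
      N M σ P : Carrier
      N = ⟦ d C m ⟧
      M = ⟦ m ! ⟧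
      σ = N * M
      P = σ * N
      0<N : 0# < N
      0<N = ⟦⟧-pos (0<nCk m≤d)
      0<M : 0# < M
      0<M = ⟦⟧-pos (ℕₚ.1≤n! m)
      0<P : 0# < P
      0<P = *-pos (*-pos 0<N 0<M) 0<N
      0≤P⁻¹ : 0# ≤ P ⁻¹
      0≤P⁻¹ = inj₁ (⁻¹-pos 0<P)
      P⁻¹P : P ⁻¹ * P ≈ 1#
      P⁻¹P = ⁻¹-inverseˡ (pos⇒≉0 0<P)
      S : ℕ → ℕ → Carrier
      S n x = ∑< i (λ j → coeff i j * (ι n ^ (i ∸ j) * β j x))
      k∸i≡d : k ∸ i ≡ d
      k∸i≡d = ≡.trans (≡.cong (_∸ i) (≡.sym i+d≡k)) (ℕₚ.m+n∸m≡n i d)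
      s = count χ i d
      s′ = count χ e (d ∸ m)
      -- Of the i-j positions j, ..., i-1 the last is unselected, so they add at most i-j-1 to the
      -- count s.
      lag : ∀ j → j ℕ.< i → Start i → suc (count χ j (k ∸ j)) ℕ.≤ s ℕ.+ (i ∸ j)
      lag j j<i (inj₁ ≡.refl) = ⊥-elim (ℕₚ.n≮0 j<i)
      lag j (ℕ.s≤s j≤p) (inj₂ (p , ≡.refl , χp)) = ℕₚ.≤-trans
        (ℕ.s≤s (ℕₚ.≤-trans (ℕₚ.≤-reflexive (≡.cong (count χ j) k∸j)) (count-≤ χ (p ∸ j) j (suc d))))
        (ℕₚ.≤-reflexive (≡.trans (≡.cong (λ z → suc (p ∸ j ℕ.+ z)) count-p)
          (≡.trans (ℕₚ.+-comm (suc (p ∸ j)) s) (≡.cong (s ℕ.+_) (≡.sym (ℕₚ.+-∸-assoc 1 j≤p))))))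
        where
        count-p : count χ (j ℕ.+ (p ∸ j)) (suc d) ≡ count χ (suc p) d
        count-p rewrite ℕₚ.m+[n∸m]≡n j≤p | χp = ≡.refl
        k∸j : k ∸ j ≡ p ∸ j ℕ.+ suc d
        k∸j = ≡.trans (≡.cong (_∸ j) (≡.trans (≡.sym i+d≡k) (≡.sym (ℕₚ.+-suc p d))))
          (ℕₚ.+-∸-comm (suc d) j≤p)
      S-order : O S (λ n → ν n ^ s * ι n)
      S-order = O-∑ i λ j j<i → O-* (0≤coeff i j) (O-mono
        (λ H → At.ι^ν^-≤ H (i ∸ j) (count χ j (k ∸ j)) s (lag j j<i st))
        (O-scale (λ n → ι n ^ (i ∸ j)) (λ H → At.0≤ι^ H (i ∸ j))
          (order-β (k ∸ j) j (k ∸ j) (ℕₚ.m+[n∸m]≡n (ℕₚ.<⇒≤ (ℕₚ.<-≤-trans j<i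
            (ℕₚ.≤-trans (ℕₚ.m≤m+n i m) end≤k)))) ℕₚ.≤-refl)))
      open O S-order renaming (const to A; 0≤const to 0≤A; bounded to S-bounded)
      doubled : ∀ {n} (H : k ℕ.+ k ℕ.≤ n) → At._≼_ H (λ x → P * β i x + P * β i x)
        (λ x → (ν n ^ m * β e x + (σ * σ) * S n x) + P * β i x)
      doubled {n} H = At.≼-resp H
        (λ x → trans (*-congˡ (*-congʳ (reflexive (≡.cong (λ z → ⟦ z C m ⟧) k∸i≡d))))
          (solve 3 (λ s n b → (s :+ s) :* (n :* b) := s :* n :* b :+ s :* n :* b) refl σ N (β i x)))
        (λ x → trans
          (solve 6 (λ v N M r b S → v :+ (N :* M :* (N :* M)) :* (r :* b :+ S) :=
            v :+ (N :* M :* (N :* M)) :* S :+ (M :* r) :* (N :* M :* N :* b)) refl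
            (ν n ^ m * β e x) N M (M ⁻¹) (β i x) (S n x))
          (+-congˡ (trans (*-congʳ (⁻¹-inverseʳ (pos⇒≉0 0<M))) (*-identityˡ _))))
        (At.square-≼ H i m σ end≤k)
      scaled : ∀ x → P ⁻¹ * (P * β i x) ≈ β i x
      scaled x = trans (sym (*-assoc _ _ _)) (trans (*-congʳ P⁻¹P) (*-identityˡ _))
      κ≈ : P ⁻¹ * κ χ e (d ∸ m) ≈ κ χ i d
      κ≈ = begin-equality
        P ⁻¹ * κ χ e (d ∸ m)         ≈⟨ *-congˡ (κ-run χ i d) ⟨
        P ⁻¹ * (κ χ i d * (N * N * M)) ≈⟨ solve 4 (λ r k N M → r :* (k :* (N :* N :* M)) := r :* (N :* M :* N) :* k)
                                          refl (P ⁻¹) (κ χ i d) N M ⟩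
        P ⁻¹ * P * κ χ i d           ≈⟨ trans (*-congʳ P⁻¹P) (*-identityˡ _) ⟩
        κ χ i d                      ∎
      ν^s : ∀ n → ν n ^ m * ν n ^ s′ ≈ ν n ^ s
      ν^s n = trans (sym (^-homo-* (ν n) m s′)) (reflexive (≡.cong (ν n ^_) (≡.sym (count-run χ i d))))
      final : ∀ {n} x →
        P ⁻¹ * (ν n ^ m * (ν n ^ s′ * (κ χ e (d ∸ m) + a * ι n) * β k x) + (σ * σ) * (A * (ν n ^ s * ι n) * β k x)) ≈
        ν n ^ s * (κ χ i d + (P ⁻¹ * a + P ⁻¹ * (σ * σ) * A) * ι n) * β k x
      final {n} x = begin-equality
        P ⁻¹ * (ν n ^ m * (ν n ^ s′ * (κ χ e (d ∸ m) + a * ι n) * β k x) + (σ * σ) * (A * (ν n ^ s * ι n) * β k x))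
          ≈⟨ solve 10 (λ r v w k′ a i b t A u → r :* (v :* (w :* (k′ :+ a :* i) :* b) :+ t :* (A :* (u :* i) :* b)) :=
               (v :* w) :* (r :* k′ :+ r :* a :* i) :* b :+ u :* (r :* t :* A :* i) :* b) refl
               (P ⁻¹) (ν n ^ m) (ν n ^ s′) (κ χ e (d ∸ m)) a (ι n) (β k x) (σ * σ) A (ν n ^ s) ⟩
        (ν n ^ m * ν n ^ s′) * (P ⁻¹ * κ χ e (d ∸ m) + P ⁻¹ * a * ι n) * β k x +
          ν n ^ s * (P ⁻¹ * (σ * σ) * A * ι n) * β k x
          ≈⟨ +-congʳ (*-congʳ (*-cong (ν^s n) (+-congʳ κ≈))) ⟩
        ν n ^ s * (κ χ i d + P ⁻¹ * a * ι n) * β k x + ν n ^ s * (P ⁻¹ * (σ * σ) * A * ι n) * β k x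
          ≈⟨ solve 6 (λ u k p i q b → u :* (k :+ p :* i) :* b :+ u :* (q :* i) :* b :=
               u :* (k :+ (p :+ q) :* i) :* b) refl (ν n ^ s) (κ χ i d) (P ⁻¹ * a) (ι n) (P ⁻¹ * (σ * σ) * A) (β k x) ⟩
        ν n ^ s * (κ χ i d + (P ⁻¹ * a + P ⁻¹ * (σ * σ) * A) * ι n) * β k x ∎

    -- The last hypothesis excludes entering a run in its middle. It is passed along by the
    -- alternation: a gap ends right after an unselected position, and a run ends at an unselected
    -- position or at k.
    estimates : ∀ f d i → i ℕ.+ d ≡ k → d ℕ.≤ f → Start i ⊎ χ i ≡ false ⊎ d ≡ 0 → Estimate i d
    estimates f zero i i+0≡k _ _ = estimate 0# ≤-refl λ {n} H → At.≼-reflexive H λ x _ →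
      trans (reflexive (≡.cong (λ z → β z x) (≡.trans (≡.sym (ℕₚ.+-identityʳ i)) i+0≡k)))
        (sym (trans (*-congʳ (trans (*-identityˡ _) (trans (+-congˡ (zeroˡ _)) (+-identityʳ _)))) (*-identityˡ _)))
    estimates (suc f) (suc d) i i+d≡k (ℕ.s≤s d≤f) cond with χ i in eq
    ... | false = gap-estimate i (suc d) i+d≡k (estimates f (suc d ∸ m) (i ℕ.+ m) (Step.end+rest i+d≡k m≤d)
        (ℕₚ.≤-trans (ℕₚ.≤-reflexive (≡.cong (suc d ∸_) m≡)) (ℕₚ.≤-trans (ℕₚ.m∸n≤m d m′) d≤f))
        (inj₁ (inj₂ (i ℕ.+ m′ , ≡.trans (≡.cong (i ℕ.+_) m≡) (ℕₚ.+-suc i m′) ,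
          within m′ (ℕₚ.≤-reflexive (≡.sym m≡))))))
      where
      m′ = runLength χ false (suc i) d
      m  = runLength χ false i (suc d)
      m≡ : m ≡ suc m′
      m≡ = runLength-suc χ false i d eq
      open Block (block χ false i (suc d))
    ... | true with cond
    ...   | inj₂ (inj₁ ())
    ...   | inj₂ (inj₂ ())
    ...   | inj₁ start = run-estimate i (suc d) i+d≡k start
        (estimates f (suc d ∸ m) (i ℕ.+ m) (Step.end+rest i+d≡k m≤d)
          (ℕₚ.≤-trans (ℕₚ.≤-reflexive (≡.cong (suc d ∸_) m≡)) (ℕₚ.≤-trans (ℕₚ.m∸n≤m d m′) d≤f))
          (inj₂ (after end)))
      where
      m′ = runLength χ true (suc i) d
      m  = runLength χ true i (suc d)
      m≡ : m ≡ suc m′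
      m≡ = runLength-suc χ true i d eq
      open Block (block χ true i (suc d))
      after : m ≡ suc d ⊎ χ (i ℕ.+ m) ≡ false → χ (i ℕ.+ m) ≡ false ⊎ suc d ∸ m ≡ 0
      after (inj₁ p) = inj₂ (≡.trans (≡.cong (suc d ∸_) p) (ℕₚ.n∸n≡0 (suc d)))
      after (inj₂ p) = inj₁ p

    total-estimate : Estimate 0 k
    total-estimate = estimates k k 0 ≡.refl ℕₚ.≤-refl (inj₁ (inj₁ ≡.refl))

  -- Evaluation of the leading constant

  -- Ties the list, in which K is written, to the characteristic function on [i,i+d-1], in which κ
  -- is written, so that one induction over positions compares them.
  data Enumerates (χ : ℕ → Bool) : ℕ → ℕ → List ℕ → Set where
    done : ∀ {i} → Enumerates χ i 0 []
    skip : ∀ {i d L} → χ i ≡ false → Enumerates χ (suc i) d L → Enumerates χ i (suc d) L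
    take : ∀ {i d L} → χ i ≡ true → Enumerates χ (suc i) d L → Enumerates χ i (suc d) (i ∷ L)

  enum-≥ : ∀ {χ i d L} → Enumerates χ i d L → All (i ℕ.≤_) L
  enum-≥ done       = []
  enum-≥ (skip _ E) = All.map ℕₚ.<⇒≤ (enum-≥ E)
  enum-≥ (take _ E) = ℕₚ.≤-refl ∷ All.map ℕₚ.<⇒≤ (enum-≥ E)

  count-enum : ∀ {χ i d L} → Enumerates χ i d L → count χ i d ≡ length L
  count-enum done        = ≡.refl
  count-enum (skip eq E) rewrite eq = count-enum E
  count-enum (take eq E) rewrite eq = ≡.cong suc (count-enum E)

  runFrom-< : ∀ {i} L → All (i ℕ.<_) L → runFrom i L ≡ 0
  runFrom-< []      _         = ≡.refl
  runFrom-< {i} (ℓ ∷ L) (i<ℓ ∷ _) with ℓ ℕₚ.≟ i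
  ... | yes ≡.refl = ⊥-elim (ℕₚ.<-irrefl ≡.refl i<ℓ)
  ... | no  _      = ≡.refl

  runLength-enum : ∀ {χ i d L} → Enumerates χ i d L → runLength χ true i d ≡ runFrom i L
  runLength-enum done = ≡.refl
  runLength-enum (skip {L = L} eq E) rewrite eq = ≡.sym (runFrom-< L (enum-≥ E))
  runLength-enum {i = i} (take eq E) with i ℕₚ.≟ i
  ... | yes _   rewrite eq = ≡.cong suc (runLength-enum E)
  ... | no  i≢i = ⊥-elim (i≢i ≡.refl)

  gap-[] : ∀ {χ i d} → Enumerates χ i d [] → runLength χ false i d ≡ d
  gap-[] done        = ≡.refl
  gap-[] (skip eq E) rewrite eq = ≡.cong suc (gap-[] E)

  gap-∷ : ∀ {χ i d ℓ L} → Enumerates χ i d (ℓ ∷ L) → i ℕ.+ runLength χ false i d ≡ ℓ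
  gap-∷ {i = i} (take eq E) rewrite eq = ℕₚ.+-identityʳ i
  gap-∷ {χ} {i} {suc d} (skip eq E) rewrite eq = ≡.trans (ℕₚ.+-suc i (runLength χ false (suc i) d)) (gap-∷ E)

  -- The quotient (i+d)!/i!. In `K-formula` it stands against d!, and the two cancel at i = 0, d =
  -- k.
  rising : ℕ → ℕ → ℕ
  rising i zero    = 1
  rising i (suc d) = suc i ℕ.* rising (suc i) d

  rising-! : ∀ i d → i ! ℕ.* rising i d ≡ (i ℕ.+ d) !
  rising-! i zero    = ≡.trans (ℕₚ.*-identityʳ _) (≡.cong _! (≡.sym (ℕₚ.+-identityʳ i)))
  rising-! i (suc d) = begin
    i ! ℕ.* (suc i ℕ.* rising (suc i) d) ≡⟨ ℕₚ.*-assoc (i !) (suc i) _ ⟨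
    i ! ℕ.* suc i ℕ.* rising (suc i) d   ≡⟨ ≡.cong (ℕ._* rising (suc i) d) (ℕₚ.*-comm (i !) (suc i)) ⟩
    suc i ! ℕ.* rising (suc i) d         ≡⟨ rising-! (suc i) d ⟩
    (suc i ℕ.+ d) !                      ≡⟨ ≡.cong _! (ℕₚ.+-suc i d) ⟨
    (i ℕ.+ suc d) !                      ∎
    where open ≡.≡-Reasoning

  -- Only the upper entry of the first binomial changes, from d to d+1. With j = k-ℓ and g = d-j,
  -- the ratio C(d+1,j)/C(d,j) is (d+1)/(g+1); for the empty list g = d and the ratio is 1.
  chain-gap : ∀ {χ i d L k} → i ℕ.+ suc d ≡ k → All (ℕ._< k) L → Enumerates χ (suc i) d L →
    suc (runLength χ false (suc i) d) ℕ.* binomialChain (suc d) k L ≡ suc d ℕ.* binomialChain d k L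
  chain-gap {L = []}    eq _ E = ≡.cong (λ g → suc g ℕ.* 1) (gap-[] E)
  chain-gap {χ} {i} {d} {ℓ ∷ L} {k} eq (ℓ<k ∷ _) E = begin
    suc g ℕ.* ((suc d C j) ℕ.* c)  ≡⟨ ℕₚ.*-assoc (suc g) (suc d C j) c ⟨
    suc g ℕ.* (suc d C j) ℕ.* c    ≡⟨ ≡.cong (ℕ._* c) absorb ⟩
    suc d ℕ.* (d C j) ℕ.* c        ≡⟨ ℕₚ.*-assoc (suc d) (d C j) c ⟩
    suc d ℕ.* ((d C j) ℕ.* c)      ∎
    where
    open ≡.≡-Reasoning
    g = runLength χ false (suc i) d
    j = k ∸ ℓ
    c = binomialChain (k ∸ ℓ ∸ 1) k L
    i+g : suc i ℕ.+ g ≡ ℓ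
    i+g = gap-∷ E
    d≡ : j ℕ.+ g ≡ d
    d≡ = ℕₚ.+-cancelˡ-≡ (suc i) _ _ (begin
      suc i ℕ.+ (j ℕ.+ g) ≡⟨ ≡.cong (suc i ℕ.+_) (ℕₚ.+-comm j g) ⟩
      suc i ℕ.+ (g ℕ.+ j) ≡⟨ ℕₚ.+-assoc (suc i) g j ⟨
      suc i ℕ.+ g ℕ.+ j   ≡⟨ ≡.cong (ℕ._+ j) i+g ⟩
      ℓ ℕ.+ (k ∸ ℓ)       ≡⟨ ℕₚ.m+[n∸m]≡n (ℕₚ.<⇒≤ ℓ<k) ⟩
      k                   ≡⟨ eq ⟨
      i ℕ.+ suc d         ≡⟨ ℕₚ.+-suc i d ⟩
      suc i ℕ.+ d         ∎)
    absorb′ : ∀ j g → suc g ℕ.* (suc (j ℕ.+ g) C j) ≡ suc (j ℕ.+ g) ℕ.* ((j ℕ.+ g) C j)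
    absorb′ j g = ≡.trans (≡.cong (λ z → suc g ℕ.* (z C j)) (≡.sym (ℕₚ.+-suc j g)))
      (≡.trans (≡.sym (absorption-+ j (suc g)))
        (≡.trans (≡.cong (λ z → suc j ℕ.* (z C suc j)) (ℕₚ.+-suc j g)) (absorption (j ℕ.+ g) j)))
    absorb : suc g ℕ.* (suc d C j) ≡ suc d ℕ.* (d C j)
    absorb = ≡.subst (λ z → suc g ℕ.* (suc z C j) ≡ suc z ℕ.* (z C j)) d≡ (absorb′ j g)

  sorted-tail : ∀ {ℓ L} → Linked ℕ._<_ (ℓ ∷ L) → Linked ℕ._<_ L
  sorted-tail [-]      = []
  sorted-tail (_ ∷ xs) = xs

  -- Induction from k downwards. An unselected position changes the chain by (d+1)/(g+1); a selected
  -- one changes the run factorials by r+1 and the denominator by (i+1)(d+1). The boundary terms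
  -- `rising` and d! supply i+1 and d+1, after which both cases match `factor`.
  K-formula : ∀ {χ k} i d L → i ℕ.+ d ≡ k → Linked ℕ._<_ L → All (ℕ._< k) L → Enumerates χ i d L →
    ⟦ runFactorials L ⟧ * ⟦ binomialChain d k L ⟧ * ⟦ rising i d ⟧ ≈
    κ χ i d * ⟦ K-denominator k L ⟧ * ⟦ d ! ⟧
  K-formula i zero [] _ _ _ done = *-congʳ (*-congʳ ⟦1⟧)
  K-formula {χ} {k} i (suc d) L eq sorted L<k (skip χi E) = begin-equality
    R * ⟦ binomialChain (suc d) k L ⟧ * ⟦ suc i ℕ.* rising (suc i) d ⟧
      ≈⟨ *-congˡ (⟦⟧-* (suc i) (rising (suc i) d)) ⟩
    R * ⟦ binomialChain (suc d) k L ⟧ * (⟦ suc i ⟧ * ρ)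
      ≈⟨ *-congʳ (*-congˡ chain) ⟩
    R * (G ⁻¹ * (D * B)) * (⟦ suc i ⟧ * ρ)
      ≈⟨ solve 6 (λ R G D B I ρ → R :* (G :* (D :* B)) :* (I :* ρ) := (R :* B :* ρ) :* (I :* G) :* D)
           refl R (G ⁻¹) D B ⟦ suc i ⟧ ρ ⟩
    (R * B * ρ) * (⟦ suc i ⟧ * G ⁻¹) * D
      ≈⟨ *-congʳ (*-congʳ (K-formula (suc i) d L (≡.trans (≡.sym (ℕₚ.+-suc i d)) eq) sorted L<k E)) ⟩
    (κ χ (suc i) d * den * ⟦ d ! ⟧) * (⟦ suc i ⟧ * G ⁻¹) * D
      ≈⟨ solve 5 (λ k e f x D → k :* e :* f :* x :* D := k :* x :* e :* (D :* f)) refl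
           (κ χ (suc i) d) den ⟦ d ! ⟧ (⟦ suc i ⟧ * G ⁻¹) D ⟩
    κ χ (suc i) d * factor χ false i d * den * (D * ⟦ d ! ⟧)
      ≈⟨ *-cong (*-congʳ (*-congˡ (reflexive (≡.cong (λ b → factor χ b i d) (≡.sym χi))))) (sym (⟦⟧-* (suc d) (d !))) ⟩
    κ χ i (suc d) * den * ⟦ suc d ! ⟧ ∎
    where
    open <R
    R = ⟦ runFactorials L ⟧
    ρ = ⟦ rising (suc i) d ⟧
    den = ⟦ K-denominator k L ⟧
    g = runLength χ false (suc i) d
    G = ⟦ suc g ⟧
    D = ⟦ suc d ⟧
    B = ⟦ binomialChain d k L ⟧
    chain : ⟦ binomialChain (suc d) k L ⟧ ≈ G ⁻¹ * (D * B)
    chain = *-cancelˡ (suc≉0 g) (begin-equality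
      G * ⟦ binomialChain (suc d) k L ⟧     ≈⟨ ⟦⟧-* (suc g) (binomialChain (suc d) k L) ⟨
      ⟦ suc g ℕ.* binomialChain (suc d) k L ⟧ ≡⟨ ≡.cong ⟦_⟧ (chain-gap eq L<k E) ⟩
      ⟦ suc d ℕ.* binomialChain d k L ⟧     ≈⟨ ⟦⟧-* (suc d) (binomialChain d k L) ⟩
      D * B                                 ≈⟨ *-identityˡ _ ⟨
      1# * (D * B)                          ≈⟨ *-congʳ (⁻¹-inverseʳ (suc≉0 g)) ⟨
      G * G ⁻¹ * (D * B)                    ≈⟨ *-assoc _ _ _ ⟩
      G * (G ⁻¹ * (D * B))                  ∎)
  K-formula {χ} {k} i (suc d) (.i ∷ L) eq sorted (_ ∷ L<k) (take χi E) = begin-equality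
    ⟦ runFactorials (i ∷ L) ⟧ * ⟦ binomialChain (suc d) k (i ∷ L) ⟧ * ⟦ suc i ℕ.* rising (suc i) d ⟧
      ≈⟨ *-cong (*-cong (trans (reflexive (≡.cong ⟦_⟧ facts)) (⟦⟧-* (suc r) (runFactorials L)))
           (reflexive (≡.cong ⟦_⟧ chain))) (⟦⟧-* (suc i) (rising (suc i) d)) ⟩
    (r⁺ * R) * B * (I * ρ)
      ≈⟨ solve 5 (λ r R B I ρ → r :* R :* B :* (I :* ρ) := (R :* B :* ρ) :* (r :* I)) refl r⁺ R B I ρ ⟩
    (R * B * ρ) * (r⁺ * I)
      ≈⟨ *-congʳ (K-formula (suc i) d L (≡.trans (≡.sym (ℕₚ.+-suc i d)) eq) (sorted-tail sorted) L<k E) ⟩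
    (κ χ (suc i) d * den * ⟦ d ! ⟧) * (r⁺ * I)
      ≈⟨ trans (*-congˡ one) (*-identityʳ _) ⟨
    (κ χ (suc i) d * den * ⟦ d ! ⟧) * (r⁺ * I) * (D * D ⁻¹ * (D * D ⁻¹))
      ≈⟨ solve 7 (λ k e f r I D δ → (k :* e :* f) :* (r :* I) :* (D :* δ :* (D :* δ)) :=
           k :* (r :* (δ :* δ)) :* ((I :* D) :* e) :* (D :* f)) refl
           (κ χ (suc i) d) den ⟦ d ! ⟧ r⁺ I D (D ⁻¹) ⟩
    κ χ (suc i) d * (r⁺ * (D ⁻¹ * D ⁻¹)) * ((I * D) * den) * (D * ⟦ d ! ⟧)
      ≈⟨ *-cong (*-cong (*-congˡ fac) dens) (sym (⟦⟧-* (suc d) (d !))) ⟩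
    κ χ i (suc d) * ⟦ K-denominator k (i ∷ L) ⟧ * ⟦ suc d ! ⟧ ∎
    where
    open <R
    r = runFrom (suc i) L
    r⁺ = ⟦ suc r ⟧
    R = ⟦ runFactorials L ⟧
    ρ = ⟦ rising (suc i) d ⟧
    den = ⟦ K-denominator k L ⟧
    I = ⟦ suc i ⟧
    D = ⟦ suc d ⟧
    B = ⟦ binomialChain d k L ⟧
    one : D * D ⁻¹ * (D * D ⁻¹) ≈ 1#
    one = trans (*-cong (⁻¹-inverseʳ (suc≉0 d)) (⁻¹-inverseʳ (suc≉0 d))) (*-identityˡ 1#)
    facts : runFactorials (i ∷ L) ≡ suc r ℕ.* runFactorials L
    facts = runFactorials-∷ i L sorted
    k∸i : k ∸ i ≡ suc d
    k∸i = ≡.trans (≡.cong (_∸ i) (≡.sym eq)) (ℕₚ.m+n∸m≡n i (suc d))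
    -- The first binomial is C(k-i,k-i) = 1, and the chain resumes with upper entry k-i-1 = d.
    chain : binomialChain (suc d) k (i ∷ L) ≡ binomialChain d k L
    chain rewrite k∸i | nCn≡1 (suc d) = ℕₚ.*-identityˡ _
    fac : r⁺ * (D ⁻¹ * D ⁻¹) ≈ factor χ (χ i) i d
    fac = reflexive (≡.trans (≡.cong (λ r → ⟦ suc r ⟧ * (D ⁻¹ * D ⁻¹)) (≡.sym (runLength-enum E)))
      (≡.cong (λ b → factor χ b i d) (≡.sym χi)))
    dens : (I * D) * den ≈ ⟦ K-denominator k (i ∷ L) ⟧
    dens = trans (*-congʳ (trans (sym (⟦⟧-* (suc i) (suc d)))
        (reflexive (≡.cong₂ (λ a b → ⟦ a ℕ.* b ⟧) (ℕₚ.+-comm 1 i) (≡.sym k∸i)))))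
      (sym (⟦⟧-* ((i ℕ.+ 1) ℕ.* (k ∸ i)) (K-denominator k L)))

  K≈κ : ∀ {χ} k L → Linked ℕ._<_ L → All (ℕ._< k) L → Enumerates χ 0 k L → K k L ≈ κ χ 0 k
  K≈κ {χ} k L sorted L<k E = begin-equality
    ⟦ K-numerator k L ⟧ * ⟦ K-denominator k L ⟧ ⁻¹
      ≈⟨ *-congʳ num ⟩
    κ χ 0 k * ⟦ K-denominator k L ⟧ * ⟦ K-denominator k L ⟧ ⁻¹
      ≈⟨ trans (*-assoc _ _ _) (trans (*-congˡ (⁻¹-inverseʳ (pos⇒≉0 (⟦⟧-pos (den-pos L L<k))))) (*-identityʳ _)) ⟩
    κ χ 0 k ∎
    where
    open <R
    k!≉0 : ⟦ k ! ⟧ ≉ 0#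
    k!≉0 = pos⇒≉0 (⟦⟧-pos (ℕₚ.1≤n! k))
    num : ⟦ K-numerator k L ⟧ ≈ κ χ 0 k * ⟦ K-denominator k L ⟧
    num = *-cancelˡ k!≉0 (begin-equality
      ⟦ k ! ⟧ * ⟦ K-numerator k L ⟧
        ≈⟨ *-comm _ _ ⟩
      ⟦ K-numerator k L ⟧ * ⟦ k ! ⟧
        ≈⟨ *-cong (⟦⟧-* (runFactorials L) (binomialChain k k L))
             (reflexive (≡.cong ⟦_⟧ (≡.sym (≡.trans (≡.sym (ℕₚ.*-identityˡ _)) (rising-! 0 k))))) ⟩
      ⟦ runFactorials L ⟧ * ⟦ binomialChain k k L ⟧ * ⟦ rising 0 k ⟧
        ≈⟨ K-formula 0 k L ≡.refl sorted L<k E ⟩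
      κ χ 0 k * ⟦ K-denominator k L ⟧ * ⟦ k ! ⟧
        ≈⟨ *-comm _ _ ⟩
      ⟦ k ! ⟧ * (κ χ 0 k * ⟦ K-denominator k L ⟧) ∎)
    den-pos : ∀ L → All (ℕ._< k) L → 0 ℕ.< K-denominator k L
    den-pos []      []           = ℕ.s≤s ℕ.z≤n
    den-pos (ℓ ∷ L) (ℓ<k ∷ L<k) = ℕₚ.*-mono-< {0} {_} {0}
      (ℕₚ.*-mono-< {0} {_} {0} (ℕₚ.m≤n+m 1 ℓ) (ℕₚ.m<n⇒0<n∸m ℓ<k)) (den-pos L L<k)

  runLength-not : ∀ χ b i d → runLength (not ∘ χ) (not b) i d ≡ runLength χ b i d
  runLength-not χ b i zero = ≡.refl
  runLength-not χ b i (suc d) with χ i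
  runLength-not χ true  i (suc d) | true  = ≡.cong suc (runLength-not χ true (suc i) d)
  runLength-not χ true  i (suc d) | false = ≡.refl
  runLength-not χ false i (suc d) | true  = ≡.refl
  runLength-not χ false i (suc d) | false = ≡.cong suc (runLength-not χ false (suc i) d)

  count-not : ∀ χ i d → count χ i d ℕ.+ count (not ∘ χ) i d ≡ d
  count-not χ i zero = ≡.refl
  count-not χ i (suc d) with χ i
  ... | true  = ≡.cong suc (count-not χ (suc i) d)
  ... | false = ≡.trans (ℕₚ.+-suc _ _) (≡.cong suc (count-not χ (suc i) d))

  -- Runs of χ are gaps of its negation and have the same lengths. One length stands in a numerator
  -- and the other in a denominator, so the product does not depend on χ.
  factor-not : ∀ χ b i d →
    factor χ b i d * factor (not ∘ χ) (not b) i d ≈ ⟦ suc i ⟧ * (⟦ suc d ⟧ ⁻¹ * ⟦ suc d ⟧ ⁻¹)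
  factor-not χ true i d = trans
    (*-congˡ (*-congˡ (reflexive (≡.cong (λ r → ⟦ suc r ⟧ ⁻¹) (runLength-not χ true (suc i) d)))))
    (trans (solve 4 (λ r δ I ρ → r :* δ :* (I :* ρ) := r :* ρ :* (I :* δ)) refl
        ⟦ suc r ⟧ (⟦ suc d ⟧ ⁻¹ * ⟦ suc d ⟧ ⁻¹) ⟦ suc i ⟧ (⟦ suc r ⟧ ⁻¹))
      (trans (*-congʳ (⁻¹-inverseʳ (suc≉0 r))) (*-identityˡ _)))
    where r = runLength χ true (suc i) d
  factor-not χ false i d = trans
    (*-congˡ (*-congʳ (reflexive (≡.cong (λ r → ⟦ suc r ⟧) (runLength-not χ false (suc i) d)))))
    (trans (solve 4 (λ r δ I ρ → I :* ρ :* (r :* δ) := r :* ρ :* (I :* δ)) refl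
        ⟦ suc r ⟧ (⟦ suc d ⟧ ⁻¹ * ⟦ suc d ⟧ ⁻¹) ⟦ suc i ⟧ (⟦ suc r ⟧ ⁻¹))
      (trans (*-congʳ (⁻¹-inverseʳ (suc≉0 r))) (*-identityˡ _)))
    where r = runLength χ false (suc i) d

  κ-not : ∀ χ i d → κ χ i d * κ (not ∘ χ) i d * (⟦ d ! ⟧ * ⟦ d ! ⟧) ≈ ⟦ rising i d ⟧
  κ-not χ i zero = trans (*-cong (*-identityˡ 1#) (trans (*-cong ⟦1⟧ ⟦1⟧) (*-identityˡ 1#)))
    (trans (*-identityˡ 1#) (sym ⟦1⟧))
  κ-not χ i (suc d) = begin-equality
    (κ χ (suc i) d * f) * (κ χ̄ (suc i) d * f̄) * (⟦ suc d ! ⟧ * ⟦ suc d ! ⟧)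
      ≈⟨ *-congˡ (*-cong (⟦⟧-* (suc d) (d !)) (⟦⟧-* (suc d) (d !))) ⟩
    (κ χ (suc i) d * f) * (κ χ̄ (suc i) d * f̄) * ((D * ⟦ d ! ⟧) * (D * ⟦ d ! ⟧))
      ≈⟨ solve 6 (λ k f l g D e → (k :* f) :* (l :* g) :* ((D :* e) :* (D :* e)) :=
           (f :* g) :* (k :* l :* (e :* e)) :* (D :* D)) refl (κ χ (suc i) d) f (κ χ̄ (suc i) d) f̄ D ⟦ d ! ⟧ ⟩
    (f * f̄) * (κ χ (suc i) d * κ χ̄ (suc i) d * (⟦ d ! ⟧ * ⟦ d ! ⟧)) * (D * D)
      ≈⟨ *-congʳ (*-cong (factor-not χ (χ i) i d) (κ-not χ (suc i) d)) ⟩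
    ⟦ suc i ⟧ * (D ⁻¹ * D ⁻¹) * ⟦ rising (suc i) d ⟧ * (D * D)
      ≈⟨ solve 4 (λ I δ r D → I :* (δ :* δ) :* r :* (D :* D) := I :* r :* (D :* δ :* (D :* δ))) refl
           ⟦ suc i ⟧ (D ⁻¹) ⟦ rising (suc i) d ⟧ D ⟩
    ⟦ suc i ⟧ * ⟦ rising (suc i) d ⟧ * (D * D ⁻¹ * (D * D ⁻¹))
      ≈⟨ trans (*-congˡ (trans (*-cong (⁻¹-inverseʳ (suc≉0 d)) (⁻¹-inverseʳ (suc≉0 d))) (*-identityˡ 1#)))
           (*-identityʳ _) ⟩
    ⟦ suc i ⟧ * ⟦ rising (suc i) d ⟧
      ≈⟨ ⟦⟧-* (suc i) (rising (suc i) d) ⟨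
    ⟦ rising i (suc d) ⟧ ∎
    where
    open <R
    χ̄ = not ∘ χ
    f = factor χ (χ i) i d
    f̄ = factor χ̄ (χ̄ i) i d
    D = ⟦ suc d ⟧

  κκ̄k! : ∀ χ k → κ χ 0 k * κ (not ∘ χ) 0 k * ⟦ k ! ⟧ ≈ 1#
  κκ̄k! χ k = *-cancelˡ (pos⇒≉0 (⟦⟧-pos (ℕₚ.1≤n! k))) (trans
    (solve 2 (λ a f → f :* (a :* f) := a :* (f :* f)) refl (κ χ 0 k * κ (not ∘ χ) 0 k) ⟦ k ! ⟧)
    (trans (κ-not χ 0 k) (trans (reflexive (≡.cong ⟦_⟧
      (≡.trans (≡.sym (ℕₚ.*-identityˡ _)) (rising-! 0 k)))) (sym (*-identityʳ _)))))

  -- From certificates to the Lovász number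

  member : List ℕ → ℕ → Bool
  member L x = does (_∈?_ ℕₚ._≟_ x L)

  -- Agreement with L is asked only from i on, because the tail of the list no longer contains the
  -- selected positions already passed.
  enumerates : ∀ {χ} d i L → Linked ℕ._<_ L → All (i ℕ.≤_) L → All (ℕ._< i ℕ.+ d) L →
    (∀ x → i ℕ.≤ x → χ x ≡ member L x) → Enumerates χ i d L
  enumerates zero i []      _ _ _ _ = done
  enumerates zero i (ℓ ∷ L) _ (i≤ℓ ∷ _) (ℓ<i ∷ _) _ = ⊥-elim (ℕₚ.<-irrefl ≡.refl
    (ℕₚ.≤-<-trans i≤ℓ (≡.subst (ℓ ℕ.<_) (ℕₚ.+-identityʳ i) ℓ<i)))
  enumerates (suc d) i [] sorted _ _ agree = skip (agree i ℕₚ.≤-refl)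
    (enumerates d (suc i) [] sorted [] [] (λ x p → agree x (ℕₚ.<⇒≤ p)))
  enumerates {χ} (suc d) i (ℓ ∷ L) sorted (i≤ℓ ∷ i≤L) L<k agree with ℓ ℕₚ.≟ i
  ... | no ℓ≢i = skip
      (≡.trans (agree i ℕₚ.≤-refl) (dec-false (_∈?_ ℕₚ._≟_ i (ℓ ∷ L)) (λ i∈ → ℕₚ.<-irrefl ≡.refl (All.lookup i<L i∈))))
      (enumerates d (suc i) (ℓ ∷ L) sorted i<L (≡.subst (λ z → All (ℕ._< z) (ℓ ∷ L)) (ℕₚ.+-suc i d) L<k)
        (λ x p → agree x (ℕₚ.<⇒≤ p)))
      where
      i<L : All (i ℕ.<_) (ℓ ∷ L)
      i<L = Linked⇒All ℕₚ.<-trans (ℕₚ.≤∧≢⇒< i≤ℓ (ℓ≢i ∘ ≡.sym)) sorted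
  enumerates {χ} (suc d) i (.i ∷ L) sorted (i≤ℓ ∷ i≤L) (_ ∷ L<k) agree | yes ≡.refl = take
      (≡.trans (agree i ℕₚ.≤-refl) (dec-true (_∈?_ ℕₚ._≟_ i (i ∷ L)) (here ≡.refl)))
      (enumerates d (suc i) L (sorted-tail sorted) (above sorted)
        (≡.subst (λ z → All (ℕ._< z) L) (ℕₚ.+-suc i d) L<k)
        (λ x i<x → ≡.trans (agree x (ℕₚ.<⇒≤ i<x)) (does-⇔
          (mk⇔ (λ { (here x≡i) → ⊥-elim (ℕₚ.<-irrefl (≡.sym x≡i) i<x) ; (there p) → p }) there)
          (_∈?_ ℕₚ._≟_ x (i ∷ L)) (_∈?_ ℕₚ._≟_ x L))))
      where
      above : ∀ {L} → Linked ℕ._<_ (i ∷ L) → All (i ℕ.<_) L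
      above [-]        = []
      above (p ∷ rest) = Linked⇒All ℕₚ.<-trans p rest

  ∩-full : ∀ {n} (A B : Subset n) → ∣ A ∩ B ∣ ≡ ∣ A ∣ → ∣ A ∩ B ∣ ≡ ∣ B ∣ → A ≡ B
  ∩-full []            []            _ _ = ≡.refl
  ∩-full (inside ∷ A)  (inside ∷ B)  p q = ≡.cong (inside ∷_) (∩-full A B (ℕₚ.suc-injective p) (ℕₚ.suc-injective q))
  ∩-full (outside ∷ A) (outside ∷ B) p q = ≡.cong (outside ∷_) (∩-full A B p q)
  ∩-full (inside ∷ A)  (outside ∷ B) p q = ⊥-elim (ℕₚ.1+n≰n (≡.subst (ℕ._≤ ∣ A ∣) p (∣p∩q∣≤∣p∣ A B)))
  ∩-full (outside ∷ A) (inside ∷ B)  p q = ⊥-elim (ℕₚ.1+n≰n (≡.subst (ℕ._≤ ∣ B ∣) q (∣p∩q∣≤∣q∣ A B)))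

  ⊆-or-0 : ∀ {n} (E A : Subset n) → [ E ⊆ A ] ≈ 0# ⊎ ∣ E ∩ A ∣ ≡ ∣ E ∣
  ⊆-or-0 []            []            = inj₂ ≡.refl
  ⊆-or-0 (outside ∷ E) (_ ∷ A)       = ⊆-or-0 E A
  ⊆-or-0 (inside ∷ E)  (outside ∷ A) = inj₁ refl
  ⊆-or-0 (inside ∷ E)  (inside ∷ A)  with ⊆-or-0 E A
  ... | inj₁ z = inj₁ z
  ... | inj₂ p = inj₂ (≡.cong suc p)

  ⊆-refl : ∀ {n} (E : Subset n) → [ E ⊆ E ] ≈ 1#
  ⊆-refl []            = refl
  ⊆-refl (outside ∷ E) = ⊆-refl E
  ⊆-refl (inside ∷ E)  = ⊆-refl E

  KSubset-≡ : ∀ {n k} {A B : KSubset n k} → proj₁ A ≡ proj₁ B → A ≡ B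
  KSubset-≡ {A = A , p} {B = .A , q} ≡.refl = ≡.cong (A ,_) (ℕₚ.≡-irrelevant p q)

  module Vertices {k : ℕ} (L : List ℕ) {n : ℕ} (k≤n : k ℕ.≤ n) where
    open Pairing L k≤n public
    open Attained G using (to; from-to; e; ∑-e)

    ∑ⱽ-diag : ∀ A f → ∑ⱽ (λ A′ → e A A′ * f A′) ≈ f A
    ∑ⱽ-diag = ∑-e

    intersection-< : ∀ (A B : V) → A ≢ B → ∣ proj₁ A ∩ proj₁ B ∣ ℕ.< k
    intersection-< (A , ∣A∣) (B , ∣B∣) A≢B = ℕₚ.≤∧≢⇒< (≡.subst (∣ A ∩ B ∣ ℕ.≤_) ∣A∣ (∣p∩q∣≤∣p∣ A B))
      λ eq → A≢B (KSubset-≡ (∩-full A B (≡.trans eq (≡.sym ∣A∣)) (≡.trans eq (≡.sym ∣B∣))))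

    intersection-self : ∀ (A : V) → ∣ proj₁ A ∩ proj₁ A ∣ ≡ k
    intersection-self (A , ∣A∣) = ≡.trans (≡.cong ∣_∣ (∩-idem A)) ∣A∣

    identity-cases : ∀ A B → (A ≡ B × e A B ≈ 1#) ⊎ (A ≢ B × e A B ≈ 0#)
    identity-cases A B with to A Finₚ.≟ to B
    ... | yes p = inj₁ (≡.trans (≡.sym (from-to A)) (≡.trans (≡.cong from p) (from-to B)) ,
            trans (reflexive (≡.cong (δ (to A)) (≡.sym p))) (δ-refl (to A)))
    ... | no ¬p = inj₂ ((λ A≡B → ¬p (≡.cong to A≡B)) , δ-≢ (to A) (to B) ¬p)

    -- Double counting: a k-set contains exactly one k-set, so the vertex sum can be exchanged for
    -- `∑ₛ`, whose value is known. The size of the enumeration itself is never unfolded.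
    ∑ⱽ-1 : ∑ⱽ (λ _ → 1#) ≈ ⟦ n C k ⟧
    ∑ⱽ-1 = begin-equality
      ∑ⱽ (λ _ → 1#)
        ≈⟨ ∑-cong {λ A → ∑ₛ n k (λ E → [ E ⊆ proj₁ A ])} {λ _ → 1#} (λ A → trans (∑ₛ-⊆ n k (proj₁ A))
             (trans (reflexive (≡.cong ⟦_⟧ (≡.trans (≡.cong (_C k) (proj₂ A)) (nCn≡1 k)))) ⟦1⟧)) ⟨
      ∑ⱽ (λ A → ∑ₛ n k (λ E → [ E ⊆ proj₁ A ]))
        ≈⟨ ∑ₛ-swap ∑ⱽ-additive n k (λ E A → [ E ⊆ proj₁ A ]) ⟩
      ∑ₛ n k (λ E → ∑ⱽ (λ A → [ E ⊆ proj₁ A ]))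
        ≈⟨ ∑ₛ-cong n k (λ E ∣E∣ → trans (single E ∣E∣) (sym (⊤-⊆ E))) ⟩
      ∑ₛ n k (λ E → [ E ⊆ ⊤ ])
        ≈⟨ ∑ₛ-⊆ n k ⊤ ⟩
      ⟦ ∣ ⊤ {n} ∣ C k ⟧
        ≡⟨ ≡.cong (λ z → ⟦ z C k ⟧) (∣⊤∣≡n n) ⟩
      ⟦ n C k ⟧ ∎
      where
      open <R
      single : ∀ E → ∣ E ∣ ≡ k → ∑ⱽ (λ A → [ E ⊆ proj₁ A ]) ≈ 1#
      single E ∣E∣ = trans
        (∑-cong {λ A → [ E ⊆ proj₁ A ]} {λ A → e Ê A * 1#} (λ A → trans (indicator A) (sym (*-identityʳ _))))
        (∑ⱽ-diag Ê (λ _ → 1#))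
        where
        Ê : V
        Ê = E , ∣E∣
        indicator : ∀ A → [ E ⊆ proj₁ A ] ≈ e Ê A
        indicator A with identity-cases Ê A
        ... | inj₁ (≡.refl , one) = trans (⊆-refl E) (sym one)
        ... | inj₂ (Ê≢A , nil) with ⊆-or-0 E (proj₁ A)
        ...   | inj₁ z = trans z (sym nil)
        ...   | inj₂ p = ⊥-elim (ℕₚ.<-irrefl (≡.trans p ∣E∣) (intersection-< Ê A Ê≢A))

    rank-one-psd : ∀ (x : V → Carrier) → PositiveSemidefinite G (λ A B → x A * x B)
    rank-one-psd x = (λ A B → *-comm _ _) , λ y → ≤-resp refl (sym (eq y)) (0≤x*x (∑ⱽ λ A → y A * x A))
      where
      eq : ∀ y → ∑ⱽ (λ A → ∑ⱽ λ B → y A * (x A * x B) * y B) ≈ ∑ⱽ (λ A → y A * x A) * ∑ⱽ (λ A → y A * x A)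
      eq y = trans
        (∑∑-cong (λ A B → y A * (x A * x B) * y B) (λ A B → (y A * x A) * (y B * x B))
          (λ A B → solve 4 (λ a b c d → a :* (b :* c) :* d := a :* b :* (d :* c)) refl (y A) (x A) (x B) (y B)))
        (trans (∑-cong {λ A → ∑ⱽ λ B → (y A * x A) * (y B * x B)} {λ A → (y A * x A) * ∑ⱽ (λ B → y B * x B)}
                 (λ A → ∑-*ˡ (y A * x A) (λ B → y B * x B)))
          (∑-*ʳ (∑ⱽ (λ B → y B * x B)) (λ A → y A * x A)))

    module _ (χ : ℕ → Bool) where
      open Order χ using (_≼_; slack)

      private
        on-diagonal : ∀ {u : ℕ → Carrier} {t} → (∀ x → Support k χ x → β 0 x + u x ≈ t * β k x) → β 0 k + u k ≈ t
        on-diagonal eq = trans (eq k (inj₂ ≡.refl)) (trans (*-congˡ (β-diag k)) (*-identityʳ _))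

        off-diagonal : ∀ {u : ℕ → Carrier} {t x} → (∀ x → Support k χ x → β 0 x + u x ≈ t * β k x) →
          x ℕ.< k → χ x ≡ true → β 0 x + u x ≈ 0#
        off-diagonal eq x<k χx = trans (eq _ (inj₁ (x<k , χx))) (trans (*-congˡ (β-< x<k)) (zeroʳ _))

      -- Weak duality: adding ⟨B,u⟩ ≥ 0 replaces the weight 1 by 1 + u. This is t on the diagonal,
      -- where B has trace 1; off it either the size is selected and 1 + u = 0, or it is not in L
      -- and B vanishes on the edge.
      ϑ-upper : (∀ x → χ x ≡ false → x ∉ L) → ∀ {t} → β 0 ≼ (λ x → t * β k x) → ϑ G ≤ t
      ϑ-upper sound {t} (slack u p eq) = attained (proj₁ (ϑ-isLovászNumber G))
        where
        open <R
        attained : (∃ λ B → Feasible G B × total G B ≈ ϑ G) → ϑ G ≤ t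
        attained (B , (psdB , tr , edge) , tot) = begin
          ϑ G                      ≈⟨ tot ⟨
          total G B                ≤⟨ x≤x+y _ (nonneg p B psdB) ⟩
          total G B + ⟨ B , u ⟩    ≈⟨ ∑∑-+ B (B ∙ u) ⟨
          ∑ⱽ (λ A → ∑ⱽ λ A′ → B A A′ + (B ∙ u) A A′)
            ≈⟨ ∑∑-cong (λ A A′ → B A A′ + (B ∙ u) A A′) (λ A A′ → e A A′ * (B A A′ * t)) entry ⟩
          ∑ⱽ (λ A → ∑ⱽ λ A′ → e A A′ * (B A A′ * t))
            ≈⟨ ∑-cong {λ A → ∑ⱽ λ A′ → e A A′ * (B A A′ * t)} {λ A → B A A * t}
                 (λ A → ∑ⱽ-diag A (λ A′ → B A A′ * t)) ⟩
          ∑ⱽ (λ A → B A A * t)     ≈⟨ ∑-*ʳ t (λ A → B A A) ⟩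
          trace G B * t            ≈⟨ *-congʳ tr ⟩
          1# * t                   ≈⟨ *-identityˡ t ⟩
          t                        ∎
          where
          factorise : ∀ b v x → b + b * v ≈ b * (β 0 x + v)
          factorise b v x = trans (+-congʳ (sym (trans (*-congˡ ⟦1⟧) (*-identityʳ b)))) (sym (distribˡ b _ v))
          entry : ∀ A A′ → B A A′ + (B ∙ u) A A′ ≈ e A A′ * (B A A′ * t)
          entry A A′ with identity-cases A A′
          ... | inj₁ (≡.refl , one) = trans (factorise (B A A) (u x) x) (trans
                  (*-congˡ (trans (reflexive (≡.cong (λ z → β 0 z + u z) (intersection-self A))) (on-diagonal eq)))
                  (sym (trans (*-congʳ one) (*-identityˡ _))))
            where x = ∣ proj₁ A ∩ proj₁ A ∣
          ... | inj₂ (A≢A′ , nil) = trans (vanish (χ x) ≡.refl) (sym (trans (*-congʳ nil) (zeroˡ _)))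
            where
            x = ∣ proj₁ A ∩ proj₁ A′ ∣
            vanish : ∀ b → χ x ≡ b → B A A′ + B A A′ * u x ≈ 0#
            vanish true  χx = trans (factorise (B A A′) (u x) x)
              (trans (*-congˡ (off-diagonal eq (intersection-< A A′ A≢A′) χx)) (zeroʳ _))
            vanish false χx = trans (+-cong B≈0 (trans (*-congʳ B≈0) (zeroˡ _))) (+-identityˡ 0#)
              where
              B≈0 : B A A′ ≈ 0#
              B≈0 = edge A A′ (A≢A′ , sound x χx)

      -- The dual certificate for a graph, suitably scaled, is feasible for its complement.
      ϑ-lower : (∀ x → x ∉ L → χ x ≡ true) → ∀ {t} → 0# < t → β 0 ≼ (λ x → t * β k x) →
        ⟦ n C k ⟧ ≤ ϑ G * t
      ϑ-lower complete {t} 0<t (slack u p eq) = begin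
        N                 ≈⟨ *-identityʳ N ⟨
        N * 1#            ≈⟨ *-congˡ Ntw ⟨
        N * (N * t * w)   ≈⟨ solve 3 (λ N t w → N :* (N :* t :* w) := w :* (N :* N) :* t) refl N t w ⟩
        w * (N * N) * t   ≤⟨ *-monoʳ-≤ (inj₁ 0<t) (*-monoˡ-≤ 0≤w (begin
          N * N                            ≈⟨ NN ⟨
          -- Pairing u with the all-ones matrix, written as a rank-one matrix, is nonnegative; so 1
          -- + u has total at least N².
          ∑ⱽ (λ A → ∑ⱽ λ A′ → 1#)          ≤⟨ x≤x+y _ (nonneg p (λ _ _ → 1# * 1#) (rank-one-psd (λ _ → 1#))) ⟩
          ∑ⱽ (λ A → ∑ⱽ λ A′ → 1#) + ⟨ (λ _ _ → 1# * 1#) , u ⟩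
            ≈⟨ ∑∑-+ (λ _ _ → 1#) ((λ _ _ → 1# * 1#) ∙ u) ⟨
          ∑ⱽ (λ A → ∑ⱽ λ A′ → 1# + 1# * 1# * u ∣ proj₁ A ∩ proj₁ A′ ∣)
            ≈⟨ ∑∑-cong (λ A A′ → 1# + 1# * 1# * u ∣ proj₁ A ∩ proj₁ A′ ∣) (λ A A′ → q ∣ proj₁ A ∩ proj₁ A′ ∣)
                 (λ A A′ → +-cong (sym ⟦1⟧) (trans (*-congʳ (*-identityˡ 1#)) (*-identityˡ _))) ⟩
          ∑ⱽ (λ A → ∑ⱽ λ A′ → q ∣ proj₁ A ∩ proj₁ A′ ∣) ∎)) ⟩
        w * ∑ⱽ (λ A → ∑ⱽ λ A′ → q ∣ proj₁ A ∩ proj₁ A′ ∣) * t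
                          ≈⟨ *-congʳ (∑∑-*ˡ w (λ A A′ → q ∣ proj₁ A ∩ proj₁ A′ ∣)) ⟨
        total G B * t     ≤⟨ *-monoʳ-≤ (inj₁ 0<t) (proj₂ (ϑ-isLovászNumber G) B feasible) ⟩
        ϑ G * t           ∎
        where
        open <R
        N w : Carrier
        N = ⟦ n C k ⟧
        w = (N * t) ⁻¹
        q : ℕ → Carrier
        q x = β 0 x + u x
        0<N : 0# < N
        0<N = ⟦⟧-pos (0<nCk k≤n)
        0≤w : 0# ≤ w
        0≤w = inj₁ (⁻¹-pos (*-pos 0<N 0<t))
        Ntw : N * t * w ≈ 1#
        Ntw = ⁻¹-inverseʳ (pos⇒≉0 (*-pos 0<N 0<t))
        NN : ∑ⱽ (λ A → ∑ⱽ λ A′ → 1#) ≈ N * N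
        NN = trans (∑-cong {λ _ → ∑ⱽ λ _ → 1#} {λ _ → N * 1#} (λ _ → trans ∑ⱽ-1 (sym (*-identityʳ N))))
          (trans (∑-*ˡ N (λ _ → 1#)) (*-congˡ ∑ⱽ-1))
        B : V → V → Carrier
        B A A′ = w * q ∣ proj₁ A ∩ proj₁ A′ ∣
        feasible : Feasible G B
        feasible = (symm , form) , tr , edge
          where
          symm : ∀ A A′ → B A A′ ≈ B A′ A
          symm A A′ = reflexive (≡.cong (λ D → w * q ∣ D ∣) (∩-comm (proj₁ A) (proj₁ A′)))
          form : ∀ x → 0# ≤ ∑ⱽ (λ A → ∑ⱽ λ A′ → x A * B A A′ * x A′)
          form x = ≤-resp refl
            (trans (sym (∑∑-*ˡ w ((λ A A′ → x A * x A′) ∙ q)))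
              (∑∑-cong (λ A A′ → w * ((λ A A′ → x A * x A′) ∙ q) A A′) (λ A A′ → x A * B A A′ * x A′)
                (λ A A′ → solve 4 (λ w a b q → w :* (a :* b :* q) := a :* (w :* q) :* b) refl w (x A) (x A′) _)))
            (*-nonneg 0≤w (nonneg (Psd-+ (Psd-β 0) p) (λ A A′ → x A * x A′) (rank-one-psd x)))
          tr : ∑ⱽ (λ A → B A A) ≈ 1#
          tr = begin-equality
            ∑ⱽ (λ A → B A A)
              ≈⟨ ∑-cong {λ A → B A A} {λ _ → w * t * 1#} (λ A → trans
                   (*-congˡ (trans (reflexive (≡.cong q (intersection-self A))) (on-diagonal eq))) (sym (*-identityʳ _))) ⟩
            ∑ⱽ (λ _ → w * t * 1#) ≈⟨ ∑-*ˡ (w * t) (λ _ → 1#) ⟩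
            w * t * ∑ⱽ (λ _ → 1#) ≈⟨ *-congˡ ∑ⱽ-1 ⟩
            w * t * N             ≈⟨ solve 3 (λ w t N → w :* t :* N := N :* t :* w) refl w t N ⟩
            N * t * w             ≈⟨ Ntw ⟩
            1#                    ∎
          edge : ∀ A A′ → Graph._~_ G A A′ → B A A′ ≈ 0#
          edge A A′ (A≢A′ , x∉L) = trans
            (*-congˡ (off-diagonal eq (intersection-< A A′ A≢A′) (complete _ x∉L))) (zeroʳ w)

  -- Assembly of the two bounds and of the order of growth

  module Theorem (k : ℕ) (0<k : 0 ℕ.< k)
    (L : List ℕ) (sorted : Linked ℕ._<_ L) (L<k : All (ℕ._< k) L) where

    χ χ̄ : ℕ → Bool
    χ = member L
    χ̄ = not ∘ χ

    module Upper = Growth k 0<k L χ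
    module Lower = Growth k 0<k L χ̄
    open Upper using (ν; ι; k≤n; module At)

    s s̄ : ℕ
    s = length L
    s̄ = count χ̄ 0 k

    κL κ̄ f : Carrier
    κL = κ χ 0 k
    κ̄ = κ χ̄ 0 k
    f = ⟦ k ! ⟧

    enumL : Enumerates χ 0 k L
    enumL = enumerates k 0 L sorted (All.universal (λ _ → ℕ.z≤n) L) L<k (λ _ _ → ≡.refl)

    count≡s : count χ 0 k ≡ s
    count≡s = count-enum enumL

    s+s̄ : s ℕ.+ s̄ ≡ k
    s+s̄ = ≡.trans (≡.cong (ℕ._+ s̄) (≡.sym count≡s)) (count-not χ 0 k)

    sound : ∀ x → χ x ≡ false → x ∉ L
    sound x χx x∈L = not-both (dec-true (_∈?_ ℕₚ._≟_ x L) x∈L) χx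

    complement : ∀ x → x ∉ L → χ̄ x ≡ true
    complement x x∉L = ≡.cong not (dec-false (_∈?_ ℕₚ._≟_ x L) x∉L)

    0<κL : 0# < κL
    0<κL = κ-pos χ 0 k

    0<κ̄ : 0# < κ̄
    0<κ̄ = κ-pos χ̄ 0 k

    0<f : 0# < f
    0<f = ⟦⟧-pos (ℕₚ.1≤n! k)

    ϑ[_] : ∀ {n} → k ℕ.≤ n → Carrier
    ϑ[_] {n} h = ϑ (johnson n k L h)

    -- n^(s−1), also for s = 0.
    error : ℕ → Carrier
    error n = ν n ^ s * ι n

    open Upper.Estimate Upper.total-estimate using () renaming (const to a; 0≤const to 0≤a; bounded to below)
    open Lower.Estimate Lower.total-estimate using () renaming (const to ā; 0≤const to 0≤ā; bounded to below̄)

    large-upper : ∀ {n} (h : k ℕ.+ k ℕ.≤ n) → ϑ[ k≤n h ] ≤ κL * ν n ^ s + a * error n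
    large-upper {n} h = ≤-resp refl
      (trans (*-congʳ (reflexive (≡.cong (ν n ^_) count≡s)))
        (solve 4 (λ v κ a i → v :* (κ :+ a :* i) := κ :* v :+ a :* (v :* i)) refl (ν n ^ s) κL a (ι n)))
      (Vertices.ϑ-upper L (k≤n h) χ sound (below h))

    lead : ∃ λ c₀ → 0# ≤ c₀ × (∀ {n} (h : k ℕ.+ k ℕ.≤ n) → ν n ^ k ≤ ⟦ n C k ⟧ * f + c₀ * (ν n ^ k * ι n))
    lead = lemma k 0<k
      where
      lemma : ∀ k′ → 0 ℕ.< k′ → ∃ λ c₀ → 0# ≤ c₀ ×
        (∀ {n} (h : k ℕ.+ k ℕ.≤ n) → ν n ^ k′ ≤ ⟦ n C k′ ⟧ * ⟦ k′ ! ⟧ + c₀ * (ν n ^ k′ * ι n))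
      lemma (suc k′) _ = ⟦ c ⟧ , ⟦⟧-nonneg c , λ {n} h → ≤-resp
        (⟦⟧-^ n (suc k′))
        (trans (⟦⟧-+ ((n C suc k′) ℕ.* suc k′ !) (c ℕ.* n ℕ.^ k′)) (+-cong (⟦⟧-* (n C suc k′) (suc k′ !))
          (trans (⟦⟧-* c (n ℕ.^ k′)) (*-congˡ (trans (⟦⟧-^ n k′) (sym (cancel-ν h k′)))))))
        (⟦⟧-mono (bd n))
        where
        c = proj₁ (^≤C*! k′)
        bd = proj₂ (^≤C*! k′)
        cancel-ν : ∀ {n} (h : k ℕ.+ k ℕ.≤ n) m → ν n ^ suc m * ι n ≈ ν n ^ m
        cancel-ν {n} h m = trans (solve 3 (λ v w i → v :* w :* i := v :* i :* w) refl (ν n) (ν n ^ m) (ι n))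
          (trans (*-congʳ (At.νι h)) (*-identityˡ _))

    c₀ c : Carrier
    c₀ = proj₁ lead
    -- Since κL κ̄ k! = 1, this makes c κ̄ k! equal to κL ā k! + c₀, the sum of the error of the
    -- complementary certificate and that of C(n,k) k! against n^k.
    c = κL * (κL * ā * f + c₀)

    0≤c : 0# ≤ c
    0≤c = *-nonneg (inj₁ 0<κL) (+-nonneg (*-nonneg (*-nonneg (inj₁ 0<κL) 0≤ā) (inj₁ 0<f)) (proj₁ (proj₂ lead)))

    cκ̄f : c * (κ̄ * f) ≈ κL * ā * f + c₀
    cκ̄f = trans (solve 4 (λ κ x κ̄ f → κ :* x :* (κ̄ :* f) := κ :* κ̄ :* f :* x) refl κL _ κ̄ f)
      (trans (*-congʳ (κκ̄k! χ k)) (*-identityˡ _))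

    -- The bound C(n,k)/t, with t the value of the complementary certificate, is handled without
    -- division: after multiplying by t k! the main term on the left is exactly n^k, because κL κ̄
    -- k! = 1 and s + s̄ = k.
    large-lower : ∀ {n} (h : k ℕ.+ k ℕ.≤ n) → κL * ν n ^ s ≤ ϑ[ k≤n h ] + c * error n
    large-lower {n} h = *-cancelˡ-≤ (*-pos 0<t 0<f) (begin
      t * f * (κL * ν n ^ s)
        ≈⟨ solve 7 (λ w κ̄ ā i f κ v → w :* (κ̄ :+ ā :* i) :* f :* (κ :* v) :=
             v :* w :* (κ :* κ̄ :* f) :+ v :* w :* i :* (κ :* ā :* f)) refl
             (ν n ^ s̄) κ̄ ā (ι n) f κL (ν n ^ s) ⟩
      ν n ^ s * ν n ^ s̄ * (κL * κ̄ * f) + ν n ^ s * ν n ^ s̄ * ι n * (κL * ā * f)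
        ≈⟨ +-cong (trans (*-cong ν^k (κκ̄k! χ k)) (*-identityʳ _)) (*-congʳ (*-congʳ ν^k)) ⟩
      ν n ^ k + ν n ^ k * ι n * (κL * ā * f)
        ≤⟨ +-monoˡ-≤ _ (proj₂ (proj₂ lead) h) ⟩
      ⟦ n C k ⟧ * f + c₀ * (ν n ^ k * ι n) + ν n ^ k * ι n * (κL * ā * f)
        ≈⟨ solve 4 (λ N c₀ x y → N :+ c₀ :* x :+ x :* y := N :+ x :* (y :+ c₀)) refl
             (⟦ n C k ⟧ * f) c₀ (ν n ^ k * ι n) (κL * ā * f) ⟩
      ⟦ n C k ⟧ * f + ν n ^ k * ι n * (κL * ā * f + c₀)
        ≈⟨ +-congˡ (*-congˡ cκ̄f) ⟨
      ⟦ n C k ⟧ * f + ν n ^ k * ι n * (c * (κ̄ * f))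
        ≤⟨ +-mono-≤ (*-monoʳ-≤ (inj₁ 0<f) N≤ϑt)
             (*-monoˡ-≤ (*-nonneg (At.0≤ν^ h k) (inj₁ (At.0<ι h)))
               (*-monoˡ-≤ 0≤c (*-monoʳ-≤ (inj₁ 0<f) (x≤x+y κ̄ (*-nonneg 0≤ā (inj₁ (At.0<ι h))))))) ⟩
      ϑ[ k≤n h ] * t * f + ν n ^ k * ι n * (c * ((κ̄ + ā * ι n) * f))
        ≈⟨ +-congˡ (*-congʳ (*-congʳ ν^k)) ⟨
      ϑ[ k≤n h ] * t * f + ν n ^ s * ν n ^ s̄ * ι n * (c * ((κ̄ + ā * ι n) * f))
        ≈⟨ solve 7 (λ θ v w i c z f → θ :* (w :* z) :* f :+ v :* w :* i :* (c :* (z :* f)) :=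
             w :* z :* f :* (θ :+ c :* (v :* i))) refl ϑ[ k≤n h ] (ν n ^ s) (ν n ^ s̄) (ι n) c (κ̄ + ā * ι n) f ⟩
      t * f * (ϑ[ k≤n h ] + c * error n) ∎)
      where
      open <R
      t : Carrier
      t = ν n ^ s̄ * (κ̄ + ā * ι n)
      0<t : 0# < t
      0<t = *-pos (^-pos (At.0<ν h) s̄) (<-≤-trans 0<κ̄ (x≤x+y κ̄ (*-nonneg 0≤ā (inj₁ (At.0<ι h)))))
      ν^k : ν n ^ s * ν n ^ s̄ ≈ ν n ^ k
      ν^k = trans (sym (^-homo-* (ν n) s s̄)) (reflexive (≡.cong (ν n ^_) s+s̄))
      N≤ϑt : ⟦ n C k ⟧ ≤ ϑ[ k≤n h ] * t
      N≤ϑt = Vertices.ϑ-lower L (k≤n h) χ̄ complement 0<t (below̄ h)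

    -- Independent of a proof of k ≤ n, with the dummy value 0 where there is no graph, so that a
    -- bound over an initial segment of n can be taken.
    ϑ-at : ℕ → Carrier
    ϑ-at n with k ℕₚ.≤? n
    ... | yes h = ϑ[ h ]
    ... | no  _ = 0#

    ϑ-at≡ : ∀ {n} (h : k ℕ.≤ n) → ϑ-at n ≡ ϑ[ h ]
    ϑ-at≡ {n} h with k ℕₚ.≤? n
    ... | yes h′ = ≡.cong ϑ[_] (ℕₚ.≤-irrelevant h′ h)
    ... | no ¬h  = ⊥-elim (¬h h)

    -- Covers the finitely many n below 2k, outside the reach of the estimates: `error` is positive
    -- there, so one multiple of it dominates all values.
    absorb-small : ∀ (g : ℕ → Carrier) → ∃ λ A → 0# ≤ A ×
      (∀ n → 0 ℕ.< n → n ℕ.< k ℕ.+ k → g n ≤ A * error n)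
    absorb-small g =
      let A , 0≤A , b = initial-segment-bound (λ n → g n * error n ⁻¹) (k ℕ.+ k) in
      A , 0≤A , λ n 0<n n<2k →
        let 0<e : 0# < error n
            0<e = *-pos (^-pos (⟦⟧-pos 0<n) s) (⁻¹-pos (⟦⟧-pos 0<n))
        in ≤-resp (trans (*-assoc _ _ _) (trans (*-congˡ (⁻¹-inverseˡ (pos⇒≉0 0<e))) (*-identityʳ _))) refl
             (*-monoʳ-≤ (inj₁ 0<e) (b n n<2k))

    error-nonneg : ∀ n → 0 ℕ.< n → 0# ≤ error n
    error-nonneg n 0<n = *-nonneg (^-nonneg (⟦⟧-nonneg n) s) (inj₁ (⁻¹-pos (⟦⟧-pos 0<n)))

    upper : ∃ λ A → 0# ≤ A × (∀ n (h : k ℕ.< n) → ϑ[ <⇒≤ h ] ≤ K k L * ν n ^ s + A * error n)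
    upper = let A , 0≤A , small = absorb-small ϑ-at in a + A , +-nonneg 0≤a 0≤A , λ n k<n →
        ≤-resp refl (+-congʳ (*-congʳ (sym (K≈κ k L sorted L<k enumL))))
          (case n k<n A 0≤A small (ℕₚ.<-≤-connex n (k ℕ.+ k)))
      where
      case : ∀ n (k<n : k ℕ.< n) A → 0# ≤ A → (∀ n → 0 ℕ.< n → n ℕ.< k ℕ.+ k → ϑ-at n ≤ A * error n) →
        n ℕ.< k ℕ.+ k ⊎ k ℕ.+ k ℕ.≤ n → ϑ[ <⇒≤ k<n ] ≤ κL * ν n ^ s + (a + A) * error n
      case n k<n A 0≤A small (inj₁ n<2k) = begin
        ϑ[ <⇒≤ k<n ]                       ≡⟨ ϑ-at≡ (<⇒≤ k<n) ⟨
        ϑ-at n                             ≤⟨ small n 0<n n<2k ⟩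
        A * error n                        ≤⟨ x≤x+y _ (*-nonneg 0≤a (error-nonneg n 0<n)) ⟩
        A * error n + a * error n          ≈⟨ trans (+-comm _ _) (sym (distribʳ _ _ _)) ⟩
        (a + A) * error n                  ≤⟨ x≤x+y _ (*-nonneg (inj₁ 0<κL) (^-nonneg (⟦⟧-nonneg n) s)) ⟩
        (a + A) * error n + κL * ν n ^ s   ≈⟨ +-comm _ _ ⟩
        κL * ν n ^ s + (a + A) * error n   ∎
        where
        open <R
        0<n : 0 ℕ.< n
        0<n = ℕₚ.<-trans 0<k k<n
      case n k<n A 0≤A small (inj₂ h) = begin
        ϑ[ <⇒≤ k<n ]                       ≡⟨ ≡.cong ϑ[_] (ℕₚ.≤-irrelevant (<⇒≤ k<n) (k≤n h)) ⟩
        ϑ[ k≤n h ]                         ≤⟨ large-upper h ⟩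
        κL * ν n ^ s + a * error n         ≤⟨ +-monoʳ-≤ _ (*-monoʳ-≤ (error-nonneg n 0<n) (x≤x+y a 0≤A)) ⟩
        κL * ν n ^ s + (a + A) * error n   ∎
        where
        open <R
        0<n : 0 ℕ.< n
        0<n = ℕₚ.<-trans 0<k k<n

    lower : ∃ λ A → 0# ≤ A × (∀ n (h : k ℕ.< n) → K k L * ν n ^ s ≤ ϑ[ <⇒≤ h ] + A * error n)
    lower = let A , 0≤A , small = absorb-small excess in c + A , +-nonneg 0≤c 0≤A , λ n k<n →
        ≤-resp (*-congʳ (sym (K≈κ k L sorted L<k enumL))) refl
          (case n k<n A 0≤A small (ℕₚ.<-≤-connex n (k ℕ.+ k)))
      where
      excess : ℕ → Carrier
      excess n = κL * ν n ^ s - ϑ-at n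
      case : ∀ n (k<n : k ℕ.< n) A → 0# ≤ A → (∀ n → 0 ℕ.< n → n ℕ.< k ℕ.+ k → excess n ≤ A * error n) →
        n ℕ.< k ℕ.+ k ⊎ k ℕ.+ k ℕ.≤ n → κL * ν n ^ s ≤ ϑ[ <⇒≤ k<n ] + (c + A) * error n
      case n k<n A 0≤A small (inj₁ n<2k) = begin
        κL * ν n ^ s                        ≈⟨ y-x+x≈y (ϑ-at n) _ ⟨
        excess n + ϑ-at n                   ≤⟨ +-monoˡ-≤ _ (small n 0<n n<2k) ⟩
        A * error n + ϑ-at n                ≡⟨ ≡.cong (λ z → A * error n + z) (ϑ-at≡ (<⇒≤ k<n)) ⟩
        A * error n + ϑ[ <⇒≤ k<n ]          ≈⟨ +-comm _ _ ⟩
        ϑ[ <⇒≤ k<n ] + A * error n          ≤⟨ +-monoʳ-≤ _ (*-monoʳ-≤ (error-nonneg n 0<n)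
                                                 (≤-resp refl (+-comm A c) (x≤x+y A 0≤c))) ⟩
        ϑ[ <⇒≤ k<n ] + (c + A) * error n    ∎
        where
        open <R
        0<n : 0 ℕ.< n
        0<n = ℕₚ.<-trans 0<k k<n
      case n k<n A 0≤A small (inj₂ h) = begin
        κL * ν n ^ s                        ≤⟨ large-lower h ⟩
        ϑ[ k≤n h ] + c * error n            ≡⟨ ≡.cong (λ p → ϑ[ p ] + c * error n) (ℕₚ.≤-irrelevant (k≤n h) (<⇒≤ k<n)) ⟩
        ϑ[ <⇒≤ k<n ] + c * error n          ≤⟨ +-monoʳ-≤ _ (*-monoʳ-≤ (error-nonneg n (ℕₚ.<-trans 0<k k<n)) (x≤x+y c 0≤A)) ⟩
        ϑ[ <⇒≤ k<n ] + (c + A) * error n    ∎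
        where open <R

    error≈ : ∀ n → 0 ℕ.< n → error n ≈ ⟦ n ⟧ ^ᶻ pred (+ s)
    error≈ n 0<n = go s
      where
      go : ∀ s → ⟦ n ⟧ ^ s * ⟦ n ⟧ ⁻¹ ≈ ⟦ n ⟧ ^ᶻ pred (+ s)
      -- For s = 0 the exponent `pred (+ 0)` is -1, and the error term is 1/n.
      go zero    = *-comm _ _
      go (suc s) = trans (solve 3 (λ v w i → v :* w :* i := v :* i :* w) refl ⟦ n ⟧ (⟦ n ⟧ ^ s) (⟦ n ⟧ ⁻¹))
        (trans (*-congʳ (⁻¹-inverseʳ (pos⇒≉0 (⟦⟧-pos 0<n)))) (*-identityˡ _))

    0<K : 0# < K k L
    0<K = <-resp₂ refl (sym (K≈κ k L sorted L<k enumL)) 0<κL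

    Θ : IsΘ (λ n (k<n : k ℕ.< n) → ϑ (johnson n k L (<⇒≤ k<n))) (λ n → ⟦ n ⟧ ^ s)
    Θ =
      -- η is half of K. From n₀ > B/η on, the error B/n is at most the other half.
      let η , 0<η , η+η     = half 0<K
          A , 0≤A , up      = upper
          B , 0≤B , low     = lower
          n₀ , n₀>          = archimedean (B * η ⁻¹)
      in η , K k L + A , 0<η , <-≤-trans 0<K (x≤x+y _ 0≤A) , n₀ , λ n k<n n₀≤n →
         lower-half η 0<η η+η B 0≤B low n₀ n₀> n k<n n₀≤n , upper-half A 0≤A up n k<n
      where
      open <R
      upper-half : ∀ A → 0# ≤ A → (∀ n (h : k ℕ.< n) → ϑ[ <⇒≤ h ] ≤ K k L * ν n ^ s + A * error n) →
        ∀ n (k<n : k ℕ.< n) → ϑ[ <⇒≤ k<n ] ≤ (K k L + A) * ν n ^ s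
      upper-half A 0≤A up n k<n = begin
        ϑ[ <⇒≤ k<n ]                        ≤⟨ up n k<n ⟩
        K k L * ν n ^ s + A * (ν n ^ s * ι n)
          ≤⟨ +-monoʳ-≤ _ (*-monoˡ-≤ 0≤A (*-monoˡ-≤ (^-nonneg (⟦⟧-nonneg n) s) ι≤1)) ⟩
        K k L * ν n ^ s + A * (ν n ^ s * 1#) ≈⟨ +-congˡ (*-congˡ (*-identityʳ _)) ⟩
        K k L * ν n ^ s + A * ν n ^ s        ≈⟨ distribʳ _ _ _ ⟨
        (K k L + A) * ν n ^ s                ∎
        where
        0<n : 0 ℕ.< n
        0<n = ℕₚ.<-trans 0<k k<n
        ι≤1 : ι n ≤ 1#
        ι≤1 = *-cancelˡ-≤ (⟦⟧-pos 0<n) (begin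
          ν n * ι n ≈⟨ ⁻¹-inverseʳ (pos⇒≉0 (⟦⟧-pos 0<n)) ⟩
          1#        ≈⟨ ⟦1⟧ ⟨
          ⟦ 1 ⟧     ≤⟨ ⟦⟧-mono 0<n ⟩
          ν n       ≈⟨ *-identityʳ _ ⟨
          ν n * 1#  ∎)
      lower-half : ∀ η → 0# < η → η + η ≈ K k L → ∀ B → 0# ≤ B →
        (∀ n (h : k ℕ.< n) → K k L * ν n ^ s ≤ ϑ[ <⇒≤ h ] + B * error n) →
        ∀ n₀ → B * η ⁻¹ < ⟦ n₀ ⟧ → ∀ n (k<n : k ℕ.< n) → n₀ ℕ.≤ n → η * ν n ^ s ≤ ϑ[ <⇒≤ k<n ]
      lower-half η 0<η η+η B 0≤B low n₀ n₀> n k<n n₀≤n = ≮⇒≥ λ θ<ην →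
        <-irrefl refl (begin-strict
          K k L * ν n ^ s                       ≤⟨ low n k<n ⟩
          ϑ[ <⇒≤ k<n ] + B * (ν n ^ s * ι n)    <⟨ +-monoˡ-< _ θ<ην ⟩
          η * ν n ^ s + B * (ν n ^ s * ι n)
            ≈⟨ +-congˡ (solve 3 (λ B v i → B :* (v :* i) := B :* i :* v) refl B (ν n ^ s) (ι n)) ⟩
          η * ν n ^ s + B * ι n * ν n ^ s       ≤⟨ +-monoʳ-≤ _ (*-monoʳ-≤ (^-nonneg (⟦⟧-nonneg n) s) Bι≤η) ⟩
          η * ν n ^ s + η * ν n ^ s             ≈⟨ distribʳ _ _ _ ⟨
          (η + η) * ν n ^ s                     ≈⟨ *-congʳ η+η ⟩
          K k L * ν n ^ s                       ∎)
        where
        0<n : 0 ℕ.< n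
        0<n = ℕₚ.<-trans 0<k k<n
        0<ν : 0# < ν n
        0<ν = ⟦⟧-pos 0<n
        Bι≤η : B * ι n ≤ η
        Bι≤η = begin
          B * ι n                   ≈⟨ *-identityˡ _ ⟨
          1# * (B * ι n)            ≈⟨ *-congʳ (⁻¹-inverseʳ (pos⇒≉0 0<η)) ⟨
          η * η ⁻¹ * (B * ι n)      ≈⟨ solve 4 (λ η δ B i → η :* δ :* (B :* i) := B :* δ :* (η :* i)) refl η (η ⁻¹) B (ι n) ⟩
          B * η ⁻¹ * (η * ι n)      ≤⟨ *-monoʳ-≤ (*-nonneg (inj₁ 0<η) (inj₁ (⁻¹-pos 0<ν)))
                                         (≤-trans (inj₁ n₀>) (⟦⟧-mono n₀≤n)) ⟩
          ν n * (η * ι n)           ≈⟨ solve 3 (λ v η i → v :* (η :* i) := v :* i :* η) refl (ν n) η (ι n) ⟩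
          ν n * ι n * η             ≈⟨ trans (*-congʳ (⁻¹-inverseʳ (pos⇒≉0 0<ν))) (*-identityˡ η) ⟩
          η                         ∎

theorem1 : (ℝ : CompleteOrderedField) → let open Lovász ℝ in
    (k : ℕ) → 0 ℕ.< k →
    (L : List ℕ) → Linked ℕ._<_ L → All (ℕ._< k) L →
    let s = length L in
    (∃ λ c → ∀ n (k<n : k ℕ.< n) →
    K k L * ⟦ n ⟧ ^ s - c * ⟦ n ⟧ ^ᶻ pred (+ s) ≤ ϑ (johnson n k L (<⇒≤ k<n)))
    ×
    (∃ λ C → ∀ n (k<n : k ℕ.< n) →
    ϑ (johnson n k L (<⇒≤ k<n)) ≤ K k L * ⟦ n ⟧ ^ s + C * ⟦ n ⟧ ^ᶻ pred (+ s))
    ×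
    IsΘ (λ n (k<n : k ℕ.< n) → ϑ (johnson n k L (<⇒≤ k<n))) (λ n → ⟦ n ⟧ ^ s)
theorem1 ℝ k 0<k L sorted L<k =
  (proj₁ lower , λ n k<n → ≤-resp (+-congˡ (-‿cong (*-congˡ (error≈ n (ℕₚ.<-trans 0<k k<n)))))
      (trans (+-assoc _ _ _) (trans (+-congˡ (-‿inverseʳ _)) (+-identityʳ _)))
      (+-monoˡ-≤ _ (proj₂ (proj₂ lower) n k<n))) ,
  (proj₁ upper , λ n k<n → ≤-resp refl (+-congˡ (*-congˡ (error≈ n (ℕₚ.<-trans 0<k k<n))))
      (proj₂ (proj₂ upper) n k<n)) ,
  Θ
  where
  open Proof ℝ
  open Theorem k 0<k L sorted L<k
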